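{- Let $Q$ be any binary quadratic form in the sense below (not necessarily irreducible or indefinite). (1) If $Q\notin\mathcal{F}_+\cup\mathcal{F}_-$, then $\mathcal{S}(Q)=\{\pm I\}$. (2) If $Q\in\mathcal{F}_+$, then $\mathcal{S}(Q)=\chi_Q(\mathcal{U}_f)\cong(\mathbb{Z}/2\mathbb{Z})\times\mathbb{Z}$, where $f$ is the conductor of $Q$. (3) If $Q\in\mathcal{F}_-$, then $\mathcal{S}(Q)=\langle SQ\rangle\cong\mathbb{Z}/4\mathbb{Z}$ if $\Delta(Q)=-4$; $\mathcal{S}(Q)=\langle \tfrac12 I+SQ\rangle\cong\mathbb{Z}/6\mathbb{Z}$ if $\Delta(Q)=-3$; $\mathcal{S}(Q)=\langle -I,\ I+SQ\rangle\cong(\mathbb{Z}/2\mathbb{Z})\times\mathbb{Z}$ if $\Delta(Q)=0$; $\mathcal{S}(Q)=\langle -I,\ 2SQ\rangle\cong(\mathbb{Z}/2\mathbb{Z})\times(\mathbb{Z}/2\mathbb{Z})$ if $\Delta(Q)=1$; $\mathcal{S}(Q)=\langle -I,\ SQ\rangle\cong(\mathbb{Z}/2\mathbb{Z})\times(\mathbb{Z}/2\mathbb{Z})$ if $\Delta(Q)=4$.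
   Context: Here a form is $Q(x,y)=ax^2+bxy+cy^2$ with $a,b,c$ coprime integers, identified with the matrix $Q=\begin{pmatrix}a&b/2\\ b/2&c\end{pmatrix}$; its discriminant is $\Delta(Q)=b^2-4ac$. $\mathcal{S}(Q)=\{M\in GL_2(\mathbb{Z}):\det(M)M^{T}QM=Q\}$ is the stability group. $S=\begin{pmatrix}0&-1\\1&0\end{pmatrix}$. $\mathcal{F}_+$ is the set of forms that are indefinite and irreducible over $\mathbb{Q}$; $\mathcal{F}_-$ is the set of forms with discriminant in $\{ -4,-3,0,1,4\}$. For $Q\in\mathcal{F}_+$ with discriminant $\Delta$: let $D$ be the square-free part of $\Delta$, $\Delta_0=D$ if $D\equiv1\pmod4$ and $\Delta_0=4D$ otherwise, $f=\sqrt{\Delta/\Delta_0}$ (the conductor), $K=\mathbb{Q}(\sqrt{\Delta_0})$, $\mathcal{O}_f=\{m+nf\frac{\Delta_0+\sqrt{\Delta_0}}{2}:m,n\in\mathbb{Z}\}$, $\mathcal{U}_f=\mathcal{O}_f^\times$, and $\chi_Q:K\to M_2(\mathbb{Q})$, $\chi_Q(x+y\sqrt{\Delta_0})=xI+\frac{2y}{f}SQ$. -}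

module Defs where

open import Data.Nat using (ℕ; NonZero)
open import Data.Integer as ℤ using (ℤ; +_)
open import Data.Integer.Divisibility using (_∣_)
open import Data.Rational as ℚ using (ℚ; _/_; 0ℚ; 1ℚ; ½)
open import Data.Product using (Σ; _×_; _,_; ∃; ∃-syntax)
open import Data.Sum using (_⊎_)
open import Data.List using (List)
open import Data.List.Membership.Propositional using (_∈_)
open import Relation.Binary.PropositionalEquality using (_≡_)
open import Relation.Nullary using (¬_)
open import Function.Bundles using (_⇔_)

record Form : Set where
  constructor form
  field
    a b c : ℤ
open Form public

Primitive : Form → Set
Primitive Q = ∀ (d : ℤ) → d ∣ a Q → d ∣ b Q → d ∣ c Q → d ∣ (+ 1)

disc : Form → ℤ
disc Q = b Q ℤ.* b Q ℤ.- (+ 4) ℤ.* a Q ℤ.* c Q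

eval : Form → ℤ → ℤ → ℤ
eval Q x y = a Q ℤ.* x ℤ.* x ℤ.+ b Q ℤ.* x ℤ.* y ℤ.+ c Q ℤ.* y ℤ.* y

Indefinite : Form → Set
Indefinite Q = (∃[ x ] ∃[ y ] (+ 0) ℤ.< eval Q x y) × (∃[ x ] ∃[ y ] eval Q x y ℤ.< (+ 0))

-- reducible over ℚ: a product of two rational linear forms
-- (px + qy)(rx + sy), compared coefficientwise
ReducibleOverℚ : Form → Set
ReducibleOverℚ Q = ∃[ p ] ∃[ q ] ∃[ r ] ∃[ s ]
  ((a Q / 1 ≡ p ℚ.* r) × (b Q / 1 ≡ p ℚ.* s ℚ.+ q ℚ.* r) × (c Q / 1 ≡ q ℚ.* s))

IrreducibleOverℚ : Form → Set
IrreducibleOverℚ Q = ¬ ReducibleOverℚ Q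

F₊ : Form → Set
F₊ Q = Indefinite Q × IrreducibleOverℚ Q

F₋ : Form → Set
F₋ Q = (disc Q ≡ ℤ.- (+ 4)) ⊎ (disc Q ≡ ℤ.- (+ 3)) ⊎ (disc Q ≡ + 0)
     ⊎ (disc Q ≡ + 1) ⊎ (disc Q ≡ + 4)

record Mat : Set where
  constructor mat
  field
    m11 m12 m21 m22 : ℚ
open Mat public

infixl 7 _·_
_·_ : Mat → Mat → Mat
A · B = mat (m11 A ℚ.* m11 B ℚ.+ m12 A ℚ.* m21 B) (m11 A ℚ.* m12 B ℚ.+ m12 A ℚ.* m22 B)
            (m21 A ℚ.* m11 B ℚ.+ m22 A ℚ.* m21 B) (m21 A ℚ.* m12 B ℚ.+ m22 A ℚ.* m22 B)

_⊕_ : Mat → Mat → Mat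
A ⊕ B = mat (m11 A ℚ.+ m11 B) (m12 A ℚ.+ m12 B) (m21 A ℚ.+ m21 B) (m22 A ℚ.+ m22 B)

_⊛_ : ℚ → Mat → Mat
t ⊛ A = mat (t ℚ.* m11 A) (t ℚ.* m12 A) (t ℚ.* m21 A) (t ℚ.* m22 A)

transpose : Mat → Mat
transpose A = mat (m11 A) (m21 A) (m12 A) (m22 A)

det : Mat → ℚ
det A = m11 A ℚ.* m22 A ℚ.- m12 A ℚ.* m21 A

I : Mat
I = mat 1ℚ 0ℚ 0ℚ 1ℚ

-I : Mat
-I = mat (ℚ.- 1ℚ) 0ℚ 0ℚ (ℚ.- 1ℚ)

S : Mat
S = mat 0ℚ (ℚ.- 1ℚ) 1ℚ 0ℚ

toMat : Form → Mat
toMat Q = mat (a Q / 1) (b Q / 2) (b Q / 2) (c Q / 1)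

SQ : Form → Mat
SQ Q = S · toMat Q

IsInt : ℚ → Set
IsInt q = ∃[ z ] q ≡ z / 1

IntMat : Mat → Set
IntMat A = IsInt (m11 A) × IsInt (m12 A) × IsInt (m21 A) × IsInt (m22 A)

GL₂ℤ : Mat → Set
GL₂ℤ M = IntMat M × ∃[ N ] (IntMat N × (M · N ≡ I) × (N · M ≡ I))

Stab : Form → Mat → Set
Stab Q M = GL₂ℤ M × (det M ⊛ (transpose M · toMat Q · M) ≡ toMat Q)

data Gen (gs : List Mat) : Mat → Set where
  gen-one : Gen gs I
  gen-gen : ∀ {g} → g ∈ gs → Gen gs g
  gen-mul : ∀ {A B} → Gen gs A → Gen gs B → Gen gs (A · B)
  gen-inv : ∀ {A B} → Gen gs A → A · B ≡ I → B · A ≡ I → Gen gs B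

-- Group isomorphisms  ℤ²/L ≅ H  where H is a set of matrices
-- (a group under matrix multiplication).  Finitely generated abelian
-- groups are presented as quotients of ℤ² (setoid-style: no quotients
-- in Agda).

_+²_ : ℤ × ℤ → ℤ × ℤ → ℤ × ℤ
(x₁ , y₁) +² (x₂ , y₂) = (x₁ ℤ.+ x₂ , y₁ ℤ.+ y₂)

_-²_ : ℤ × ℤ → ℤ × ℤ → ℤ × ℤ
(x₁ , y₁) -² (x₂ , y₂) = (x₁ ℤ.- x₂ , y₁ ℤ.- y₂)

record IsoFromℤ²/ (L : ℤ × ℤ → Set) (H : Mat → Set) : Set where
  field
    φ     : ℤ × ℤ → Mat
    into  : ∀ v → H (φ v)
    onto  : ∀ M → H M → ∃[ v ] φ v ≡ M
    hom   : ∀ v w → φ (v +² w) ≡ φ v · φ w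
    ker   : ∀ v w → (φ v ≡ φ w) ⇔ L (v -² w)

L-ℤ/n : ℕ → ℤ × ℤ → Set          -- ℤ²/(nℤ × ℤ) ≅ ℤ/nℤ
L-ℤ/n n (x , y) = + n ∣ x

L-ℤ/2×ℤ : ℤ × ℤ → Set
L-ℤ/2×ℤ (x , y) = (+ 2 ∣ x) × (y ≡ + 0)

L-ℤ/2×ℤ/2 : ℤ × ℤ → Set
L-ℤ/2×ℤ/2 (x , y) = (+ 2 ∣ x) × (+ 2 ∣ y)

SquareFree : ℤ → Set
SquareFree D = ∀ (n : ℕ) → + (n Data.Nat.* n) ∣ D → n ≡ 1

SquareFreePart : ℤ → ℤ → Set
SquareFreePart Δ D = SquareFree D × ∃[ k ] Δ ≡ D ℤ.* k ℤ.* k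

FundDisc : ℤ → ℤ → Set
FundDisc D Δ₀ = ((+ 4 ∣ (D ℤ.- + 1)) × Δ₀ ≡ D) ⊎ (¬ (+ 4 ∣ (D ℤ.- + 1)) × Δ₀ ≡ + 4 ℤ.* D)

Conductor : ℤ → ℤ → ℕ → Set
Conductor Δ Δ₀ f = + (f Data.Nat.* f) ℤ.* Δ₀ ≡ Δ

-- elements x + y√Δ₀ of K = ℚ(√Δ₀), as pairs (x , y)
record K : Set where
  constructor _+√_
  field
    re ir : ℚ
open K public

mulK : ℤ → K → K → K
mulK Δ₀ u v = (re u ℚ.* re v ℚ.+ (Δ₀ / 1) ℚ.* ir u ℚ.* ir v) +√ (re u ℚ.* ir v ℚ.+ ir u ℚ.* re v)

oneK : K
oneK = 1ℚ +√ 0ℚ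

-- 𝒪_f = { m + n f (Δ₀ + √Δ₀)/2 }
InOrder : ℤ → ℕ → K → Set
InOrder Δ₀ f u = ∃[ m ] ∃[ n ]
  u ≡ ((m / 1) ℚ.+ (n ℤ.* + f ℤ.* Δ₀) / 2) +√ ((n ℤ.* + f) / 2)

Unit : ℤ → ℕ → K → Set
Unit Δ₀ f u = InOrder Δ₀ f u × ∃[ v ] (InOrder Δ₀ f v × mulK Δ₀ u v ≡ oneK)

χ : Form → (f : ℕ) → .{{NonZero f}} → K → Mat
χ Q f u = (re u ⊛ I) ⊕ ((ℚ._*_ ((+ 2) / f) (ir u)) ⊛ SQ Q)

{-# OPTIONS --safe #-}
module Submission where

open import Defs
open import Data.Nat using (ℕ; NonZero)
open import Data.Integer as ℤ using (ℤ; +_)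
open import Data.Rational as ℚ using (ℚ; _/_; ½)
open import Data.Product using (_×_; ∃-syntax)
open import Data.Sum using (_⊎_)
open import Data.List using (List; []; _∷_)
open import Relation.Binary.PropositionalEquality using (_≡_)
open import Relation.Nullary using (¬_)
open import Function.Bundles using (_⇔_)

import Algebra.Properties.AbelianGroup as AbelianGroupProperties
open import Data.Bool using (Bool; true; false)
open import Data.Empty using (⊥; ⊥-elim)
open import Data.Fin as Fin using (Fin; toℕ; fromℕ<; combine)
open import Data.Fin.Properties using (pigeonhole; combine-injective; fromℕ<-injective)
open import Data.Integer using (-[1+_]; +<+; -<+; +≤+; -≤+; ∣_∣)
open import Data.Integer.Divisibility using (_∣_)
open import Data.Integer.Divisibility.Signed using (divides; ∣ᵤ⇒∣; ∣⇒∣ᵤ)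
open import Data.Integer.DivMod using (_%ℕ_; _/ℕ_; a≡a%ℕn+[a/ℕn]*n; n%ℕd<d)
import Data.Integer.Properties as ℤP
open import Data.Integer.Tactic.RingSolver using (solve-∀)
open import Data.List.Membership.Propositional using (_∈_)
open import Data.List.Relation.Unary.Any using (here; there)
open import Data.Nat as ℕ using (zero; suc; z≤n; s≤s)
open import Data.Nat.Coprimality using (Coprime; coprime-divisor; recompute) renaming (sym to coprime-sym)
import Data.Nat.Divisibility as ℕD
open import Data.Nat.GCD using (module GCD; module Bézout)
open import Data.Nat.Induction using (<-rec)
import Data.Nat.Properties as ℕP
open import Data.Nat.Tactic.RingSolver renaming (solve-∀ to solve-∀-ℕ)
open import Data.Product using (Σ; _,_; proj₁; proj₂)
open import Data.Rational using (mkℚ; 0ℚ; 1ℚ)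
import Data.Rational.Properties as ℚP
open import Data.Rational.Unnormalised as ℚᵘ using (mkℚᵘ; *≡*)
import Data.Rational.Unnormalised.Properties as ℚᵘP
open import Data.Sign using (Sign)
open import Data.Sum using (inj₁; inj₂)
open import Function.Bundles using (mk⇔; module Equivalence)
open import Relation.Binary.Definitions using (tri<; tri≈; tri>)
open import Relation.Binary.PropositionalEquality using (refl; sym; trans; cong; cong₂; subst; subst₂; module ≡-Reasoning)
open import Relation.Nullary using (Dec; yes; no)
open import Relation.Nullary.Decidable using (map′; _×-dec_; _⊎-dec_; dec⇒maybe)
open import Tactic.RingSolver using () renaming (solve-∀ to solve-∀-in)
open import Tactic.RingSolver.Core.AlmostCommutativeRing using (AlmostCommutativeRing; fromCommutativeRing)

open AbelianGroupProperties ℤP.+-0-abelianGroup using () renaming (∙-cancelˡ to +-cancelˡ; ∙-cancelʳ to +-cancelʳ)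

-- Put w = (b/2) I + SQ, so that w² = b w − ac.  The stability condition says that M commutes with SQ; since
-- Q is primitive this forces M = x I + u w with integers x and u, and det M = x² + b x u + ac u².  Hence
-- 𝒮(Q) is the group of units of the quadratic order ℤ[w], that is, the set of solutions of
-- t² − Δ u² = ±4 with t = 2x + b u.  For Δ < 0 and for square Δ the solutions are listed by hand.  For
-- Δ > 0 not a square, the finitely many forms along Conway's river of x² − Δ y² give a nontrivial
-- solution by pigeonhole, and multiplying by the inverse of the unit ε with least u > 0 (taking norm −1
-- when both norms occur) decreases t + 2u, so every unit is ± a power of ε.

-- `x + u w` is a pair of integers and meets ℚ only through two multiplicative maps: `μ` into
-- matrices, where det becomes the norm, and `κ` into K, with χ_Q after `κ` equal to `μ`. So 𝒮(Q)
-- and χ_Q(𝒰_f) are both compared with the same group. No real numbers occur. The units that are at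
-- least 1 are recognised by tr > 0 and im ≥ 0, and ε is chosen by its integer `im`, so that a least
-- one is found by search. The price is that `im` does not order units strictly: for Δ = 5 both ε =
-- (1 + √5)/2 and ε² = (3 + √5)/2 have im 1, with norms -1 and 1. Starting from ε² would lose ε;
-- hence the preference for norm -1. The measure has the same origin: for Δ = 5, u alone does not
-- separate ε from ε², and t + u does not separate 1 from ε. The search for ε needs some unit to
-- begin with. The river supplies one because its step is invertible: a repetition found anywhere
-- runs back to the starting form.

module Units where

  open import Data.Integer using (-_; _+_; _-_; _*_; _<_; _≤_; sign; _◃_; _⊖_)

  -- Signs of products and squares of integers.

  0≤*0≤ : ∀ {i j} → + 0 ≤ i → + 0 ≤ j → + 0 ≤ i * j
  0≤*0≤ {+ m} {+ n} _ _ = subst (+ 0 ≤_) (ℤP.pos-* m n) (+≤+ z≤n)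

  0<*0< : ∀ {i j} → + 0 < i → + 0 < j → + 0 < i * j
  0<*0< {+ suc m} {+ suc n} _ _ = +<+ (s≤s z≤n)
  0<*0< {+ suc m} {+ zero} _ (+<+ ())
  0<*0< {+ zero} (+<+ ()) _

  square-abs : ∀ i → i * i ≡ + (∣ i ∣ ℕ.* ∣ i ∣)
  square-abs (+ n) = sym (ℤP.pos-* n n)
  square-abs -[1+ n ] = refl

  0≤square : ∀ i → + 0 ≤ i * i
  0≤square i = subst (+ 0 ≤_) (sym (square-abs i)) (+≤+ z≤n)

  NonSquare : ℤ → Set
  NonSquare d = ∀ k → ¬ d ≡ k * k

  m≤m*m : ∀ m → m ℕ.≤ m ℕ.* m
  m≤m*m zero = z≤n
  m≤m*m (suc m) = ℕP.m≤m*n (suc m) (suc m)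

  -- A nontrivial solution of Pell's equation from the river.

  -- A state (A , h , C) is the form A x² + 2h x y − C y² on an edge of the river, with A , C > 0.
  module River where

    record State : Set where
      constructor state
      field
        A h C : ℤ
    open State

    Valid : ℤ → State → Set
    Valid d (state A h C) = + 0 < A × + 0 < C × h * h + A * C ≡ d

    -- The values of the form at (1, 1) and at (1, -1).
    turn unturn : State → ℤ
    turn (state A h C) = A + + 2 * h - C
    unturn (state A h C) = A - + 2 * h - C

    -- Base changes to (e₁ + e₂, e₂) and to (e₁, e₁ + e₂), with their inverses. The sign of `turn`
    -- decides which of the first two keeps the diagonal values of opposite sign.
    left right unleft unright : State → State
    left T = state (turn T) (h T - C T) (C T)
    right T = state (A T) (h T + A T) (- turn T)
    unleft T = state (unturn T) (h T + C T) (C T)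
    unright T = state (A T) (h T - A T) (- unturn T)

    positive? : ℤ → Bool
    positive? (+ suc _) = true
    positive? (+ zero)  = false
    positive? -[1+ _ ]  = false

    move unmove : Bool → State → State
    move true    = left
    move false   = right
    unmove true  = unleft
    unmove false = unright

    step unstep : State → State
    step T = move (positive? (turn T)) T
    unstep T = unmove (positive? (unturn T)) T

    0<⇒positive : ∀ {i} → + 0 < i → positive? i ≡ true
    0<⇒positive {+ suc _} _ = refl
    0<⇒positive {+ zero} (+<+ ())

    <0⇒¬positive : ∀ {i} → i < + 0 → positive? i ≡ false
    <0⇒¬positive { -[1+ _ ]} _ = refl
    <0⇒¬positive {+ _} (+<+ ())

    positive⇒0< : ∀ {i} → positive? i ≡ true → + 0 < i
    positive⇒0< {+ suc _} _ = +<+ (s≤s z≤n)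

    ¬positive⇒<0 : ∀ {i} → ¬ i ≡ + 0 → positive? i ≡ false → i < + 0
    ¬positive⇒<0 {+ zero} i≢0 _ = ⊥-elim (i≢0 refl)
    ¬positive⇒<0 { -[1+ _ ]} _ _ = -<+

    state-≡ : ∀ {A A' h h' C C'} → A ≡ A' → h ≡ h' → C ≡ C' → state A h C ≡ state A' h' C'
    state-≡ refl refl refl = refl

    neg-pos : ∀ {i} → i < + 0 → + 0 < - i
    neg-pos {i} p = ℤP.neg-mono-< p

    pos-neg : ∀ {i} → + 0 < i → - i < + 0
    pos-neg {i} p = ℤP.neg-mono-< p

    unturn-left : ∀ A h C → (A + + 2 * h - C) - + 2 * (h - C) - C ≡ A
    unturn-left = solve-∀

    unturn-right : ∀ A h C → A - + 2 * (h + A) - (- (A + + 2 * h - C)) ≡ - C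
    unturn-right = solve-∀

    i-j+j≡i : ∀ i j → (i - j) + j ≡ i
    i-j+j≡i = solve-∀

    i+j-j≡i : ∀ i j → i + j - j ≡ i
    i+j-j≡i = solve-∀

    unleft-left : ∀ T → unleft (left T) ≡ T
    unleft-left (state A h C) = state-≡ (unturn-left A h C) (i-j+j≡i h C) refl

    unright-right : ∀ T → unright (right T) ≡ T
    unright-right (state A h C) =
      state-≡ refl (i+j-j≡i h A) (trans (cong -_ (unturn-right A h C)) (ℤP.neg-involutive C))

    -- At the difference of the new basis vectors the form has the value A > 0 after a left turn and
    -- -C < 0 after a right turn, so the sign of `unturn` reveals the turn that was made.
    unstep-move : ∀ b T → + 0 < A T → + 0 < C T → unstep (move b T) ≡ T
    unstep-move true T 0<A _ = trans
      (cong (λ b → unmove b (left T)) (trans (cong positive? (unturn-left (A T) (h T) (C T))) (0<⇒positive 0<A)))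
      (unleft-left T)
    unstep-move false T _ 0<C = trans
      (cong (λ b → unmove b (right T)) (trans (cong positive? (unturn-right (A T) (h T) (C T))) (<0⇒¬positive (pos-neg 0<C))))
      (unright-right T)

    -- d = (h + A)² - A · turn, so a vanishing `turn` would make d a square.
    turn-nonzero : ∀ {d T} → NonSquare d → h T * h T + A T * C T ≡ d → ¬ turn T ≡ + 0
    turn-nonzero {d} {state A h C} nsq eq v≡0 = nsq (h + A) (begin
      d                                             ≡⟨ eq ⟨
      h * h + A * C                                 ≡⟨ e A h C ⟩
      (h + A) * (h + A) - A * (A + + 2 * h - C)     ≡⟨ cong (λ v → (h + A) * (h + A) - A * v) v≡0 ⟩
      (h + A) * (h + A) - A * + 0                   ≡⟨ f (h + A) A ⟩
      (h + A) * (h + A) ∎)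
      where
      open ≡-Reasoning
      e : ∀ A h C → h * h + A * C ≡ (h + A) * (h + A) - A * (A + + 2 * h - C)
      e = solve-∀
      f : ∀ x A → x * x - A * + 0 ≡ x * x
      f = solve-∀

    left-form : ∀ A h C → (h - C) * (h - C) + (A + + 2 * h - C) * C ≡ h * h + A * C
    left-form = solve-∀

    right-form : ∀ A h C → (h + A) * (h + A) + A * - (A + + 2 * h - C) ≡ h * h + A * C
    right-form = solve-∀

    move-valid : ∀ {d} b T → positive? (turn T) ≡ b → NonSquare d → Valid d T → Valid d (move b T)
    move-valid true T v nsq (0<A , 0<C , eq) =
      positive⇒0< v , 0<C , trans (left-form (A T) (h T) (C T)) eq
    move-valid false T v nsq (0<A , 0<C , eq) =
      0<A , neg-pos (¬positive⇒<0 (turn-nonzero {T = T} nsq eq) v) , trans (right-form (A T) (h T) (C T)) eq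

    -- The columns (p , r) and (q , s) of the accumulated base change.
    record Base (d : ℤ) (T : State) : Set where
      field
        p q r s : ℕ
        0<p : 0 ℕ.< p
        0<s : 0 ℕ.< s
        A≡ : + p * + p - d * (+ r * + r) ≡ A T
        h≡ : + p * + q - d * (+ r * + s) ≡ h T
        C≡ : + q * + q - d * (+ s * + s) ≡ - C T

    open Base

    left-A : ∀ d p q r s → (p + q) * (p + q) - d * ((r + s) * (r + s)) ≡
      (p * p - d * (r * r)) + + 2 * (p * q - d * (r * s)) + (q * q - d * (s * s))
    left-A = solve-∀

    left-h : ∀ d p q r s → (p + q) * q - d * ((r + s) * s) ≡ (p * q - d * (r * s)) + (q * q - d * (s * s))
    left-h = solve-∀

    right-h : ∀ d p q r s → p * (p + q) - d * (r * (r + s)) ≡ (p * q - d * (r * s)) + (p * p - d * (r * r))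
    right-h = solve-∀

    -- The second component records that a basis reached by a move is not the initial one; it later
    -- excludes the trivial Pell solution.
    move-base : ∀ {d} b T → Base d T → Σ (Base d (move b T)) (λ β → 0 ℕ.< q β ⊎ 0 ℕ.< r β)
    move-base {d} true T β = record
      { p = p β ℕ.+ q β ; q = q β ; r = r β ℕ.+ s β ; s = s β
      ; 0<p = ℕP.m≤n⇒m≤n+o (q β) (0<p β) ; 0<s = 0<s β
      ; A≡ = trans (left-A d (+ p β) (+ q β) (+ r β) (+ s β))
               (cong₂ _+_ (cong₂ _+_ (A≡ β) (cong (+ 2 *_) (h≡ β))) (C≡ β))
      ; h≡ = trans (left-h d (+ p β) (+ q β) (+ r β) (+ s β)) (cong₂ _+_ (h≡ β) (C≡ β))
      ; C≡ = C≡ β } , inj₂ (ℕP.m≤n⇒m≤o+n (r β) (0<s β))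
    move-base {d} false T β = record
      { p = p β ; q = p β ℕ.+ q β ; r = r β ; s = r β ℕ.+ s β
      ; 0<p = 0<p β ; 0<s = ℕP.m≤n⇒m≤o+n (r β) (0<s β)
      ; A≡ = A≡ β
      ; h≡ = trans (right-h d (+ p β) (+ q β) (+ r β) (+ s β)) (cong₂ _+_ (h≡ β) (A≡ β))
      ; C≡ = trans (left-A d (+ p β) (+ q β) (+ r β) (+ s β))
               (trans (cong₂ _+_ (cong₂ _+_ (A≡ β) (cong (+ 2 *_) (h≡ β))) (C≡ β)) (sym (ℤP.neg-involutive (turn T))))
      } , inj₁ (ℕP.m≤n⇒m≤n+o (q β) (0<p β))

    signCode : Sign → Fin 2
    signCode Sign.- = Fin.zero
    signCode Sign.+ = Fin.suc Fin.zero

    signCode-injective : ∀ s t → signCode s ≡ signCode t → s ≡ t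
    signCode-injective Sign.- Sign.- _ = refl
    signCode-injective Sign.+ Sign.+ _ = refl

    record Bounded (m : ℕ) (T : State) : Set where
      constructor bounded
      field
        0<A : + 0 < A T
        0<C : + 0 < C T
        A<  : ∣ A T ∣ ℕ.< m
        h<  : ∣ h T ∣ ℕ.< m
        C<  : ∣ C T ∣ ℕ.< m
    open Bounded

    -- In h² + AC = d with A, C ≥ 1, each of |h|, A and C is at most d.
    valid⇒bounded : ∀ {d} T → Valid d T → Bounded (suc ∣ d ∣) T
    valid⇒bounded {d} (state (+ suc a) h (+ suc c)) (0<A , 0<C , eq)
      rewrite sym eq | square-abs h =
      bounded 0<A 0<C
        (s≤s (ℕP.m≤n⇒m≤o+n (∣ h ∣ ℕ.* ∣ h ∣) (ℕP.m≤m*n (suc a) (suc c))))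
        (s≤s (ℕP.m≤n⇒m≤n+o (suc a ℕ.* suc c) (m≤m*m ∣ h ∣)))
        (s≤s (ℕP.m≤n⇒m≤o+n (∣ h ∣ ℕ.* ∣ h ∣) (ℕP.m≤n*m (suc c) (suc a))))
    valid⇒bounded (state (+ zero) h _) (+<+ () , _)
    valid⇒bounded (state (+ suc _) h (+ zero)) (_ , +<+ () , _)

    code : ∀ {m} T → Bounded m T → Fin (m ℕ.* (m ℕ.* (m ℕ.* 2)))
    code T b = combine (fromℕ< (A< b)) (combine (fromℕ< (C< b)) (combine (fromℕ< (h< b)) (signCode (sign (h T)))))

    pos-abs-injective : ∀ {i j} → + 0 < i → + 0 < j → ∣ i ∣ ≡ ∣ j ∣ → i ≡ j
    pos-abs-injective {+ m} {+ n} _ _ refl = refl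

    code-injective : ∀ {m T T'} (b : Bounded m T) (b' : Bounded m T') → code T b ≡ code T' b' → T ≡ T'
    code-injective {m} {T} {T'} b b' eq
      with eA , eq₁ ← combine-injective (fromℕ< (A< b)) _ (fromℕ< (A< b')) _ eq
      with eC , eq₂ ← combine-injective (fromℕ< (C< b)) _ (fromℕ< (C< b')) _ eq₁
      with eh , es ← combine-injective (fromℕ< (h< b)) _ (fromℕ< (h< b')) _ eq₂ =
      state-≡
        (pos-abs-injective (0<A b) (0<A b') (fromℕ<-injective _ _ (A< b) (A< b') eA))
        (trans (sym (ℤP.signᵢ◃∣i∣≡i (h T))) (trans
          (cong₂ _◃_ (signCode-injective _ _ es) (fromℕ<-injective _ _ (h< b) (h< b') eh))
          (ℤP.signᵢ◃∣i∣≡i (h T'))))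
        (pos-abs-injective (0<C b) (0<C b') (fromℕ<-injective _ _ (C< b) (C< b') eC))

    pq-d0s : ∀ d p q s → p * q ≡ p * q - d * (+ 0 * s)
    pq-d0s = solve-∀

    -- h = 0 says pq = d rs; if q > 0 the left side is positive, so r cannot vanish.
    base-r>0 : ∀ {d T} (β : Base d T) → h T ≡ + 0 → 0 ℕ.< q β ⊎ 0 ℕ.< r β → + 0 < + r β
    base-r>0 β h≡0 (inj₂ 0<r) = +<+ 0<r
    base-r>0 {d} {T} record { p = p ; q = q ; r = zero ; s = s ; 0<p = 0<p ; h≡ = h≡ } h≡0 (inj₁ 0<q) =
      ⊥-elim (ℤP.<-irrefl (sym (trans (pq-d0s d (+ p) (+ q) (+ s)) (trans h≡ h≡0))) (0<*0< (+<+ 0<p) (+<+ 0<q)))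
    base-r>0 record { r = suc _ } h≡0 (inj₁ 0<q) = +<+ (s≤s z≤n)

    module Periodic (d : ℤ) (0<d : + 0 < d) (nsq : NonSquare d) where

      river : ℕ → State
      river zero = state (+ 1) (+ 0) d
      river (suc n) = step (river n)

      river-valid : ∀ n → Valid d (river n)
      river-valid zero = +<+ (s≤s z≤n) , 0<d , e d
        where
        e : ∀ d → + 0 * + 0 + + 1 * d ≡ d
        e = solve-∀
      river-valid (suc n) = move-valid (positive? (turn (river n))) (river n) refl nsq (river-valid n)

      river-base : ∀ n → Base d (river n)
      river-base zero = record
        { p = 1 ; q = 0 ; r = 0 ; s = 1 ; 0<p = s≤s z≤n ; 0<s = s≤s z≤n ; A≡ = e d ; h≡ = f d ; C≡ = g d }
        where
        e : ∀ d → + 1 * + 1 - d * (+ 0 * + 0) ≡ + 1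
        e = solve-∀
        f : ∀ d → + 1 * + 0 - d * (+ 0 * + 1) ≡ + 0
        f = solve-∀
        g : ∀ d → + 0 * + 0 - d * (+ 1 * + 1) ≡ - d
        g = solve-∀
      river-base (suc n) = proj₁ (move-base (positive? (turn (river n))) (river n) (river-base n))

      -- Undoing i steps on both sides moves a repetition back to the source.
      rewind : ∀ i k → river i ≡ river (i ℕ.+ k) → river 0 ≡ river k
      rewind zero k eq = eq
      rewind (suc i) k eq = rewind i k (begin
        river i                          ≡⟨ undo i ⟨
        unstep (river (suc i))           ≡⟨ cong unstep eq ⟩
        unstep (river (suc i ℕ.+ k))     ≡⟨ undo (i ℕ.+ k) ⟩
        river (i ℕ.+ k) ∎)
        where
        open ≡-Reasoning
        undo : ∀ n → unstep (river (suc n)) ≡ river n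
        undo n = unstep-move (positive? (turn (river n))) (river n) (proj₁ (river-valid n)) (proj₁ (proj₂ (river-valid n)))

      river-bounded : ∀ n → Bounded (suc ∣ d ∣) (river n)
      river-bounded n = valid⇒bounded (river n) (river-valid n)

      periodic : ∃[ n ] river 0 ≡ river (suc n)
      periodic
        with i , j , i<j , eq ← pigeonhole (ℕP.n<1+n _) (λ i → code (river (toℕ i)) (river-bounded (toℕ i)))
        with k , j≡ ← ℕP.m≤n⇒∃[o]m+o≡n i<j =
        k , rewind (toℕ i) (suc k) (trans
          (code-injective (river-bounded (toℕ i)) (river-bounded (toℕ j)) eq)
          (cong river (trans (sym j≡) (sym (ℕP.+-suc (toℕ i) k)))))

      pell : ∃[ x ] ∃[ y ] (+ 0 < y × x * x - d * (y * y) ≡ + 1)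
      -- On return to x² - d y² the first column (p, r) of the base change satisfies p² - d r² = 1.
      -- The last step before the return is made explicitly, since `move-base` must certify r > 0.
      pell = let n , eq = periodic
                 β , moved = move-base (positive? (turn (river n))) (river n) (river-base n)
             in + p β , + r β , base-r>0 β (cong h (sym eq)) moved , trans (A≡ β) (cong A (sym eq))

  -- Arithmetic of the order ℤ[w].

  ±1 : ℤ → Set
  ±1 n = n ≡ + 1 ⊎ n ≡ - (+ 1)

  ±1-square : ∀ {n} → ±1 n → n * n ≡ + 1
  ±1-square (inj₁ refl) = refl
  ±1-square (inj₂ refl) = refl

  ±1-* : ∀ {m n} → ±1 m → ±1 n → ±1 (m * n)
  ±1-* (inj₁ refl) (inj₁ refl) = inj₁ refl
  ±1-* (inj₁ refl) (inj₂ refl) = inj₂ refl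
  ±1-* (inj₂ refl) (inj₁ refl) = inj₂ refl
  ±1-* (inj₂ refl) (inj₂ refl) = inj₁ refl

  ∣n∣≡1⇒±1 : ∀ n → ∣ n ∣ ≡ 1 → ±1 n
  ∣n∣≡1⇒±1 (+ .1) refl = inj₁ refl
  ∣n∣≡1⇒±1 -[1+ .0 ] refl = inj₂ refl

  m*n≡1⇒±1 : ∀ m n → m * n ≡ + 1 → ±1 m
  m*n≡1⇒±1 m n eq = ∣n∣≡1⇒±1 m (ℕP.m*n≡1⇒m≡1 ∣ m ∣ ∣ n ∣ (trans (sym (ℤP.abs-* m n)) (cong ∣_∣ eq)))

  ∙-assoc-x : ∀ B C x u y v z w →
    (x * y - C * u * v) * z - C * (x * v + u * y + B * u * v) * w ≡
    x * (y * z - C * v * w) - C * u * (y * w + v * z + B * v * w)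
  ∙-assoc-x = solve-∀

  ∙-assoc-u : ∀ B C x u y v z w →
    (x * y - C * u * v) * w + (x * v + u * y + B * u * v) * z + B * (x * v + u * y + B * u * v) * w ≡
    x * (y * w + v * z + B * v * w) + u * (y * z - C * v * w) + B * u * (y * w + v * z + B * v * w)
  ∙-assoc-u = solve-∀

  ∙-comm-x : ∀ C x u y v → x * y - C * u * v ≡ y * x - C * v * u
  ∙-comm-x = solve-∀

  ∙-comm-u : ∀ B x u y v → x * v + u * y + B * u * v ≡ y * u + v * x + B * v * u
  ∙-comm-u = solve-∀

  1∙-x : ∀ C x u → + 1 * x - C * + 0 * u ≡ x
  1∙-x = solve-∀

  1∙-u : ∀ B x u → + 1 * u + + 0 * x + B * + 0 * u ≡ u
  1∙-u = solve-∀

  N-∙-identity : ∀ B C x u y v →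
    (x * y - C * u * v) * (x * y - C * u * v) + B * (x * y - C * u * v) * (x * v + u * y + B * u * v)
      + C * (x * v + u * y + B * u * v) * (x * v + u * y + B * u * v) ≡
    (x * x + B * x * u + C * u * u) * (y * y + B * y * v + C * v * v)
  N-∙-identity = solve-∀

  N-1 : ∀ B C → + 1 * + 1 + B * + 1 * + 0 + C * + 0 * + 0 ≡ + 1
  N-1 = solve-∀

  N-neg-identity : ∀ B C x u → - x * - x + B * - x * - u + C * - u * - u ≡ x * x + B * x * u + C * u * u
  N-neg-identity = solve-∀

  inverse-x : ∀ B C n x u → x * (n * (x + B * u)) - C * u * (n * - u) ≡ n * (x * x + B * x * u + C * u * u)
  inverse-x = solve-∀

  inverse-u : ∀ B n x u → x * (n * - u) + u * (n * (x + B * u)) + B * u * (n * - u) ≡ + 0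
  inverse-u = solve-∀

  tr-∙-identity : ∀ B C x u y v →
    + 2 * (+ 2 * (x * y - C * u * v) + B * (x * v + u * y + B * u * v)) ≡
    (+ 2 * x + B * u) * (+ 2 * y + B * v) + (B * B - + 4 * C) * (u * v)
  tr-∙-identity = solve-∀

  im-∙-identity : ∀ B x u y v →
    + 2 * (x * v + u * y + B * u * v) ≡ (+ 2 * x + B * u) * v + u * (+ 2 * y + B * v)
  im-∙-identity = solve-∀

  4N-identity : ∀ B C x u →
    + 4 * (x * x + B * x * u + C * u * u) ≡ (+ 2 * x + B * u) * (+ 2 * x + B * u) - (B * B - + 4 * C) * (u * u)
  4N-identity = solve-∀

  tr-inv-identity : ∀ B n x u → + 2 * (n * (x + B * u)) + B * (n * - u) ≡ n * (+ 2 * x + B * u)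
  tr-inv-identity = solve-∀

  tr-neg-identity : ∀ B x u → + 2 * - x + B * - u ≡ - (+ 2 * x + B * u)
  tr-neg-identity = solve-∀

  neg-∙-x : ∀ C x u → - (+ 1) * x - C * + 0 * u ≡ - x
  neg-∙-x = solve-∀

  neg-∙-u : ∀ B x u → - (+ 1) * u + + 0 * x + B * + 0 * u ≡ - u
  neg-∙-u = solve-∀

  -- elt x u stands for x + u w, where w² = B w − C in Order B C.
  record Elt : Set where
    constructor elt
    field
      scalar im : ℤ
  open Elt public

  module Order (B C : ℤ) where

    Δ : ℤ
    Δ = B * B - + 4 * C

    one : Elt
    one = elt (+ 1) (+ 0)

    infixl 7 _∙_

    opaque
      _∙_ : Elt → Elt → Elt
      elt x u ∙ elt y v = elt (x * y - C * u * v) (x * v + u * y + B * u * v)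

      neg : Elt → Elt
      neg (elt x u) = elt (- x) (- u)

      N tr : Elt → ℤ
      N (elt x u) = x * x + B * x * u + C * u * u
      tr (elt x u) = + 2 * x + B * u

      -- The conjugate of w is B - w, so this is N α times the conjugate of α; it inverts α when N α
      -- = ±1.
      inv : Elt → Elt
      inv α@(elt x u) = elt (N α * (x + B * u)) (N α * - u)

    record IsUnit (α : Elt) : Set where
      constructor is-unit
      field
        norm-±1 : ±1 (N α)
    open IsUnit public

    opaque
      unfolding _∙_

      ∙-def : ∀ x u y v → elt x u ∙ elt y v ≡ elt (x * y - C * u * v) (x * v + u * y + B * u * v)
      ∙-def x u y v = refl

      neg-def : ∀ x u → neg (elt x u) ≡ elt (- x) (- u)
      neg-def x u = refl

      N-def : ∀ x u → N (elt x u) ≡ x * x + B * x * u + C * u * u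
      N-def x u = refl

      tr-def : ∀ α → tr α ≡ + 2 * scalar α + B * im α
      tr-def α = refl

      ∙-assoc : ∀ α β γ → (α ∙ β) ∙ γ ≡ α ∙ (β ∙ γ)
      ∙-assoc (elt x u) (elt y v) (elt z w) = cong₂ elt (∙-assoc-x B C x u y v z w) (∙-assoc-u B C x u y v z w)

      ∙-comm : ∀ α β → α ∙ β ≡ β ∙ α
      ∙-comm (elt x u) (elt y v) = cong₂ elt (∙-comm-x C x u y v) (∙-comm-u B x u y v)

      one-∙ : ∀ α → one ∙ α ≡ α
      one-∙ (elt x u) = cong₂ elt (1∙-x C x u) (1∙-u B x u)

      neg-one-∙ : ∀ α → neg one ∙ α ≡ neg α
      neg-one-∙ (elt x u) = cong₂ elt (neg-∙-x C x u) (neg-∙-u B x u)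

      N-∙ : ∀ α β → N (α ∙ β) ≡ N α * N β
      N-∙ (elt x u) (elt y v) = N-∙-identity B C x u y v

      N-one : N one ≡ + 1
      N-one = N-1 B C

      N-neg : ∀ α → N (neg α) ≡ N α
      N-neg (elt x u) = N-neg-identity B C x u

      ∙-inv-N : ∀ α → N α * N α ≡ + 1 → α ∙ inv α ≡ one
      ∙-inv-N (elt x u) eq = cong₂ elt (trans (inverse-x B C (N (elt x u)) x u) eq) (inverse-u B (N (elt x u)) x u)

      4N : ∀ α → + 4 * N α ≡ tr α * tr α - Δ * (im α * im α)
      4N (elt x u) = 4N-identity B C x u

      tr-∙ : ∀ α β → + 2 * tr (α ∙ β) ≡ tr α * tr β + Δ * (im α * im β)
      tr-∙ (elt x u) (elt y v) = tr-∙-identity B C x u y v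

      im-∙ : ∀ α β → + 2 * im (α ∙ β) ≡ tr α * im β + im α * tr β
      im-∙ (elt x u) (elt y v) = im-∙-identity B x u y v

      tr-inv : ∀ α → tr (inv α) ≡ N α * tr α
      tr-inv (elt x u) = tr-inv-identity B (N (elt x u)) x u

      im-inv : ∀ α → im (inv α) ≡ N α * - im α
      im-inv (elt x u) = refl

      tr-neg : ∀ α → tr (neg α) ≡ - tr α
      tr-neg (elt x u) = tr-neg-identity B x u

      im-neg : ∀ α → im (neg α) ≡ - im α
      im-neg (elt x u) = refl

      tr-im-injective : ∀ {α β} → tr α ≡ tr β → im α ≡ im β → α ≡ β
      tr-im-injective {elt x u} {elt y .u} t≡ refl =
        cong (λ z → elt z u) (ℤP.*-cancelˡ-≡ (+ 2) x y (+-cancelʳ (B * u) (+ 2 * x) (+ 2 * y) t≡))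

    ∙-one : ∀ α → α ∙ one ≡ α
    ∙-one α = trans (∙-comm α one) (one-∙ α)

    ∙-inv : ∀ {α} → IsUnit α → α ∙ inv α ≡ one
    ∙-inv {α} (is-unit n) = ∙-inv-N α (±1-square n)

    inv-∙ : ∀ {α} → IsUnit α → inv α ∙ α ≡ one
    inv-∙ {α} a = trans (∙-comm (inv α) α) (∙-inv a)

    ∙-interchange : ∀ α β γ δ → (α ∙ β) ∙ (γ ∙ δ) ≡ (α ∙ γ) ∙ (β ∙ δ)
    ∙-interchange α β γ δ = begin
      (α ∙ β) ∙ (γ ∙ δ) ≡⟨ ∙-assoc α β (γ ∙ δ) ⟩
      α ∙ (β ∙ (γ ∙ δ)) ≡⟨ cong (α ∙_) (sym (∙-assoc β γ δ)) ⟩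
      α ∙ ((β ∙ γ) ∙ δ) ≡⟨ cong (λ ξ → α ∙ (ξ ∙ δ)) (∙-comm β γ) ⟩
      α ∙ ((γ ∙ β) ∙ δ) ≡⟨ cong (α ∙_) (∙-assoc γ β δ) ⟩
      α ∙ (γ ∙ (β ∙ δ)) ≡⟨ sym (∙-assoc α γ (β ∙ δ)) ⟩
      (α ∙ γ) ∙ (β ∙ δ) ∎
      where open ≡-Reasoning

    unit-one : IsUnit one
    unit-one = is-unit (inj₁ N-one)

    unit-∙ : ∀ {α β} → IsUnit α → IsUnit β → IsUnit (α ∙ β)
    unit-∙ {α} {β} (is-unit a) (is-unit b) = is-unit (subst ±1 (sym (N-∙ α β)) (±1-* a b))

    -- Norms multiply, so N α divides 1.
    inverse⇒unit : ∀ α β → α ∙ β ≡ one → IsUnit α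
    inverse⇒unit α β eq = is-unit (m*n≡1⇒±1 (N α) (N β) (trans (sym (N-∙ α β)) (trans (cong N eq) N-one)))

    unit-inv : ∀ {α} → IsUnit α → IsUnit (inv α)
    unit-inv {α} a = inverse⇒unit (inv α) α (inv-∙ a)

    unit-neg : ∀ {α} → IsUnit α → IsUnit (neg α)
    unit-neg {α} (is-unit a) = is-unit (subst ±1 (sym (N-neg α)) a)

    infixr 8 _^_
    _^_ : Elt → ℕ → Elt
    α ^ zero  = one
    α ^ suc n = α ∙ α ^ n

    ^-+ : ∀ α m n → α ^ (m ℕ.+ n) ≡ α ^ m ∙ α ^ n
    ^-+ α zero n = sym (one-∙ (α ^ n))
    ^-+ α (suc m) n = trans (cong (α ∙_) (^-+ α m n)) (sym (∙-assoc α (α ^ m) (α ^ n)))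

    unit-^ : ∀ {α} n → IsUnit α → IsUnit (α ^ n)
    unit-^ zero a = unit-one
    unit-^ {α} (suc n) a = unit-∙ {α} {α ^ n} a (unit-^ n a)

    pow : Elt → ℤ → Elt
    pow α (+ n)    = α ^ n
    pow α -[1+ n ] = inv α ^ suc n

    unit-pow : ∀ {α} i → IsUnit α → IsUnit (pow α i)
    unit-pow (+ n) a = unit-^ n a
    unit-pow {α} -[1+ n ] a = unit-^ (suc n) (unit-inv {α} a)

    pow-⊖ : ∀ {α} → IsUnit α → ∀ m n → pow α (m ⊖ n) ≡ α ^ m ∙ inv α ^ n
    pow-⊖ {α} a m zero = sym (∙-one (α ^ m))
    pow-⊖ {α} a zero (suc n) = sym (one-∙ (inv α ^ suc n))
    pow-⊖ {α} a (suc m) (suc n) = begin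
      pow α (suc m ⊖ suc n)                    ≡⟨ cong (pow α) (ℤP.[1+m]⊖[1+n]≡m⊖n m n) ⟩
      pow α (m ⊖ n)                            ≡⟨ pow-⊖ a m n ⟩
      α ^ m ∙ inv α ^ n                        ≡⟨ sym (one-∙ _) ⟩
      one ∙ (α ^ m ∙ inv α ^ n)                ≡⟨ cong (_∙ (α ^ m ∙ inv α ^ n)) (sym (∙-inv {α} a)) ⟩
      (α ∙ inv α) ∙ (α ^ m ∙ inv α ^ n)        ≡⟨ ∙-interchange α (inv α) (α ^ m) (inv α ^ n) ⟩
      α ^ suc m ∙ inv α ^ suc n ∎
      where open ≡-Reasoning

    pow-+ : ∀ {α} → IsUnit α → ∀ i j → pow α (i + j) ≡ pow α i ∙ pow α j
    pow-+ {α} a (+ m) (+ n) = ^-+ α m n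
    pow-+ {α} a (+ m) -[1+ n ] = pow-⊖ a m (suc n)
    pow-+ {α} a -[1+ m ] (+ n) = trans (pow-⊖ a n (suc m)) (∙-comm (α ^ n) (inv α ^ suc m))
    pow-+ {α} a -[1+ m ] -[1+ n ] =
      trans (cong (inv α ^_) (cong suc (sym (ℕP.+-suc m n)))) (^-+ (inv α) (suc m) (suc n))

    -- The monomials g^i h^j, by which the unit groups are presented as quotients of ℤ².
    word : Elt → Elt → ℤ × ℤ → Elt
    word g h (i , j) = pow g i ∙ pow h j

    word-+ : ∀ {g h} → IsUnit g → IsUnit h → ∀ i j k l → word g h (i + k , j + l) ≡ word g h (i , j) ∙ word g h (k , l)
    word-+ {g} {h} a b i j k l = trans (cong₂ _∙_ (pow-+ a i k) (pow-+ b j l)) (∙-interchange (pow g i) (pow g k) (pow h j) (pow h l))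

    unit-word : ∀ {g h} → IsUnit g → IsUnit h → ∀ v → IsUnit (word g h v)
    unit-word {g} {h} a b (i , j) = unit-∙ {pow g i} {pow h j} (unit-pow i a) (unit-pow j b)

    ∙-inverse-unique : ∀ α β γ → α ∙ β ≡ one → α ∙ γ ≡ one → β ≡ γ
    ∙-inverse-unique α β γ e f = begin
      β             ≡⟨ sym (∙-one β) ⟩
      β ∙ one       ≡⟨ cong (β ∙_) (sym f) ⟩
      β ∙ (α ∙ γ)   ≡⟨ sym (∙-assoc β α γ) ⟩
      (β ∙ α) ∙ γ   ≡⟨ cong (_∙ γ) (trans (∙-comm β α) e) ⟩
      one ∙ γ       ≡⟨ one-∙ γ ⟩
      γ ∎
      where open ≡-Reasoning

    ∙-cancelʳ : ∀ {γ} → IsUnit γ → ∀ α β → α ∙ γ ≡ β ∙ γ → α ≡ β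
    ∙-cancelʳ {γ} c α β eq = trans (sym (expand α)) (trans (cong (_∙ inv γ) eq) (expand β))
      where
      expand : ∀ ξ → (ξ ∙ γ) ∙ inv γ ≡ ξ
      expand ξ = trans (∙-assoc ξ γ (inv γ)) (trans (cong (ξ ∙_) (∙-inv {γ} c)) (∙-one ξ))

  -- Units with im 0 and the relations between two generators.

  N-at-im0 : ∀ B C x → x * x + B * x * + 0 + C * + 0 * + 0 ≡ x * x
  N-at-im0 = solve-∀

  parity : ∀ i → ∃[ q ] (i ≡ q * + 2 ⊎ i ≡ + 1 + q * + 2)
  parity i = i /ℕ 2 , by (i %ℕ 2) (n%ℕd<d i 2) (a≡a%ℕn+[a/ℕn]*n i 2)
    where
    by : ∀ {k} r → r ℕ.< 2 → i ≡ + r + k → i ≡ k ⊎ i ≡ + 1 + k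
    by {k} zero _ eq = inj₁ (trans eq (ℤP.+-identityˡ k))
    by (suc zero) _ eq = inj₂ eq
    by (suc (suc _)) (s≤s (s≤s ())) _

  module Order-Properties (B C : ℤ) where
    open Order B C

    one≢neg-one : ¬ one ≡ neg one
    one≢neg-one eq with cong scalar (trans eq (neg-def (+ 1) (+ 0)))
    ... | ()

    unit-neg-one : IsUnit (neg one)
    unit-neg-one = unit-neg unit-one

    unit-im0 : ∀ {α} → IsUnit α → im α ≡ + 0 → α ≡ one ⊎ α ≡ neg one
    unit-im0 {elt x .(+ 0)} (is-unit n) refl = go (subst ±1 (trans (N-def x (+ 0)) (N-at-im0 B C x)) n)
      where
      ± : ±1 x → elt x (+ 0) ≡ one ⊎ elt x (+ 0) ≡ neg one
      ± (inj₁ refl) = inj₁ refl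
      ± (inj₂ refl) = inj₂ (sym (neg-def (+ 1) (+ 0)))
      go : ±1 (x * x) → elt x (+ 0) ≡ one ⊎ elt x (+ 0) ≡ neg one
      go (inj₁ eq) = ± (m*n≡1⇒±1 x x eq)
      go (inj₂ eq) with subst (+ 0 ≤_) eq (0≤square x)
      ... | ()

    pow-neg-∙ : ∀ {g} → IsUnit g → ∀ i → pow g (- i) ∙ pow g i ≡ one
    pow-neg-∙ {g} a i = trans (sym (pow-+ a (- i) i)) (cong (pow g) (ℤP.+-inverseˡ i))

    pow-neg-one : ∀ {g} → IsUnit g → ∀ i → pow g i ≡ one → pow g (- i) ≡ one
    pow-neg-one {g} a i eq = trans (sym (∙-one _)) (trans (cong (pow g (- i) ∙_) (sym eq)) (pow-neg-∙ a i))

    pow-multiple-ℕ : ∀ {g} → IsUnit g → ∀ k → pow g k ≡ one → ∀ m → pow g (+ m * k) ≡ one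
    pow-multiple-ℕ a k eq zero = refl
    pow-multiple-ℕ {g} a k eq (suc m) = trans (cong (pow g) (ℤP.suc-* (+ m) k)) (trans (pow-+ a k (+ m * k))
      (trans (cong₂ _∙_ eq (pow-multiple-ℕ a k eq m)) (one-∙ one)))

    pow-multiple : ∀ {g} → IsUnit g → ∀ k → pow g k ≡ one → ∀ q → pow g (q * k) ≡ one
    pow-multiple a k eq (+ m) = pow-multiple-ℕ a k eq m
    pow-multiple {g} a k eq -[1+ m ] = trans (cong (pow g) (sym (ℤP.neg-distribˡ-* (+ suc m) k)))
      (pow-neg-one a (+ suc m * k) (pow-multiple-ℕ a k eq (suc m)))

    pow-remainder : ∀ {g} → IsUnit g → ∀ r k q → pow g k ≡ one → pow g (r + q * k) ≡ pow g r
    pow-remainder {g} a r k q eq = trans (pow-+ a r (q * k))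
      (trans (cong (pow g r ∙_) (pow-multiple a k eq q)) (∙-one (pow g r)))

    -- By division with remainder only an exponent r < n survives, and the minimality hypothesis
    -- makes it 0.
    pow-kernel : ∀ {g} → IsUnit g → ∀ n .{{_ : ℕ.NonZero n}} → g ^ n ≡ one →
      (∀ r → r ℕ.< n → g ^ r ≡ one → r ≡ 0) → ∀ i → pow g i ≡ one ⇔ (+ n ∣ i)
    pow-kernel {g} a n gⁿ≡1 minimal i = mk⇔ to from
      where
      to : pow g i ≡ one → + n ∣ i
      to eq = ∣⇒∣ᵤ (divides (i /ℕ n) (trans (a≡a%ℕn+[a/ℕn]*n i n)
        (trans (cong (λ r → + r + (i /ℕ n) * + n) r≡0) (ℤP.+-identityˡ _))))
        where
        r≡0 : i %ℕ n ≡ 0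
        r≡0 = minimal (i %ℕ n) (n%ℕd<d i n) (trans (sym (pow-remainder a (+ (i %ℕ n)) (+ n) (i /ℕ n) gⁿ≡1))
          (trans (cong (pow g) (sym (a≡a%ℕn+[a/ℕn]*n i n))) eq))
      from : + n ∣ i → pow g i ≡ one
      from n∣i with ∣ᵤ⇒∣ {+ n} {i} n∣i
      ... | divides q eq = trans (cong (pow g) eq) (pow-multiple a (+ n) gⁿ≡1 q)

    neg-one-^2 : neg one ^ 2 ≡ one
    neg-one-^2 = trans (cong (neg one ∙_) (∙-one (neg one)))
      (trans (neg-one-∙ (neg one)) (trans (cong neg (neg-def (+ 1) (+ 0))) (neg-def (- (+ 1)) (+ 0))))

    neg-one-pow : ∀ i → pow (neg one) i ≡ one ⇔ (+ 2 ∣ i)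
    neg-one-pow = pow-kernel unit-neg-one 2 neg-one-^2 minimal
      where
      minimal : ∀ r → r ℕ.< 2 → neg one ^ r ≡ one → r ≡ 0
      minimal zero _ _ = refl
      minimal (suc zero) _ eq = ⊥-elim (one≢neg-one (trans (sym eq) (∙-one (neg one))))
      minimal (suc (suc _)) (s≤s (s≤s ())) _

    neg-one-pow-cases : ∀ i → pow (neg one) i ≡ one ⊎ pow (neg one) i ≡ neg one
    neg-one-pow-cases i with parity i
    ... | q , inj₁ refl = inj₁ (pow-multiple unit-neg-one (+ 2) neg-one-^2 q)
    ... | q , inj₂ refl = inj₂ (trans (pow-remainder unit-neg-one (+ 1) (+ 2) q neg-one-^2) (∙-one (neg one)))

    im-neg-one-pow-∙ : ∀ i α → im (pow (neg one) i ∙ α) ≡ + 0 → im α ≡ + 0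
    im-neg-one-pow-∙ i α eq with neg-one-pow-cases i
    ... | inj₁ e = trans (sym (cong im (trans (cong (_∙ α) e) (one-∙ α)))) eq
    ... | inj₂ e = ℤP.neg-injective (trans (sym (trans (cong im (trans (cong (_∙ α) e) (neg-one-∙ α))) (im-neg α))) eq)

    -- A power of -1 can only change the sign of `im`, so a trivial word has im (h^j) = 0, whence j
    -- = 0 by `free`.
    kernel-ℤ/2×ℤ : ∀ {h} → IsUnit h → (∀ j → im (pow h j) ≡ + 0 → j ≡ + 0) →
      ∀ v → word (neg one) h v ≡ one ⇔ L-ℤ/2×ℤ v
    kernel-ℤ/2×ℤ {h} b free (i , j) = mk⇔ to from
      where
      to : word (neg one) h (i , j) ≡ one → L-ℤ/2×ℤ (i , j)
      to eq = Equivalence.to (neg-one-pow i) (trans (sym (∙-one _)) (trans (cong (λ k → pow (neg one) i ∙ pow h k) (sym j≡0)) eq)) , j≡0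
        where
        j≡0 : j ≡ + 0
        j≡0 = free j (im-neg-one-pow-∙ i (pow h j) (cong im eq))
      from : L-ℤ/2×ℤ (i , j) → word (neg one) h (i , j) ≡ one
      from (2∣i , refl) = trans (cong (_∙ one) (Equivalence.from (neg-one-pow i) 2∣i)) (one-∙ one)

    kernel-ℤ/2×ℤ/2 : ∀ {h} → IsUnit h → h ^ 2 ≡ one → ¬ im h ≡ + 0 →
      ∀ v → word (neg one) h v ≡ one ⇔ L-ℤ/2×ℤ/2 v
    kernel-ℤ/2×ℤ/2 {h} b h²≡1 im≢0 (i , j) = mk⇔ to from
      where
      h-pow : ∀ j → pow h j ≡ one ⇔ (+ 2 ∣ j)
      h-pow = pow-kernel b 2 h²≡1 λ where
        zero _ _ → refl
        (suc zero) _ eq → ⊥-elim (im≢0 (cong im (trans (sym (∙-one h)) eq)))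
        (suc (suc _)) (s≤s (s≤s ())) _
      pow-j : im (pow h j) ≡ + 0 → pow h j ≡ one
      pow-j eq with parity j
      ... | q , inj₁ refl = pow-multiple b (+ 2) h²≡1 q
      ... | q , inj₂ refl = ⊥-elim (im≢0 (trans (sym (cong im (trans (pow-remainder b (+ 1) (+ 2) q h²≡1) (∙-one h)))) eq))
      to : word (neg one) h (i , j) ≡ one → L-ℤ/2×ℤ/2 (i , j)
      to eq = Equivalence.to (neg-one-pow i) (trans (sym (∙-one _)) (trans (cong (pow (neg one) i ∙_) (sym hʲ≡1)) eq)) ,
              Equivalence.to (h-pow j) hʲ≡1
        where
        hʲ≡1 : pow h j ≡ one
        hʲ≡1 = pow-j (im-neg-one-pow-∙ i (pow h j) (cong im eq))
      from : L-ℤ/2×ℤ/2 (i , j) → word (neg one) h (i , j) ≡ one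
      from (2∣i , 2∣j) = trans (cong₂ _∙_ (Equivalence.from (neg-one-pow i) 2∣i) (Equivalence.from (h-pow j) 2∣j)) (one-∙ one)

    -- A cyclic group is given `one` as second generator, which matches the free second coordinate
    -- of `L-ℤ/n`.
    kernel-ℤ/n : ∀ {g} → IsUnit g → ∀ n .{{_ : ℕ.NonZero n}} → g ^ n ≡ one →
      (∀ r → r ℕ.< n → g ^ r ≡ one → r ≡ 0) → ∀ v → word g one v ≡ one ⇔ L-ℤ/n n v
    kernel-ℤ/n {g} a n gⁿ≡1 minimal (i , j) = mk⇔
      (λ eq → Equivalence.to kernel (trans (sym unfold) eq)) (λ n∣i → trans unfold (Equivalence.from kernel n∣i))
      where
      kernel : pow g i ≡ one ⇔ (+ n ∣ i)
      kernel = pow-kernel a n gⁿ≡1 minimal i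
      unfold : word g one (i , j) ≡ pow g i
      unfold = trans (cong (pow g i ∙_) (trans (cong (pow one) (sym (ℤP.*-identityʳ j))) (pow-multiple unit-one (+ 1) (one-∙ one) j)))
        (∙-one (pow g i))

  -- Inequalities, halving and searching for the descent.

  0≤+0≤ : ∀ {i j} → + 0 ≤ i → + 0 ≤ j → + 0 ≤ i + j
  0≤+0≤ p q = ℤP.+-mono-≤ p q

  0<+0≤ : ∀ {i j} → + 0 < i → + 0 ≤ j → + 0 < i + j
  0<+0≤ p q = ℤP.+-mono-<-≤ p q

  ≤-product : ∀ m n {i j} → + m ≤ i → + n ≤ j → + (m ℕ.* n) ≤ i * j
  ≤-product m n {+ k} {+ l} (+≤+ m≤k) (+≤+ n≤l) =
    subst (+ (m ℕ.* n) ≤_) (ℤP.pos-* k l) (+≤+ (ℕP.*-mono-≤ m≤k n≤l))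

  0≤i*j⇒0≤i : ∀ i {j} → + 0 < j → + 0 ≤ i * j → + 0 ≤ i
  0≤i*j⇒0≤i i {+ suc k} _ p = ℤP.*-cancelʳ-≤-pos (+ 0) i (+ suc k) p
  0≤i*j⇒0≤i i {+ zero} (+<+ ()) _

  0<i*j⇒0<i : ∀ i {j} → + 0 < j → + 0 < i * j → + 0 < i
  0<i*j⇒0<i i {+ suc k} _ p = ℤP.*-cancelʳ-<-nonNeg (+ suc k) p
  0<i*j⇒0<i i {+ zero} (+<+ ()) _

  0<2i⇒0<i : ∀ i → + 0 < + 2 * i → + 0 < i
  0<2i⇒0<i i p = 0<i*j⇒0<i i {+ 2} (+<+ (s≤s z≤n)) (subst (+ 0 <_) (ℤP.*-comm (+ 2) i) p)

  0≤2i⇒0≤i : ∀ i → + 0 ≤ + 2 * i → + 0 ≤ i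
  0≤2i⇒0≤i i p = 0≤i*j⇒0≤i i {+ 2} (+<+ (s≤s z≤n)) (subst (+ 0 ≤_) (ℤP.*-comm (+ 2) i) p)

  0<⇒1≤ : ∀ {i} → + 0 < i → + 1 ≤ i
  0<⇒1≤ = ℤP.i<j⇒suc[i]≤j

  ≤∧≢0⇒0< : ∀ {i} → + 0 ≤ i → ¬ i ≡ + 0 → + 0 < i
  ≤∧≢0⇒0< p q = ℤP.≤∧≢⇒< p (λ e → q (sym e))

  -- Meant for D = Δ: a unit of trace 0 would give Δu² = 4, and both values left for Δ are squares.
  D*k²≡4 : ∀ D k → D ℕ.* (k ℕ.* k) ≡ 4 → D ≡ 4 ⊎ D ≡ 1
  D*k²≡4 D 0 eq with trans (sym (ℕP.*-zeroʳ D)) eq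
  ... | ()
  D*k²≡4 D 1 eq = inj₁ (trans (sym (ℕP.*-identityʳ D)) eq)
  D*k²≡4 D 2 eq = inj₂ (ℕP.*-cancelʳ-≡ D 1 4 eq)
  D*k²≡4 zero (suc (suc (suc k))) ()
  D*k²≡4 (suc D) k@(suc (suc (suc l))) eq = ⊥-elim (ℕP.<-irrefl (sym eq) 4<)
    where
    4< : 4 ℕ.< suc D ℕ.* (k ℕ.* k)
    4< = ℕP.≤-trans (ℕP.m≤m+n 5 4) (ℕP.≤-trans (ℕP.*-mono-≤ {3} {k} {3} {k} 3≤k 3≤k) (ℕP.m≤n*m (k ℕ.* k) (suc D)))
      where
      3≤k : 3 ℕ.≤ k
      3≤k = s≤s (s≤s (s≤s z≤n))

  square-suc : ∀ n w → n * n ≡ n + + 2 * w → (+ 1 + n) * (+ 1 + n) ≡ (+ 1 + n) + + 2 * (w + n)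
  square-suc n w eq = trans (e n) (trans (cong (λ s → s + + 2 * n + + 1) eq) (f n w))
    where
    e : ∀ n → (+ 1 + n) * (+ 1 + n) ≡ n * n + + 2 * n + + 1
    e = solve-∀
    f : ∀ n w → (n + + 2 * w) + + 2 * n + + 1 ≡ (+ 1 + n) + + 2 * (w + n)
    f = solve-∀

  square-parity-ℕ : ∀ n → ∃[ w ] + n * + n ≡ + n + + 2 * w
  square-parity-ℕ zero = + 0 , refl
  square-parity-ℕ (suc n) = let w , eq = square-parity-ℕ n in w + + n , square-suc (+ n) w eq

  -- Justifies halving expressions such as t - b u: the quotient w enters ring identities directly.
  square-parity : ∀ z → ∃[ w ] z * z ≡ z + + 2 * w
  square-parity (+ n) = square-parity-ℕ n
  square-parity -[1+ n ] = let w , eq = square-parity-ℕ (suc n) in + suc n + w , trans eq (f (+ suc n) w)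
    where
    f : ∀ n w → n + + 2 * w ≡ - n + + 2 * (n + w)
    f = solve-∀

  IsSquare : ℤ → Set
  IsSquare z = ∃[ t ] + t * + t ≡ z

  isSquare? : ∀ z → Dec (IsSquare z)
  isSquare? (+ n) = map′
    (λ { (t , _ , eq) → t , trans (sym (ℤP.pos-* t t)) (cong +_ eq) })
    (λ { (t , eq) → let eq' = ℤP.+-injective (trans (ℤP.pos-* t t) eq) in
         t , s≤s (subst (t ℕ.≤_) eq' (m≤m*m t)) , eq' })
    (ℕP.anyUpTo? (λ t → t ℕ.* t ℕP.≟ n) (suc n))
  isSquare? -[1+ n ] = no λ { (t , eq) → absurd (subst (+ 0 ≤_) eq (0≤square (+ t))) }
    where
    absurd : ¬ (+ 0 ≤ -[1+ n ])
    absurd ()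

  least : ∀ {P : ℕ → Set} → (∀ n → Dec (P n)) → ∀ n → P n → ∃[ m ] (P m × (∀ k → P k → m ℕ.≤ k))
  least {P} P? = <-rec _ λ n rec Pn → case n rec Pn (ℕP.anyUpTo? P? n)
    where
    case : ∀ n → (∀ {m} → m ℕ.< n → P m → ∃[ m ] (P m × (∀ k → P k → m ℕ.≤ k))) → P n →
      Dec (∃[ m ] (m ℕ.< n × P m)) → ∃[ m ] (P m × (∀ k → P k → m ℕ.≤ k))
    case n rec Pn (yes (m , m<n , Pm)) = rec m<n Pm
    case n rec Pn (no none) = n , Pn , λ k Pk → ℕP.≮⇒≥ λ k<n → none (k , k<n , Pk)

  -- Multiplied by the positive u t₀ + t u₀, resp. t t₀ + Δ u u₀, the coordinates of 2 α ε⁻¹ become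
  -- expressions in the norms, whose signs can be read off.
  im-descent : ∀ Δ t u t₀ u₀ n₀ →
    (t * (n₀ * - u₀) + u * (n₀ * t₀)) * (u * t₀ + t * u₀) ≡
    n₀ * (u * u * (t₀ * t₀ - Δ * (u₀ * u₀)) - u₀ * u₀ * (t * t - Δ * (u * u)))
  im-descent = solve-∀

  tr-descent : ∀ Δ t u t₀ u₀ n₀ →
    (t * (n₀ * t₀) + Δ * (u * (n₀ * - u₀))) * (t * t₀ + Δ * (u * u₀)) ≡
    n₀ * ((t * t - Δ * (u * u)) * (t₀ * t₀ - Δ * (u₀ * u₀)) + Δ * (u * u) * (t₀ * t₀ - Δ * (u₀ * u₀)) + Δ * (u₀ * u₀) * (t * t - Δ * (u * u)))
  tr-descent = solve-∀

  -- As n₀² = 1, the expression is 4(u² - n n₀ u₀²).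
  im-gap : ∀ {n n₀ u u₀} → ±1 n → ±1 n₀ → + 0 ≤ u₀ → u₀ ≤ u →
    + 0 ≤ n₀ * (u * u * (+ 4 * n₀) - u₀ * u₀ * (+ 4 * n))
  im-gap {u = u} {u₀} σ σ₀ 0≤u₀ u₀≤u = go σ σ₀
    where
    diff : ∀ u u₀ → + 4 * ((u - u₀) * (u + u₀)) ≡ + 1 * (u * u * (+ 4 * + 1) - u₀ * u₀ * (+ 4 * + 1))
    diff = solve-∀
    diff' : ∀ u u₀ → + 4 * ((u - u₀) * (u + u₀)) ≡ - (+ 1) * (u * u * (+ 4 * - (+ 1)) - u₀ * u₀ * (+ 4 * - (+ 1)))
    diff' = solve-∀
    sum : ∀ u u₀ → + 4 * (u * u + u₀ * u₀) ≡ + 1 * (u * u * (+ 4 * + 1) - u₀ * u₀ * (+ 4 * - (+ 1)))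
    sum = solve-∀
    sum' : ∀ u u₀ → + 4 * (u * u + u₀ * u₀) ≡ - (+ 1) * (u * u * (+ 4 * - (+ 1)) - u₀ * u₀ * (+ 4 * + 1))
    sum' = solve-∀
    0≤4 : + 0 ≤ + 4
    0≤4 = +≤+ z≤n
    0≤diff : + 0 ≤ + 4 * ((u - u₀) * (u + u₀))
    0≤diff = 0≤*0≤ 0≤4 (0≤*0≤ (ℤP.i≤j⇒0≤j-i u₀≤u) (0≤+0≤ (ℤP.≤-trans 0≤u₀ u₀≤u) 0≤u₀))
    0≤sum : + 0 ≤ + 4 * (u * u + u₀ * u₀)
    0≤sum = 0≤*0≤ 0≤4 (0≤+0≤ (0≤square u) (0≤square u₀))
    go : ∀ {n n₀} → ±1 n → ±1 n₀ → + 0 ≤ n₀ * (u * u * (+ 4 * n₀) - u₀ * u₀ * (+ 4 * n))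
    go (inj₁ refl) (inj₁ refl) = subst (+ 0 ≤_) (diff u u₀) 0≤diff
    go (inj₂ refl) (inj₂ refl) = subst (+ 0 ≤_) (diff' u u₀) 0≤diff
    go (inj₂ refl) (inj₁ refl) = subst (+ 0 ≤_) (sum u u₀) 0≤sum
    go (inj₁ refl) (inj₂ refl) = subst (+ 0 ≤_) (sum' u u₀) 0≤sum

  -- As n₀² = 1, the expression is 16n + 4Δ(u² + n n₀ u₀²). The delicate case is n = -1, n₀ = 1,
  -- which needs Δ(u² - u₀²) ≥ 4: false for u = u₀, which is what the last hypothesis excludes, and
  -- true for u > u₀, where both factors are at least 2.
  tr-gap : ∀ {Δ n n₀ u u₀} → + 2 ≤ Δ → ±1 n → ±1 n₀ → + 1 ≤ u₀ → u₀ ≤ u → (u₀ ≡ u → n₀ ≡ - (+ 1) ⊎ n ≡ + 1) →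
    + 0 ≤ n₀ * ((+ 4 * n) * (+ 4 * n₀) + Δ * (u * u) * (+ 4 * n₀) + Δ * (u₀ * u₀) * (+ 4 * n))
  tr-gap {Δ} {u = u} {u₀} 2≤Δ σ σ₀ 1≤u₀ u₀≤u tie = go σ σ₀ tie
    where
    e₊₊ : ∀ Δ u u₀ → + 16 + + 4 * (Δ * (u * u + u₀ * u₀)) ≡
      + 1 * ((+ 4 * + 1) * (+ 4 * + 1) + Δ * (u * u) * (+ 4 * + 1) + Δ * (u₀ * u₀) * (+ 4 * + 1))
    e₊₊ = solve-∀
    e₊₋ : ∀ Δ u u₀ → + 16 + + 4 * (Δ * ((u - u₀) * (u + u₀))) ≡
      - (+ 1) * ((+ 4 * + 1) * (+ 4 * - (+ 1)) + Δ * (u * u) * (+ 4 * - (+ 1)) + Δ * (u₀ * u₀) * (+ 4 * + 1))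
    e₊₋ = solve-∀
    e₋₊ : ∀ Δ u u₀ → + 4 * (Δ * ((u - u₀) * (u + u₀)) - + 4) ≡
      + 1 * ((+ 4 * - (+ 1)) * (+ 4 * + 1) + Δ * (u * u) * (+ 4 * + 1) + Δ * (u₀ * u₀) * (+ 4 * - (+ 1)))
    e₋₊ = solve-∀
    e₋₋ : ∀ Δ u u₀ → + 4 * (Δ * (u * u + u₀ * u₀) - + 4) ≡
      - (+ 1) * ((+ 4 * - (+ 1)) * (+ 4 * - (+ 1)) + Δ * (u * u) * (+ 4 * - (+ 1)) + Δ * (u₀ * u₀) * (+ 4 * - (+ 1)))
    e₋₋ = solve-∀
    0≤4 : + 0 ≤ + 4
    0≤4 = +≤+ z≤n
    0≤16 : + 0 ≤ + 16
    0≤16 = +≤+ z≤n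
    0≤Δ : + 0 ≤ Δ
    0≤Δ = ℤP.≤-trans (+≤+ z≤n) 2≤Δ
    1≤u : + 1 ≤ u
    1≤u = ℤP.≤-trans 1≤u₀ u₀≤u
    2≤u²+u₀² : + 2 ≤ u * u + u₀ * u₀
    2≤u²+u₀² = ℤP.+-mono-≤ (≤-product 1 1 1≤u 1≤u) (≤-product 1 1 1≤u₀ 1≤u₀)
    0≤difference : + 0 ≤ (u - u₀) * (u + u₀)
    0≤difference = 0≤*0≤ (ℤP.i≤j⇒0≤j-i u₀≤u) (ℤP.≤-trans (+≤+ z≤n) (ℤP.+-mono-≤ 1≤u 1≤u₀))
    go : ∀ {n n₀} → ±1 n → ±1 n₀ → (u₀ ≡ u → n₀ ≡ - (+ 1) ⊎ n ≡ + 1) →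
      + 0 ≤ n₀ * ((+ 4 * n) * (+ 4 * n₀) + Δ * (u * u) * (+ 4 * n₀) + Δ * (u₀ * u₀) * (+ 4 * n))
    go (inj₁ refl) (inj₁ refl) _ = subst (+ 0 ≤_) (e₊₊ Δ u u₀)
      (0≤+0≤ 0≤16 (0≤*0≤ 0≤4 (0≤*0≤ 0≤Δ (ℤP.≤-trans (+≤+ z≤n) 2≤u²+u₀²))))
    go (inj₁ refl) (inj₂ refl) _ = subst (+ 0 ≤_) (e₊₋ Δ u u₀) (0≤+0≤ 0≤16 (0≤*0≤ 0≤4 (0≤*0≤ 0≤Δ 0≤difference)))
    go (inj₂ refl) (inj₂ refl) _ = subst (+ 0 ≤_) (e₋₋ Δ u u₀)
      (0≤*0≤ 0≤4 (ℤP.i≤j⇒0≤j-i (≤-product 2 2 2≤Δ 2≤u²+u₀²)))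
    go (inj₂ refl) (inj₁ refl) tie = subst (+ 0 ≤_) (e₋₊ Δ u u₀)
      (0≤*0≤ 0≤4 (ℤP.i≤j⇒0≤j-i (≤-product 2 2 2≤Δ (≤-product 1 2 1≤u-u₀ (ℤP.+-mono-≤ 1≤u 1≤u₀)))))
      where
      u-u₀≢0 : ¬ u - u₀ ≡ + 0
      u-u₀≢0 eq with tie (sym (ℤP.i-j≡0⇒i≡j u u₀ eq))
      ... | inj₁ ()
      ... | inj₂ ()
      1≤u-u₀ : + 1 ≤ u - u₀
      1≤u-u₀ = 0<⇒1≤ (≤∧≢0⇒0< (ℤP.i≤j⇒0≤j-i u₀≤u) u-u₀≢0)

  -- The right side is twice the growth of t + 2u under multiplication by ε. On the left the
  -- coefficient of t is at least 1 and that of u at least 0, as soon as t₀, u₀ ≥ 1 and Δ ≥ 2.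
  measure-identity : ∀ Δ t u t₀ u₀ →
    t * (+ 1 + (t₀ - + 1) + + 2 * (u₀ - + 1)) + u * (Δ * (u₀ - + 1) + (Δ - + 2) + + 2 * (t₀ - + 1)) ≡
    ((t * t₀ + Δ * (u * u₀)) + + 2 * (t * u₀ + u * t₀)) - + 2 * (t + + 2 * u)
  measure-identity = solve-∀

  2-out : ∀ t u t' u' → (+ 2 * t + + 2 * (+ 2 * u)) - + 2 * (t' + + 2 * u') ≡ + 2 * ((t + + 2 * u) - (t' + + 2 * u'))
  2-out = solve-∀

  i<suc⇒i≤ : ∀ {i m} → i < + suc m → i ≤ + m
  i<suc⇒i≤ {+ k} (+<+ (s≤s k≤m)) = +≤+ k≤m
  i<suc⇒i≤ { -[1+ k ]} _ = -≤+

  -- The scalar sought is (t - b)/2, where b stands for B k. It is integral because t ≡ t² ≡ Δk² ≡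
  -- b² ≡ b (mod 2), and w₁, w₂ make the quotient explicit.
  half-difference : ∀ C k t s b² Δk² w₁ w₂ → t + + 2 * w₁ ≡ Δk² + + 4 * s → b² ≡ Δk² + + 4 * (C * (k * k)) → 
    ∀ b → b² ≡ b + + 2 * w₂ → + 2 * (+ 2 * s - + 2 * (C * (k * k)) - w₁ + w₂) + b ≡ t
  half-difference C k t s b² Δk² w₁ w₂ e₁ e₂ b e₃ = begin
    + 2 * (+ 2 * s - + 2 * (C * (k * k)) - w₁ + w₂) + b              ≡⟨ p C k s w₁ w₂ b Δk² ⟩
    (Δk² + + 4 * s) - (Δk² + + 4 * (C * (k * k))) + (b + + 2 * w₂) - + 2 * w₁
      ≡⟨ cong₂ (λ x y → x - (Δk² + + 4 * (C * (k * k))) + y - + 2 * w₁) (sym e₁) (sym e₃) ⟩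
    (t + + 2 * w₁) - (Δk² + + 4 * (C * (k * k))) + b² - + 2 * w₁
      ≡⟨ cong (λ x → (t + + 2 * w₁) - (Δk² + + 4 * (C * (k * k))) + x - + 2 * w₁) e₂ ⟩
    (t + + 2 * w₁) - (Δk² + + 4 * (C * (k * k))) + (Δk² + + 4 * (C * (k * k))) - + 2 * w₁  ≡⟨ q t w₁ (Δk² + + 4 * (C * (k * k))) ⟩
    t ∎
    where
    open ≡-Reasoning
    p : ∀ C k s w₁ w₂ b Δk² → + 2 * (+ 2 * s - + 2 * (C * (k * k)) - w₁ + w₂) + b ≡
      (Δk² + + 4 * s) - (Δk² + + 4 * (C * (k * k))) + (b + + 2 * w₂) - + 2 * w₁
    p = solve-∀
    q : ∀ t w z → (t + + 2 * w) - z + z - + 2 * w ≡ t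
    q = solve-∀

  Bk²-identity : ∀ B C k → (B * k) * (B * k) ≡ (B * B - + 4 * C) * (k * k) + + 4 * (C * (k * k))
  Bk²-identity = solve-∀

  move-term : ∀ x y z → x ≡ y - z → y ≡ z + x
  move-term x y z refl = e y z
    where
    e : ∀ y z → y ≡ z + (y - z)
    e = solve-∀

  i-i+j : ∀ i j → (i + j) - i ≡ j
  i-i+j = solve-∀

  -- The element is X + Y√Δ in the basis 1, w, where √Δ = 2w - B.
  pell-element : ∀ B C X Y → (X - B * Y) * (X - B * Y) + B * (X - B * Y) * (+ 2 * Y) + C * (+ 2 * Y) * (+ 2 * Y) ≡
    X * X - (B * B - + 4 * C) * (Y * Y)
  pell-element = solve-∀

  0-Δu² : ∀ Δ u² → + 0 * + 0 - Δ * u² ≡ - (Δ * u²)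
  0-Δu² = solve-∀

  -- Positive non-square discriminant: choice of the fundamental unit.

  module Fundamental (B C : ℤ) (2≤Δ : + 2 ≤ Order.Δ B C) (nsq : NonSquare (Order.Δ B C)) where
    open Order B C
    open Order-Properties B C

    0<Δ : + 0 < Δ
    0<Δ = ℤP.<-≤-trans (+<+ (s≤s z≤n)) 2≤Δ

    Δ*u²≢4 : ∀ u → ¬ Δ * (u * u) ≡ + 4
    Δ*u²≢4 u eq with D*k²≡4 ∣ Δ ∣ ∣ u ∣ (trans (cong (∣ Δ ∣ ℕ.*_) (sym (ℤP.abs-* u u))) (trans (sym (ℤP.abs-* Δ (u * u))) (cong ∣_∣ eq)))
    ... | inj₁ D≡4 = nsq (+ 2) (trans (sym (ℤP.0≤i⇒+∣i∣≡i (ℤP.<⇒≤ 0<Δ))) (cong +_ D≡4))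
    ... | inj₂ D≡1 = nsq (+ 1) (trans (sym (ℤP.0≤i⇒+∣i∣≡i (ℤP.<⇒≤ 0<Δ))) (cong +_ D≡1))

    -- For t = 0 the norm equation reads 4N = -Δu², which leaves N = -1 and Δu² = 4.
    tr≢0 : ∀ {α} → IsUnit α → ¬ tr α ≡ + 0
    tr≢0 {α} (is-unit n) t≡0 = go n
      where
      Δu² = Δ * (im α * im α)
      eq : + 4 * N α ≡ - Δu²
      eq = trans (4N α) (trans (cong (λ t → t * t - Δu²) t≡0) (0-Δu² Δ (im α * im α)))
      Δu²≡ : Δu² ≡ - (+ 4 * N α)
      Δu²≡ = trans (sym (ℤP.neg-involutive Δu²)) (cong -_ (sym eq))
      0≤Δu² : + 0 ≤ Δu²
      0≤Δu² = 0≤*0≤ (ℤP.<⇒≤ 0<Δ) (0≤square (im α))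
      absurd : ¬ (+ 0 ≤ - (+ 4 * + 1))
      absurd ()
      go : ±1 (N α) → ⊥
      go (inj₁ n≡) = absurd (subst (+ 0 ≤_) (trans Δu²≡ (cong (λ n → - (+ 4 * n)) n≡)) 0≤Δu²)
      go (inj₂ n≡) = Δ*u²≢4 (im α) (trans Δu²≡ (cong (λ n → - (+ 4 * n)) n≡))

    -- The equation t² = Δk² + 4s: the condition for an element of norm s with im k, in a form
    -- decided by a bounded search for t.
    Solution : ℤ → ℕ → Set
    Solution s k = IsSquare (Δ * (+ k * + k) + + 4 * s)

    solution⇒element : ∀ s k → ((t , _) : Solution s k) → ∃[ α ] (im α ≡ + k × tr α ≡ + t × N α ≡ s)
    solution⇒element s k (t , eq) =
      let w₁ , e₁ = square-parity (+ t)
          w₂ , e₂ = square-parity (B * + k)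
          x = + 2 * s - + 2 * (C * (+ k * + k)) - w₁ + w₂
          tr≡ = trans (tr-def (elt x (+ k))) (half-difference C (+ k) (+ t) s ((B * + k) * (B * + k)) (Δ * (+ k * + k)) w₁ w₂
                  (trans (sym e₁) eq) (Bk²-identity B C (+ k)) (B * + k) e₂)
      in elt x (+ k) , refl , tr≡ , ℤP.*-cancelˡ-≡ (+ 4) (N (elt x (+ k))) s
           (trans (4N (elt x (+ k))) (trans (cong (_- Δ * (+ k * + k)) (trans (cong₂ _*_ tr≡ tr≡) eq)) (i-i+j (Δ * (+ k * + k)) (+ 4 * s))))

    element⇒solution : ∀ α k → im α ≡ + k → Solution (N α) k
    element⇒solution α k im≡ = ∣ tr α ∣ , trans (sym (trans (square-abs (tr α)) (ℤP.pos-* ∣ tr α ∣ ∣ tr α ∣)))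
      (trans (move-term (+ 4 * N α) (tr α * tr α) (Δ * (im α * im α)) (4N α)) (cong (λ u → Δ * (u * u) + + 4 * N α) im≡))

    UnitIm : ℕ → Set
    UnitIm k = 0 ℕ.< k × (Solution (- (+ 1)) k ⊎ Solution (+ 1) k)

    unitIm? : ∀ k → Dec (UnitIm k)
    unitIm? k = (0 ℕP.<? k) ×-dec (isSquare? _ ⊎-dec isSquare? _)

    unit⇒unitIm : ∀ {α} k → IsUnit α → 0 ℕ.< k → im α ≡ + k → UnitIm k
    unit⇒unitIm {α} k (is-unit (inj₁ n≡)) 0<k im≡ = 0<k , inj₂ (subst (λ s → Solution s k) n≡ (element⇒solution α k im≡))
    unit⇒unitIm {α} k (is-unit (inj₂ n≡)) 0<k im≡ = 0<k , inj₁ (subst (λ s → Solution s k) n≡ (element⇒solution α k im≡))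

    -- The starting point for the search of the least k is the unit X + Y√Δ, with im 2Y.
    some-unitIm : ∃[ k ] UnitIm k
    some-unitIm =
      let X , Y , 0<Y , eq = River.Periodic.pell Δ 0<Δ nsq
          0<2Y = 0<*0< {+ 2} (+<+ (s≤s z≤n)) 0<Y
          2Y≡ = sym (ℤP.0≤i⇒+∣i∣≡i (ℤP.<⇒≤ 0<2Y))
      in ∣ + 2 * Y ∣ , unit⇒unitIm {elt (X - B * Y) (+ 2 * Y)} ∣ + 2 * Y ∣
        (is-unit (inj₁ (trans (N-def _ _) (trans (pell-element B C X Y) eq))))
        (ℤP.drop‿+<+ (subst (+ 0 <_) 2Y≡ 0<2Y)) 2Y≡

    record IsFundamental (ε : Elt) : Set where
      field
        unit : IsUnit ε
        0<tr : + 0 < tr ε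
        0<im : + 0 < im ε
        im-least : ∀ {α} → IsUnit α → + 0 < im α → im ε ≤ im α
        -- Among units with the least `im`, norm -1 takes precedence; otherwise α ε⁻¹ could have a
        -- negative trace.
        tie : ∀ {α} → im ε ≡ im α → N ε ≡ - (+ 1) ⊎ ¬ N α ≡ - (+ 1)

    fundamental-from : ∀ s k → ±1 s → 0 ℕ.< k → (∀ l → UnitIm l → k ℕ.≤ l) → (s ≡ - (+ 1) ⊎ ¬ Solution (- (+ 1)) k) →
      Solution s k → ∃[ ε ] IsFundamental ε
    fundamental-from s k σ 0<k minimal sign sol =
      let ε , im≡ , tr≡ , N≡ = solution⇒element s k sol
          unit = is-unit (subst ±1 (sym N≡) σ)
      in ε , record
        { unit = unit
        -- The trace is a natural square root, so only 0 has to be excluded.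
        ; 0<tr = ≤∧≢0⇒0< (subst (+ 0 ≤_) (sym tr≡) (+≤+ z≤n)) (tr≢0 unit)
        ; 0<im = subst (+ 0 <_) (sym im≡) (+<+ 0<k)
        ; im-least = λ {α} a 0<u → 
            let u≡ = sym (ℤP.0≤i⇒+∣i∣≡i (ℤP.<⇒≤ 0<u))
            in subst₂ _≤_ (sym im≡) (sym u≡)
                 (+≤+ (minimal ∣ im α ∣ (unit⇒unitIm ∣ im α ∣ a (ℤP.drop‿+<+ (subst (+ 0 <_) u≡ 0<u)) u≡)))
        ; tie = λ {α} u≡ → tie {α} N≡ (trans (sym u≡) im≡) sign }
      where
      tie : ∀ {α ε} → N ε ≡ s → im α ≡ + k → (s ≡ - (+ 1) ⊎ ¬ Solution (- (+ 1)) k) → N ε ≡ - (+ 1) ⊎ ¬ N α ≡ - (+ 1)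
      tie N≡ u≡ (inj₁ s≡) = inj₁ (trans N≡ s≡)
      tie {α} N≡ u≡ (inj₂ none) = inj₂ λ n≡ → none (subst (λ s → Solution s k) n≡ (element⇒solution α k u≡))

    fundamental : ∃[ ε ] IsFundamental ε
    fundamental =
      let k , (0<k , sols) , minimal = least unitIm? (proj₁ some-unitIm) (proj₂ some-unitIm)
      in choose k 0<k minimal sols (isSquare? _)
      where
      choose : ∀ k → 0 ℕ.< k → (∀ l → UnitIm l → k ℕ.≤ l) → Solution (- (+ 1)) k ⊎ Solution (+ 1) k →
        Dec (Solution (- (+ 1)) k) → ∃[ ε ] IsFundamental ε
      choose k 0<k minimal _ (yes sol) = fundamental-from (- (+ 1)) k (inj₂ refl) 0<k minimal (inj₁ refl) sol
      choose k 0<k minimal (inj₁ sol) (no none) = ⊥-elim (none sol)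
      choose k 0<k minimal (inj₂ sol) (no none) = fundamental-from (+ 1) k (inj₁ refl) 0<k minimal (inj₂ none) sol

  -- Positive non-square discriminant: descent to powers of ε.

  module Generation (B C : ℤ) (2≤Δ : + 2 ≤ Order.Δ B C) (nsq : NonSquare (Order.Δ B C)) where
    open Order B C
    open Order-Properties B C
    open Fundamental B C 2≤Δ nsq

    ∙-pos : ∀ {α β} → + 0 < tr α → + 0 < im α → + 0 < tr β → + 0 ≤ im β → + 0 < tr (α ∙ β) × + 0 < im (α ∙ β)
    ∙-pos {α} {β} 0<t 0<u 0<t' 0≤u' =
      0<2i⇒0<i _ (subst (+ 0 <_) (sym (tr-∙ α β)) (0<+0≤ (0<*0< 0<t 0<t') (0≤*0≤ (ℤP.<⇒≤ 0<Δ) (0≤*0≤ (ℤP.<⇒≤ 0<u) 0≤u')))) ,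
      0<2i⇒0<i _ (subst (+ 0 <_) (sym (im-∙ α β)) (ℤP.+-mono-≤-< (0≤*0≤ (ℤP.<⇒≤ 0<t) 0≤u') (0<*0< 0<u 0<t')))

    tr-one : tr one ≡ + 2
    tr-one = trans (tr-def one) (cong (λ z → + 2 * + 1 + z) (ℤP.*-zeroʳ B))

    tr-neg-one : tr (neg one) ≡ - (+ 2)
    tr-neg-one = trans (tr-neg one) (cong -_ tr-one)

    module _ {ε : Elt} (fund : IsFundamental ε) where
      open IsFundamental fund

      -- The gap lemmas yield weak inequalities only; the trace becomes strictly positive because no
      -- unit has trace 0.
      descent : ∀ {α} → IsUnit α → + 0 < tr α → + 0 < im α →
        + 0 < tr (α ∙ inv ε) × + 0 ≤ im (α ∙ inv ε)
      descent {α} a 0<t 0<u = ≤∧≢0⇒0< 0≤tr' (tr≢0 (unit-∙ a (unit-inv unit))) , 0≤im'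
        where
        t = tr α
        u = im α
        t₀ = tr ε
        u₀ = im ε
        n₀ = N ε
        im≡ : + 2 * im (α ∙ inv ε) ≡ t * (n₀ * - u₀) + u * (n₀ * t₀)
        im≡ = trans (im-∙ α (inv ε)) (cong₂ (λ y z → t * y + u * z) (im-inv ε) (tr-inv ε))
        tr≡ : + 2 * tr (α ∙ inv ε) ≡ t * (n₀ * t₀) + Δ * (u * (n₀ * - u₀))
        tr≡ = trans (tr-∙ α (inv ε)) (cong₂ (λ y z → t * y + Δ * (u * z)) (tr-inv ε) (im-inv ε))
        u₀≤u : u₀ ≤ u
        u₀≤u = im-least a 0<u
        tie' : ±1 (N α) → u₀ ≡ u → n₀ ≡ - (+ 1) ⊎ N α ≡ + 1
        tie' σ eq with tie {α} eq | σ
        ... | inj₁ n₀≡ | _ = inj₁ n₀≡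
        ... | inj₂ _ | inj₁ n≡ = inj₂ n≡
        ... | inj₂ n≢ | inj₂ n≡ = ⊥-elim (n≢ n≡)
        0≤im' : + 0 ≤ im (α ∙ inv ε)
        0≤im' = 0≤2i⇒0≤i _ (0≤i*j⇒0≤i (+ 2 * im (α ∙ inv ε)) (0<+0≤ (0<*0< 0<u 0<tr) (ℤP.<⇒≤ (0<*0< 0<t 0<im)))
          (subst (+ 0 ≤_) (sym (trans (cong (_* (u * t₀ + t * u₀)) im≡) (trans (im-descent Δ t u t₀ u₀ n₀)
            (cong₂ (λ y z → n₀ * (u * u * y - u₀ * u₀ * z)) (sym (4N ε)) (sym (4N α))))))
            (im-gap (norm-±1 a) (norm-±1 unit) (ℤP.<⇒≤ 0<im) u₀≤u)))
        0≤tr' : + 0 ≤ tr (α ∙ inv ε)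
        0≤tr' = 0≤2i⇒0≤i _ (0≤i*j⇒0≤i (+ 2 * tr (α ∙ inv ε))
          (0<+0≤ (0<*0< 0<t 0<tr) (0≤*0≤ (ℤP.<⇒≤ 0<Δ) (ℤP.<⇒≤ (0<*0< 0<u 0<im))))
          (subst (+ 0 ≤_) (sym (trans (cong (_* (t * t₀ + Δ * (u * u₀))) tr≡) (trans (tr-descent Δ t u t₀ u₀ n₀)
            (cong₂ (λ y z → n₀ * (z * y + Δ * (u * u) * y + Δ * (u₀ * u₀) * z)) (sym (4N ε)) (sym (4N α))))))
            (tr-gap 2≤Δ (norm-±1 a) (norm-±1 unit) (0<⇒1≤ 0<im) u₀≤u (tie' (norm-±1 a)))))

      size : Elt → ℤ
      size α = tr α + + 2 * im α

      size-∙ : ∀ {β} → + 0 < tr β → + 0 ≤ im β → size β < size (β ∙ ε)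
      size-∙ {β} 0<t 0≤u = ℤP.≰⇒> λ le → ℤP.<-irrefl refl (ℤP.<-≤-trans 0<gap (ℤP.i≤j⇒i-j≤0 le))
        where
        t = tr β
        u = im β
        t₀ = tr ε
        u₀ = im ε
        0<2gap : + 0 < + 2 * (size (β ∙ ε) - size β)
        0<2gap = subst (+ 0 <_)
          (trans (measure-identity Δ t u t₀ u₀) (trans
            (cong₂ (λ y z → (y + + 2 * z) - + 2 * (t + + 2 * u)) (sym (tr-∙ β ε)) (sym (im-∙ β ε)))
            (2-out (tr (β ∙ ε)) (im (β ∙ ε)) t u)))
          (0<+0≤
            (0<*0< 0<t (0<+0≤ (0<+0≤ (+<+ (s≤s z≤n)) (ℤP.i≤j⇒0≤j-i (0<⇒1≤ 0<tr)))
              (0≤*0≤ {+ 2} (+≤+ z≤n) (ℤP.i≤j⇒0≤j-i (0<⇒1≤ 0<im)))))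
            (0≤*0≤ 0≤u (0≤+0≤ (0≤+0≤ (0≤*0≤ (ℤP.<⇒≤ 0<Δ) (ℤP.i≤j⇒0≤j-i (0<⇒1≤ 0<im))) (ℤP.i≤j⇒0≤j-i 2≤Δ))
              (0≤*0≤ {+ 2} (+≤+ z≤n) (ℤP.i≤j⇒0≤j-i (0<⇒1≤ 0<tr))))))
        0<gap : + 0 < size (β ∙ ε) - size β
        0<gap = 0<2i⇒0<i _ 0<2gap

      α∙inv∙ε : ∀ α → (α ∙ inv ε) ∙ ε ≡ α
      α∙inv∙ε α = trans (∙-assoc α (inv ε) ε) (trans (cong (α ∙_) (inv-∙ unit)) (∙-one α))

      -- Induction on a bound for `size`: one factor ε is split off while im > 0. At im = 0 the unit
      -- is ±1, and tr > 0 excludes -1.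
      power-of : ∀ m {α} → IsUnit α → + 0 < tr α → + 0 ≤ im α → size α ≤ + m → ∃[ n ] α ≡ ε ^ n
      power-of zero {α} a 0<t 0≤u bound =
        ⊥-elim (ℤP.<-irrefl refl (ℤP.<-≤-trans (0<+0≤ 0<t (0≤*0≤ {+ 2} (+≤+ z≤n) 0≤u)) bound))
      power-of (suc m) {α} a 0<t 0≤u bound with ℤP._≟_ (im α) (+ 0)
      ... | yes u≡0 with unit-im0 a u≡0
      ...   | inj₁ α≡1 = 0 , α≡1
      ...   | inj₂ α≡-1 with subst (+ 0 <_) (trans (cong tr α≡-1) tr-neg-one) 0<t
      ...     | ()
      power-of (suc m) {α} a 0<t 0≤u bound | no u≢0 =
        let 0<t' , 0≤u' = descent a 0<t (≤∧≢0⇒0< 0≤u u≢0)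
            smaller = subst (λ ξ → size (α ∙ inv ε) < size ξ) (α∙inv∙ε α) (size-∙ 0<t' 0≤u')
            n , eq = power-of m (unit-∙ a (unit-inv unit)) 0<t' 0≤u' (i<suc⇒i≤ (ℤP.<-≤-trans smaller bound))
        in suc n , trans (sym (α∙inv∙ε α)) (trans (cong (_∙ ε) eq) (∙-comm (ε ^ n) ε))

      Span : Elt → Set
      Span α = ∃[ v ] α ≡ word (neg one) ε v

      span-pos : ∀ {α} → IsUnit α → + 0 < tr α → + 0 ≤ im α → Span α
      span-pos {α} a 0<t 0≤u =
        let n , eq = power-of ∣ size α ∣ a 0<t 0≤u (ℤP.≤-reflexive (sym (ℤP.0≤i⇒+∣i∣≡i
                       (ℤP.<⇒≤ (0<+0≤ 0<t (0≤*0≤ {+ 2} (+≤+ z≤n) 0≤u))))))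
        in (+ 0 , + n) , trans eq (sym (one-∙ (ε ^ n)))

      neg-neg : ∀ α → neg one ∙ neg α ≡ α
      neg-neg α = trans (cong (neg one ∙_) (sym (neg-one-∙ α))) (trans (sym (∙-assoc (neg one) (neg one) α))
        (trans (cong (_∙ α) (trans (cong (neg one ∙_) (sym (∙-one (neg one)))) neg-one-^2)) (one-∙ α)))

      span-neg : ∀ {α} → IsUnit α → tr α < + 0 → im α ≤ + 0 → Span α
      span-neg {α} a t<0 u≤0 =
        let (i , j) , eq = span-pos (unit-neg a) (subst (+ 0 <_) (sym (tr-neg α)) (ℤP.neg-mono-< t<0))
                             (subst (+ 0 ≤_) (sym (im-neg α)) (ℤP.neg-mono-≤ u≤0))
        in (+ 1 + i , + 0 + j) , trans (sym (neg-neg α)) (trans (cong (neg one ∙_) eq)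
             (sym (trans (word-+ unit-neg-one unit (+ 1) (+ 0) i j)
               (cong (_∙ word (neg one) ε (i , j)) (trans (∙-one _) (∙-one _))))))

      span-inv : ∀ {α} → IsUnit α → Span (inv α) → Span α
      span-inv {α} a ((i , j) , eq) = (- i , - j) , ∙-inverse-unique (inv α) α (word (neg one) ε (- i , - j)) (inv-∙ a)
        (trans (cong (_∙ word (neg one) ε (- i , - j)) eq) (trans (sym (word-+ unit-neg-one unit i j (- i) (- j)))
          (trans (cong₂ (λ x y → word (neg one) ε (x , y)) (ℤP.+-inverseʳ i) (ℤP.+-inverseʳ j)) (one-∙ one))))

      N* : ∀ {α n} → N α ≡ n → (tr (inv α) ≡ n * tr α) × (im (inv α) ≡ n * - im α)
      N* {α} n≡ = trans (tr-inv α) (cong (_* tr α) n≡) , trans (im-inv α) (cong (_* - im α) n≡)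

      -- The inverse has coordinates (N t, -N u), so inversion flips the sign of im when N = 1 and
      -- of tr when N = -1. Either way the two signs then agree.
      span-mixed : ∀ {α} → IsUnit α → (+ 0 < tr α × im α ≤ + 0) ⊎ (tr α < + 0 × + 0 ≤ im α) → Span α
      span-mixed {α} a@(is-unit (inj₁ n≡)) signs with N* {α} n≡ | signs
      ... | t≡ , u≡ | inj₁ (0<t , u≤0) = span-inv a (span-pos (unit-inv a)
        (subst (+ 0 <_) (sym (trans t≡ (ℤP.*-identityˡ _))) 0<t)
        (subst (+ 0 ≤_) (sym (trans u≡ (ℤP.*-identityˡ _))) (ℤP.neg-mono-≤ u≤0)))
      ... | t≡ , u≡ | inj₂ (t<0 , 0≤u) = span-inv a (span-neg (unit-inv a)
        (subst (_< + 0) (sym (trans t≡ (ℤP.*-identityˡ _))) t<0)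
        (subst (_≤ + 0) (sym (trans u≡ (ℤP.*-identityˡ _))) (ℤP.neg-mono-≤ 0≤u)))
      span-mixed {α} a@(is-unit (inj₂ n≡)) signs with N* {α} n≡ | signs
      ... | t≡ , u≡ | inj₁ (0<t , u≤0) = span-inv a (span-neg (unit-inv a)
        (subst (_< + 0) (sym (trans t≡ (ℤP.-1*i≡-i _))) (ℤP.neg-mono-< 0<t))
        (subst (_≤ + 0) (sym (trans u≡ (trans (ℤP.-1*i≡-i _) (ℤP.neg-involutive _)))) u≤0))
      ... | t≡ , u≡ | inj₂ (t<0 , 0≤u) = span-inv a (span-pos (unit-inv a)
        (subst (+ 0 <_) (sym (trans t≡ (ℤP.-1*i≡-i _))) (ℤP.neg-mono-< t<0))
        (subst (+ 0 ≤_) (sym (trans u≡ (trans (ℤP.-1*i≡-i _) (ℤP.neg-involutive _)))) 0≤u))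

      span : ∀ {α} → IsUnit α → Span α
      span {α} a with ℤP.<-cmp (tr α) (+ 0) | ℤP.≤-total (+ 0) (im α)
      ... | tri≈ _ t≡0 _ | _ = ⊥-elim (tr≢0 a t≡0)
      ... | tri> _ _ 0<t | inj₁ 0≤u = span-pos a 0<t 0≤u
      ... | tri> _ _ 0<t | inj₂ u≤0 = span-mixed a (inj₁ (0<t , u≤0))
      ... | tri< t<0 _ _ | inj₁ 0≤u = span-mixed a (inj₂ (t<0 , 0≤u))
      ... | tri< t<0 _ _ | inj₂ u≤0 = span-neg a t<0 u≤0

      ^-pos : ∀ n → + 0 < tr (ε ^ n) × + 0 ≤ im (ε ^ n)
      ^-pos zero = subst (+ 0 <_) (sym tr-one) (+<+ (s≤s z≤n)) , +≤+ z≤n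
      ^-pos (suc n) = let 0<t , 0≤u = ^-pos n
                          0<t' , 0<u' = ∙-pos 0<tr 0<im 0<t 0≤u
                      in 0<t' , ℤP.<⇒≤ 0<u'

      im-^-suc : ∀ n → ¬ im (ε ^ suc n) ≡ + 0
      im-^-suc n eq = let 0<t , 0≤u = ^-pos n
                      in ℤP.<-irrefl (sym eq) (proj₂ (∙-pos {ε} {ε ^ n} 0<tr 0<im 0<t 0≤u))

      free : ∀ j → im (pow ε j) ≡ + 0 → j ≡ + 0
      free (+ zero) _ = refl
      free (+ suc n) eq = ⊥-elim (im-^-suc n eq)
      -- A negative power with im 0 would be ±1, hence so would its inverse ε^(n+1), whose im is
      -- positive.
      free -[1+ n ] eq = ⊥-elim (im-^-suc n (im0 (unit-im0 (unit-pow -[1+ n ] unit) eq)))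
        where
        product : ε ^ suc n ∙ pow ε -[1+ n ] ≡ one
        product = pow-neg-∙ unit -[1+ n ]
        im-one : ∀ {β γ} → β ∙ γ ≡ one → γ ≡ one ⊎ γ ≡ neg one → im β ≡ + 0
        im-one {β} eq (inj₁ refl) = cong im (trans (sym (∙-one β)) eq)
        im-one {β} eq (inj₂ refl) = ℤP.neg-injective (trans (sym (im-neg β)) (cong im (trans (sym (trans (∙-comm β (neg one)) (neg-one-∙ β))) eq)))
        im0 : pow ε -[1+ n ] ≡ one ⊎ pow ε -[1+ n ] ≡ neg one → im (ε ^ suc n) ≡ + 0
        im0 = im-one {ε ^ suc n} product

  -- Negative and square discriminants.

  ∣i∣≡n⇒i≡±n : ∀ i {n} → ∣ i ∣ ≡ n → i ≡ + n ⊎ i ≡ - (+ n)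
  ∣i∣≡n⇒i≡±n (+ _) refl = inj₁ refl
  ∣i∣≡n⇒i≡±n -[1+ _ ] refl = inj₂ refl

  n²≡1 : ∀ n → n ℕ.* n ≡ 1 → n ≡ 1
  n²≡1 n = ℕP.m*n≡1⇒m≡1 n n

  n²≡4 : ∀ n → n ℕ.* n ≡ 4 → n ≡ 2
  n²≡4 2 _ = refl
  n²≡4 (suc (suc (suc n))) eq = ⊥-elim (ℕP.<⇒≢ (ℕP.≤-trans (ℕP.m≤m+n 5 4) (ℕP.*-mono-≤ {3} {3 ℕ.+ n} {3} {3 ℕ.+ n} 3≤ 3≤)) (sym eq))
    where
    3≤ : 3 ℕ.≤ 3 ℕ.+ n
    3≤ = s≤s (s≤s (s≤s z≤n))

  -- With m = n + 1 + d the difference of the squares is 1 + 2(n + d) + 2nd + d². For n ≥ 1 it is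
  -- odd if d = 0 and at least 8 otherwise.
  n²+4 : ∀ m n → m ℕ.* m ≡ n ℕ.* n ℕ.+ 4 → n ≡ 0
  n²+4 m n eq = go (ℕP.m≤n⇒∃[o]m+o≡n n<m)
    where
    n<m : n ℕ.< m
    n<m = ℕP.≰⇒> λ m≤n → ℕP.<⇒≢ (ℕP.≤-<-trans (ℕP.*-mono-≤ m≤n m≤n) (ℕP.m<m+n (n ℕ.* n) {4} (s≤s z≤n))) eq
    e : ∀ n d → suc (n ℕ.+ d) ℕ.* suc (n ℕ.+ d) ≡ n ℕ.* n ℕ.+ (1 ℕ.+ 2 ℕ.* (n ℕ.+ d) ℕ.+ 2 ℕ.* n ℕ.* d ℕ.+ d ℕ.* d)
    e = solve-∀-ℕ
    e₀ : ∀ n → 1 ℕ.+ 2 ℕ.* (n ℕ.+ 0) ℕ.+ 2 ℕ.* n ℕ.* 0 ℕ.+ 0 ℕ.* 0 ≡ suc (n ℕ.* 2)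
    e₀ = solve-∀-ℕ
    e₁ : ∀ n d → 1 ℕ.+ 2 ℕ.* (suc n ℕ.+ suc d) ℕ.+ 2 ℕ.* suc n ℕ.* suc d ℕ.+ suc d ℕ.* suc d ≡ 5 ℕ.+ (3 ℕ.+ 4 ℕ.* n ℕ.+ 2 ℕ.* n ℕ.* d ℕ.+ 6 ℕ.* d ℕ.+ d ℕ.* d)
    e₁ = solve-∀-ℕ
    odd≢4 : ∀ k → ¬ suc (k ℕ.* 2) ≡ 4
    odd≢4 0 ()
    odd≢4 1 ()
    odd≢4 (suc (suc k)) ()
    gap : ∀ d → suc n ℕ.+ d ≡ m → 1 ℕ.+ 2 ℕ.* (n ℕ.+ d) ℕ.+ 2 ℕ.* n ℕ.* d ℕ.+ d ℕ.* d ≡ 4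
    gap d refl = ℕP.+-cancelˡ-≡ (n ℕ.* n) _ 4 (trans (sym (e n d)) eq)
    cases : ∀ n d → 1 ℕ.+ 2 ℕ.* (n ℕ.+ d) ℕ.+ 2 ℕ.* n ℕ.* d ℕ.+ d ℕ.* d ≡ 4 → n ≡ 0
    cases zero d _ = refl
    cases (suc n) zero g = ⊥-elim (odd≢4 (suc n) (trans (sym (e₀ (suc n))) g))
    cases (suc n) (suc d) g with trans (sym (e₁ n d)) g
    ... | ()
    go : ∃[ d ] suc n ℕ.+ d ≡ m → n ≡ 0
    go (d , m≡) = cases n d (gap d m≡)

  -[-D*u²] : ∀ t D u² → t - (- D) * u² ≡ t + D * u²
  -[-D*u²] = solve-∀

  t²-[ku]² : ∀ t k u → t * t - (k * k) * (u * u) ≡ t * t - (k * u) * (k * u)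
  t²-[ku]² = solve-∀

  -- B ≡ B² ≡ Δ (mod 2), with explicit quotient.
  half-residue : ∀ C B w δ ρ → B * B ≡ B + + 2 * w → B * B - + 4 * C ≡ + 2 * δ + ρ → B ≡ + 2 * (δ + + 2 * C - w) + ρ
  half-residue C B w δ ρ e₁ e₂ = begin
    B                                                     ≡⟨ p B C w ⟩
    (B + + 2 * w) - + 4 * C + (+ 4 * C - + 2 * w)         ≡⟨ cong (λ s → s - + 4 * C + (+ 4 * C - + 2 * w)) (sym e₁) ⟩
    B * B - + 4 * C + (+ 4 * C - + 2 * w)                 ≡⟨ cong (_+ (+ 4 * C - + 2 * w)) e₂ ⟩
    (+ 2 * δ + ρ) + (+ 4 * C - + 2 * w)                   ≡⟨ q C w δ ρ ⟩
    + 2 * (δ + + 2 * C - w) + ρ ∎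
    where
    open ≡-Reasoning
    p : ∀ B C w → B ≡ (B + + 2 * w) - + 4 * C + (+ 4 * C - + 2 * w)
    p = solve-∀
    q : ∀ C w δ ρ → (+ 2 * δ + ρ) + (+ 4 * C - + 2 * w) ≡ + 2 * (δ + + 2 * C - w) + ρ
    q = solve-∀

  2+1*j : ∀ j → + 2 * j + + 1 * + 2 ≡ + 2 * (+ 1 + j)
  2+1*j = solve-∀

  2-1*j : ∀ j → + 2 * - j + - (+ 1) * + 2 ≡ + 2 * - (+ 1 + j)
  2-1*j = solve-∀

  module SmallDiscriminant (B C : ℤ) where
    open Order B C
    open Order-Properties B C

    -- (tr , im) determines an element, and products are easier to compute in these coordinates.
    TU : Elt → ℤ → ℤ → Set
    TU α t u = tr α ≡ t × im α ≡ u

    TU-unique : ∀ {α β t u} → TU α t u → TU β t u → α ≡ β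
    TU-unique (t≡ , u≡) (t'≡ , u'≡) = tr-im-injective (trans t≡ (sym t'≡)) (trans u≡ (sym u'≡))

    TU-∙ : ∀ {α β t u t' u' δ} t″ u″ → Δ ≡ δ → TU α t u → TU β t' u' →
      t * t' + δ * (u * u') ≡ + 2 * t″ → t * u' + u * t' ≡ + 2 * u″ → TU (α ∙ β) t″ u″
    TU-∙ {α} {β} t″ u″ refl (refl , refl) (refl , refl) e f =
      ℤP.*-cancelˡ-≡ (+ 2) _ _ (trans (tr-∙ α β) e) , ℤP.*-cancelˡ-≡ (+ 2) _ _ (trans (im-∙ α β) f)

    TU-one : TU one (+ 2) (+ 0)
    TU-one = trans (tr-def one) (cong (λ z → + 2 * + 1 + z) (ℤP.*-zeroʳ B)) , refl

    TU-≢one : ∀ {α t u} → TU α t u → ¬ t ≡ + 2 → ¬ α ≡ one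
    TU-≢one (t≡ , _) t≢ eq = t≢ (trans (sym t≡) (trans (cong tr eq) (proj₁ TU-one)))

    TU-neg : ∀ {α t u} → TU α t u → TU (neg α) (- t) (- u)
    TU-neg {α} (refl , refl) = tr-neg α , im-neg α

    TU-unit : ∀ {α t u δ} n → ±1 n → Δ ≡ δ → TU α t u → t * t - δ * (u * u) ≡ + 4 * n → IsUnit α
    TU-unit {α} n σ refl (refl , refl) eq = is-unit (subst ±1 (ℤP.*-cancelˡ-≡ (+ 4) n (N α) (trans (sym eq) (sym (4N α)))) σ)

    -- 4N = t² + D u² is never negative, which rules out norm -1.
    negative-norm : ∀ {α} D → Δ ≡ - (+ D) → IsUnit α → ∣ tr α ∣ ℕ.* ∣ tr α ∣ ℕ.+ D ℕ.* (∣ im α ∣ ℕ.* ∣ im α ∣) ≡ 4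
    negative-norm {α} D Δ≡ (is-unit n) = go n
      where
      T = ∣ tr α ∣ ℕ.* ∣ tr α ∣
      U = ∣ im α ∣ ℕ.* ∣ im α ∣
      eq : + 4 * N α ≡ + (T ℕ.+ D ℕ.* U)
      eq = trans (4N α) (trans (cong (λ δ → tr α * tr α - δ * (im α * im α)) Δ≡)
        (trans (-[-D*u²] (tr α * tr α) (+ D) (im α * im α))
        (cong₂ _+_ (square-abs (tr α)) (trans (cong (+ D *_) (square-abs (im α))) (sym (ℤP.pos-* D U))))))
      absurd : ∀ {m} → ¬ (+ 4 * - (+ 1) ≡ + m)
      absurd ()
      go : ±1 (N α) → T ℕ.+ D ℕ.* U ≡ 4
      go (inj₁ n≡) = ℤP.+-injective (trans (sym eq) (cong (+ 4 *_) n≡))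
      go (inj₂ n≡) = ⊥-elim (absurd (trans (cong (+ 4 *_) (sym n≡)) eq))

    -- t² and (ku)² differ by 4, and the only such squares are 0 and 4; the sign of the norm tells
    -- which is which.
    square-norm : ∀ {α} k → Δ ≡ + k * + k → IsUnit α →
      (∣ tr α ∣ ≡ 2 × k ℕ.* ∣ im α ∣ ≡ 0) ⊎ (∣ tr α ∣ ≡ 0 × k ℕ.* ∣ im α ∣ ≡ 2)
    square-norm {α} k Δ≡ (is-unit n) = go n
      where
      T = ∣ tr α ∣
      V = k ℕ.* ∣ im α ∣
      ∣ku∣ : ∣ + k * im α ∣ ≡ V
      ∣ku∣ = ℤP.abs-* (+ k) (im α)
      eq : + 4 * N α ≡ + (T ℕ.* T) - + (V ℕ.* V)
      eq = trans (4N α) (trans (cong (λ δ → tr α * tr α - δ * (im α * im α)) Δ≡)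
        (trans (t²-[ku]² (tr α) (+ k) (im α)) (cong₂ _-_ (square-abs (tr α))
          (trans (square-abs (+ k * im α)) (cong (λ v → + (v ℕ.* v)) ∣ku∣)))))
      plus : ∀ p q → + 4 ≡ + p - + q → p ≡ q ℕ.+ 4
      plus p q e = ℤP.+-injective (move-term (+ 4) (+ p) (+ q) e)
      minus : ∀ p q → - (+ 4) ≡ + p - + q → q ≡ p ℕ.+ 4
      minus p q e = plus q p (trans (cong -_ e) (flip (+ p) (+ q)))
        where
        flip : ∀ p q → - (p - q) ≡ q - p
        flip = solve-∀
      finish : ∀ m n → m ℕ.* m ≡ n ℕ.* n ℕ.+ 4 → m ≡ 2 × n ≡ 0
      finish m n e = let n≡0 = n²+4 m n e in n²≡4 m (trans e (cong (λ n → n ℕ.* n ℕ.+ 4) n≡0)) , n≡0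
      go : ±1 (N α) → (T ≡ 2 × V ≡ 0) ⊎ (T ≡ 0 × V ≡ 2)
      go (inj₁ n≡) = inj₁ (finish T V (plus (T ℕ.* T) (V ℕ.* V) (trans (cong (+ 4 *_) (sym n≡)) eq)))
      go (inj₂ n≡) = let V≡2 , T≡0 = finish V T (minus (T ℕ.* T) (V ℕ.* V) (trans (cong (+ 4 *_) (sym n≡)) eq)) in inj₂ (T≡0 , V≡2)

    negative-trivial : ∀ {α} D → 5 ℕ.≤ D → Δ ≡ - (+ D) → IsUnit α → im α ≡ + 0
    negative-trivial {α} D 5≤D Δ≡ a = ℤP.∣i∣≡0⇒i≡0 (go ∣ im α ∣ (negative-norm D Δ≡ a))
      where
      T = ∣ tr α ∣ ℕ.* ∣ tr α ∣
      go : ∀ U → T ℕ.+ D ℕ.* (U ℕ.* U) ≡ 4 → U ≡ 0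
      go zero _ = refl
      go (suc U) eq = ⊥-elim (ℕP.<⇒≢ (ℕP.≤-trans (ℕP.*-mono-≤ {5} {D} {1} 5≤D (s≤s z≤n)) (ℕP.m≤n+m _ T)) (sym eq))

    square-trivial : ∀ {α} k → 3 ℕ.≤ k → Δ ≡ + k * + k → IsUnit α → im α ≡ + 0
    square-trivial {α} k 3≤k Δ≡ a = ℤP.∣i∣≡0⇒i≡0 (go ∣ im α ∣ (square-norm k Δ≡ a))
      where
      go : ∀ {T} U → (T ≡ 2 × k ℕ.* U ≡ 0) ⊎ (T ≡ 0 × k ℕ.* U ≡ 2) → U ≡ 0
      go zero _ = refl
      go (suc U) cases = ⊥-elim (absurd cases)
        where
        3≤ : 3 ℕ.≤ k ℕ.* suc U
        3≤ = ℕP.*-mono-≤ {3} {k} {1} {suc U} 3≤k (s≤s z≤n)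
        absurd : ∀ {T} → (T ≡ 2 × k ℕ.* suc U ≡ 0) ⊎ (T ≡ 0 × k ℕ.* suc U ≡ 2) → ⊥
        absurd (inj₁ (_ , e)) = ℕP.<⇒≢ (ℕP.≤-trans (s≤s z≤n) 3≤) (sym e)
        absurd (inj₂ (_ , e)) = ℕP.<⇒≢ 3≤ (sym e)

    Spanned : Elt → Elt → Set
    Spanned g h = ∀ {α} → IsUnit α → ∃[ v ] α ≡ word g h v

    spanned-^ : ∀ {g α} r → α ≡ g ^ r → ∃[ v ] α ≡ word g one v
    spanned-^ {g} r eq = (+ r , + 0) , trans eq (sym (∙-one (g ^ r)))

    -- t² + 4u² = 4 has the solutions (±2, 0) and (0, ±1); g plays the part of i.
    module Disc-4 (Δ≡ : Δ ≡ - (+ 4)) {g : Elt} (tu : TU g (+ 0) (+ 1)) where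
      unit : IsUnit g
      unit = TU-unit (+ 1) (inj₁ refl) Δ≡ tu refl

      g¹ : TU (g ^ 1) (+ 0) (+ 1)
      g¹ = TU-∙ {α = g} (+ 0) (+ 1) Δ≡ tu TU-one refl refl
      g² : TU (g ^ 2) (- (+ 2)) (+ 0)
      g² = TU-∙ {α = g} (- (+ 2)) (+ 0) Δ≡ tu g¹ refl refl
      g³ : TU (g ^ 3) (+ 0) (- (+ 1))
      g³ = TU-∙ {α = g} (+ 0) (- (+ 1)) Δ≡ tu g² refl refl
      g⁴ : TU (g ^ 4) (+ 2) (+ 0)
      g⁴ = TU-∙ {α = g} (+ 2) (+ 0) Δ≡ tu g³ refl refl

      spanned : Spanned g one
      spanned {α} a = go ∣ im α ∣ refl (negative-norm 4 Δ≡ a)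
        where
        go : ∀ U → ∣ im α ∣ ≡ U → ∣ tr α ∣ ℕ.* ∣ tr α ∣ ℕ.+ 4 ℕ.* (U ℕ.* U) ≡ 4 → ∃[ v ] α ≡ word g one v
        go 0 u≡ eq with unit-im0 a (ℤP.∣i∣≡0⇒i≡0 u≡)
        ... | inj₁ α≡ = spanned-^ 0 α≡
        ... | inj₂ α≡ = spanned-^ 2 (trans α≡ (TU-unique (TU-neg TU-one) g²))
        go 1 u≡ eq with ℤP.∣i∣≡0⇒i≡0 (square-zero ∣ tr α ∣ (ℕP.+-cancelʳ-≡ 4 _ 0 eq)) | ∣i∣≡n⇒i≡±n (im α) u≡
          where
          square-zero : ∀ t → t ℕ.* t ≡ 0 → t ≡ 0
          square-zero zero _ = refl
        ... | t≡ | inj₁ u≡' = spanned-^ 1 (TU-unique (t≡ , u≡') g¹)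
        ... | t≡ | inj₂ u≡' = spanned-^ 3 (TU-unique (t≡ , u≡') g³)
        go (suc (suc U)) u≡ eq = ⊥-elim (ℕP.<⇒≢ (ℕP.≤-trans (ℕP.≤-trans (ℕP.m≤m+n 5 11)
          (ℕP.*-monoʳ-≤ 4 (ℕP.*-mono-≤ {2} {2 ℕ.+ U} {2} {2 ℕ.+ U} (s≤s (s≤s z≤n)) (s≤s (s≤s z≤n))))) (ℕP.m≤n+m _ (∣ tr α ∣ ℕ.* ∣ tr α ∣))) (sym eq))

      kernel : ∀ v → word g one v ≡ one ⇔ L-ℤ/n 4 v
      kernel = kernel-ℤ/n unit 4 (TU-unique g⁴ TU-one) minimal
        where
        minimal : ∀ r → r ℕ.< 4 → g ^ r ≡ one → r ≡ 0
        minimal 0 _ _ = refl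
        minimal 1 _ eq = ⊥-elim (TU-≢one g¹ (λ ()) eq)
        minimal 2 _ eq = ⊥-elim (TU-≢one g² (λ ()) eq)
        minimal 3 _ eq = ⊥-elim (TU-≢one g³ (λ ()) eq)
        minimal (suc (suc (suc (suc _)))) (s≤s (s≤s (s≤s (s≤s ())))) _

    -- t² + 3u² = 4 has the solutions (±2, 0) and (±1, ±1); g plays the part of a primitive sixth
    -- root of unity.
    module Disc-3 (Δ≡ : Δ ≡ - (+ 3)) {g : Elt} (tu : TU g (+ 1) (+ 1)) where
      unit : IsUnit g
      unit = TU-unit (+ 1) (inj₁ refl) Δ≡ tu refl

      g¹ : TU (g ^ 1) (+ 1) (+ 1)
      g¹ = TU-∙ {α = g} (+ 1) (+ 1) Δ≡ tu TU-one refl refl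
      g² : TU (g ^ 2) (- (+ 1)) (+ 1)
      g² = TU-∙ {α = g} (- (+ 1)) (+ 1) Δ≡ tu g¹ refl refl
      g³ : TU (g ^ 3) (- (+ 2)) (+ 0)
      g³ = TU-∙ {α = g} (- (+ 2)) (+ 0) Δ≡ tu g² refl refl
      g⁴ : TU (g ^ 4) (- (+ 1)) (- (+ 1))
      g⁴ = TU-∙ {α = g} (- (+ 1)) (- (+ 1)) Δ≡ tu g³ refl refl
      g⁵ : TU (g ^ 5) (+ 1) (- (+ 1))
      g⁵ = TU-∙ {α = g} (+ 1) (- (+ 1)) Δ≡ tu g⁴ refl refl
      g⁶ : TU (g ^ 6) (+ 2) (+ 0)
      g⁶ = TU-∙ {α = g} (+ 2) (+ 0) Δ≡ tu g⁵ refl refl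

      spanned : Spanned g one
      spanned {α} a = go ∣ im α ∣ refl (negative-norm 3 Δ≡ a)
        where
        go : ∀ U → ∣ im α ∣ ≡ U → ∣ tr α ∣ ℕ.* ∣ tr α ∣ ℕ.+ 3 ℕ.* (U ℕ.* U) ≡ 4 → ∃[ v ] α ≡ word g one v
        go 0 u≡ eq with unit-im0 a (ℤP.∣i∣≡0⇒i≡0 u≡)
        ... | inj₁ α≡ = spanned-^ 0 α≡
        ... | inj₂ α≡ = spanned-^ 3 (trans α≡ (TU-unique (TU-neg TU-one) g³))
        go 1 u≡ eq with ∣i∣≡n⇒i≡±n (tr α) (n²≡1 ∣ tr α ∣ (ℕP.+-cancelʳ-≡ 3 _ 1 eq)) | ∣i∣≡n⇒i≡±n (im α) u≡
        ... | inj₁ t≡ | inj₁ u≡' = spanned-^ 1 (TU-unique (t≡ , u≡') g¹)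
        ... | inj₂ t≡ | inj₁ u≡' = spanned-^ 2 (TU-unique (t≡ , u≡') g²)
        ... | inj₂ t≡ | inj₂ u≡' = spanned-^ 4 (TU-unique (t≡ , u≡') g⁴)
        ... | inj₁ t≡ | inj₂ u≡' = spanned-^ 5 (TU-unique (t≡ , u≡') g⁵)
        go (suc (suc U)) u≡ eq = ⊥-elim (ℕP.<⇒≢ (ℕP.≤-trans (ℕP.≤-trans (ℕP.m≤m+n 5 7)
          (ℕP.*-monoʳ-≤ 3 (ℕP.*-mono-≤ {2} {2 ℕ.+ U} {2} {2 ℕ.+ U} (s≤s (s≤s z≤n)) (s≤s (s≤s z≤n))))) (ℕP.m≤n+m _ (∣ tr α ∣ ℕ.* ∣ tr α ∣))) (sym eq))

      kernel : ∀ v → word g one v ≡ one ⇔ L-ℤ/n 6 v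
      kernel = kernel-ℤ/n unit 6 (TU-unique g⁶ TU-one) minimal
        where
        minimal : ∀ r → r ℕ.< 6 → g ^ r ≡ one → r ≡ 0
        minimal 0 _ _ = refl
        minimal 1 _ eq = ⊥-elim (TU-≢one g¹ (λ ()) eq)
        minimal 2 _ eq = ⊥-elim (TU-≢one g² (λ ()) eq)
        minimal 3 _ eq = ⊥-elim (TU-≢one g³ (λ ()) eq)
        minimal 4 _ eq = ⊥-elim (TU-≢one g⁴ (λ ()) eq)
        minimal 5 _ eq = ⊥-elim (TU-≢one g⁵ (λ ()) eq)
        minimal (suc (suc (suc (suc (suc (suc _)))))) (s≤s (s≤s (s≤s (s≤s (s≤s (s≤s ())))))) _

    -- For Δ = 0 elements of trace 2 multiply by adding their `im`, so h^j has im j. Every unit has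
    -- trace ±2.
    module Disc-0 (Δ≡ : Δ ≡ + 0) {h : Elt} (tu : TU h (+ 2) (+ 1)) where
      unit : IsUnit h
      unit = TU-unit (+ 1) (inj₁ refl) Δ≡ tu refl

      N≡1 : N h ≡ + 1
      N≡1 = ℤP.*-cancelˡ-≡ (+ 4) (N h) (+ 1) (trans (4N h)
        (trans (cong (λ δ → tr h * tr h - δ * (im h * im h)) Δ≡) (cong₂ (λ t u → t * t - + 0 * (u * u)) (proj₁ tu) (proj₂ tu))))

      TU-inv : TU (inv h) (+ 2) (- (+ 1))
      TU-inv = trans (tr-inv h) (cong₂ _*_ N≡1 (proj₁ tu)) , trans (im-inv h) (cong₂ (λ n u → n * - u) N≡1 (proj₂ tu))

      0*i : ∀ i → + 2 * + 2 + + 0 * i ≡ + 2 * + 2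
      0*i = solve-∀

      TU-^ : ∀ n → TU (h ^ n) (+ 2) (+ n)
      TU-^ zero = TU-one
      TU-^ (suc n) = TU-∙ {α = h} (+ 2) (+ suc n) Δ≡ tu (TU-^ n) (0*i (+ 1 * + n)) (2+1*j (+ n))

      TU-inv^ : ∀ n → TU (inv h ^ n) (+ 2) (- (+ n))
      TU-inv^ zero = TU-one
      TU-inv^ (suc n) = TU-∙ {α = inv h} (+ 2) (- (+ suc n)) Δ≡ TU-inv (TU-inv^ n) (0*i (- (+ 1) * - (+ n))) (2-1*j (+ n))

      TU-pow : ∀ j → TU (pow h j) (+ 2) j
      TU-pow (+ n) = TU-^ n
      TU-pow -[1+ n ] = TU-inv^ (suc n)

      spanned : Spanned (neg one) h
      spanned {α} a with square-norm 0 Δ≡ a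
      ... | inj₂ (_ , ())
      ... | inj₁ (T≡2 , _) with ∣i∣≡n⇒i≡±n (tr α) T≡2
      ...   | inj₁ t≡ = (+ 0 , im α) , trans (TU-unique (t≡ , refl) (TU-pow (im α))) (sym (one-∙ _))
      ...   | inj₂ t≡ = (+ 1 , - im α) , trans
        (TU-unique (t≡ , sym (ℤP.neg-involutive (im α))) (TU-neg (TU-pow (- im α))))
        (sym (trans (cong (_∙ pow h (- im α)) (∙-one (neg one))) (neg-one-∙ _)))

      kernel : ∀ v → word (neg one) h v ≡ one ⇔ L-ℤ/2×ℤ v
      kernel = kernel-ℤ/2×ℤ unit (λ j eq → trans (sym (proj₂ (TU-pow j))) eq)

    -- Serves Δ = 1 and Δ = 4, where the units are ±1 and ±h.
    spanned-involution : ∀ {h} → tr h ≡ + 0 →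
      (∀ {α} → IsUnit α → im α ≡ + 0 ⊎ (tr α ≡ + 0 × (im α ≡ im h ⊎ im α ≡ - im h))) → Spanned (neg one) h
    spanned-involution {h} tr≡0 cases {α} a with cases a
    ... | inj₁ u≡0 = by (unit-im0 a u≡0)
      where
      by : α ≡ one ⊎ α ≡ neg one → ∃[ v ] α ≡ word (neg one) h v
      by (inj₁ α≡) = (+ 0 , + 0) , trans α≡ (sym (one-∙ one))
      by (inj₂ α≡) = (+ 1 , + 0) , trans α≡ (sym (trans (∙-one _) (∙-one _)))
    ... | inj₂ (t≡0 , inj₁ u≡) = (+ 0 , + 1) , trans (TU-unique (t≡0 , u≡) (tr≡0 , refl)) (sym (trans (one-∙ _) (∙-one h)))
    ... | inj₂ (t≡0 , inj₂ u≡) = (+ 1 , + 1) , trans (TU-unique (t≡0 , u≡) (TU-neg {h} (tr≡0 , refl)))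
      (sym (trans (cong₂ _∙_ (∙-one (neg one)) (∙-one h)) (neg-one-∙ h)))

    -- Here Δ is +1, and h is √Δ = 2w - B, which explains im 2.
    module Disc-1 (Δ≡ : Δ ≡ + 1) {h : Elt} (tu : TU h (+ 0) (+ 2)) where
      unit : IsUnit h
      unit = TU-unit (- (+ 1)) (inj₂ refl) Δ≡ tu refl

      spanned : Spanned (neg one) h
      spanned = spanned-involution (proj₁ tu) cases
        where
        cases : ∀ {α} → IsUnit α → im α ≡ + 0 ⊎ (tr α ≡ + 0 × (im α ≡ im h ⊎ im α ≡ - im h))
        cases {α} a with square-norm 1 Δ≡ a
        ... | inj₁ (_ , e) = inj₁ (ℤP.∣i∣≡0⇒i≡0 (trans (sym (ℕP.*-identityˡ _)) e))
        ... | inj₂ (t , e) with ∣i∣≡n⇒i≡±n (im α) (trans (sym (ℕP.*-identityˡ _)) e)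
        ...   | inj₁ u≡ = inj₂ (ℤP.∣i∣≡0⇒i≡0 t , inj₁ (trans u≡ (sym (proj₂ tu))))
        ...   | inj₂ u≡ = inj₂ (ℤP.∣i∣≡0⇒i≡0 t , inj₂ (trans u≡ (cong -_ (sym (proj₂ tu)))))

      kernel : ∀ v → word (neg one) h v ≡ one ⇔ L-ℤ/2×ℤ/2 v
      kernel = kernel-ℤ/2×ℤ/2 unit
        (TU-unique (TU-∙ {α = h} (+ 2) (+ 0) Δ≡ tu (TU-∙ {α = h} (+ 0) (+ 2) Δ≡ tu TU-one refl refl) refl refl) TU-one)
        (λ eq → absurd (trans (sym (proj₂ tu)) eq))
        where
        absurd : ¬ + 2 ≡ + 0
        absurd ()

    module Disc+4 (Δ≡ : Δ ≡ + 4) {h : Elt} (tu : TU h (+ 0) (+ 1)) where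
      unit : IsUnit h
      unit = TU-unit (- (+ 1)) (inj₂ refl) Δ≡ tu refl

      spanned : Spanned (neg one) h
      spanned = spanned-involution (proj₁ tu) cases
        where
        cases : ∀ {α} → IsUnit α → im α ≡ + 0 ⊎ (tr α ≡ + 0 × (im α ≡ im h ⊎ im α ≡ - im h))
        cases {α} a with square-norm 2 Δ≡ a
        ... | inj₁ (_ , e) = inj₁ (ℤP.∣i∣≡0⇒i≡0 (ℕP.*-cancelˡ-≡ ∣ im α ∣ 0 2 e))
        ... | inj₂ (t , e) with ∣i∣≡n⇒i≡±n (im α) (ℕP.*-cancelˡ-≡ ∣ im α ∣ 1 2 e)
        ...   | inj₁ u≡ = inj₂ (ℤP.∣i∣≡0⇒i≡0 t , inj₁ (trans u≡ (sym (proj₂ tu))))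
        ...   | inj₂ u≡ = inj₂ (ℤP.∣i∣≡0⇒i≡0 t , inj₂ (trans u≡ (cong -_ (sym (proj₂ tu)))))

      kernel : ∀ v → word (neg one) h v ≡ one ⇔ L-ℤ/2×ℤ/2 v
      kernel = kernel-ℤ/2×ℤ/2 unit
        (TU-unique (TU-∙ {α = h} (+ 2) (+ 0) Δ≡ tu (TU-∙ {α = h} (+ 0) (+ 1) Δ≡ tu TU-one refl refl) refl refl) TU-one)
        (λ eq → absurd (trans (sym (proj₂ tu)) eq))
        where
        absurd : ¬ + 1 ≡ + 0
        absurd ()

module Stabilisers where

  open import Data.Rational using (_+_; _*_; _-_; -_)
  open Units

  -- Integers inside ℚ, and Bézout relations.

  ℚ-ring : AlmostCommutativeRing _ _
  ℚ-ring = fromCommutativeRing ℚP.+-*-commutativeRing λ x → dec⇒maybe (0ℚ ℚP.≟ x)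

  fromℚᵘ-* : ∀ p q → ℚ.fromℚᵘ p * ℚ.fromℚᵘ q ≡ ℚ.fromℚᵘ (p ℚᵘ.* q)
  fromℚᵘ-* p q = ℚP.toℚᵘ-injective (ℚᵘP.≃-trans (ℚP.toℚᵘ-homo-* (ℚ.fromℚᵘ p) (ℚ.fromℚᵘ q))
    (ℚᵘP.≃-trans (ℚᵘP.*-cong (ℚP.toℚᵘ-fromℚᵘ p) (ℚP.toℚᵘ-fromℚᵘ q)) (ℚᵘP.≃-sym (ℚP.toℚᵘ-fromℚᵘ (p ℚᵘ.* q)))))

  fromℚᵘ-+ : ∀ p q → ℚ.fromℚᵘ p + ℚ.fromℚᵘ q ≡ ℚ.fromℚᵘ (p ℚᵘ.+ q)
  fromℚᵘ-+ p q = ℚP.toℚᵘ-injective (ℚᵘP.≃-trans (ℚP.toℚᵘ-homo-+ (ℚ.fromℚᵘ p) (ℚ.fromℚᵘ q))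
    (ℚᵘP.≃-trans (ℚᵘP.+-cong (ℚP.toℚᵘ-fromℚᵘ p) (ℚP.toℚᵘ-fromℚᵘ q)) (ℚᵘP.≃-sym (ℚP.toℚᵘ-fromℚᵘ (p ℚᵘ.+ q)))))

  ι : ℤ → ℚ
  ι i = i / 1

  ι-* : ∀ i j → ι (i ℤ.* j) ≡ ι i * ι j
  ι-* i j = sym (fromℚᵘ-* (mkℚᵘ i 0) (mkℚᵘ j 0))

  ι-+ : ∀ i j → ι (i ℤ.+ j) ≡ ι i + ι j
  ι-+ i j = trans (cong ι (sym (cong₂ ℤ._+_ (ℤP.*-identityʳ i) (ℤP.*-identityʳ j)))) (sym (fromℚᵘ-+ (mkℚᵘ i 0) (mkℚᵘ j 0)))

  -1* : ∀ x → - 1ℚ * x ≡ - x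
  -1* = solve-∀-in ℚ-ring

  ι-neg : ∀ i → ι (ℤ.- i) ≡ - ι i
  ι-neg i = trans (cong ι (sym (ℤP.-1*i≡-i i))) (trans (ι-* (ℤ.- (+ 1)) i) (-1* (ι i)))

  ι-- : ∀ i j → ι (i ℤ.- j) ≡ ι i - ι j
  ι-- i j = trans (ι-+ i (ℤ.- j)) (cong (λ z → ι i + z) (ι-neg j))

  ι-injective : ∀ {i j} → ι i ≡ ι j → i ≡ j
  ι-injective {i} {j} eq with ℚP.fromℚᵘ-injective {mkℚᵘ i 0} {mkℚᵘ j 0} eq
  ... | *≡* e = trans (sym (ℤP.*-identityʳ i)) (trans e (ℤP.*-identityʳ j))

  /2≡½* : ∀ i → i / 2 ≡ ½ * ι i
  /2≡½* i = trans (cong (_/ 2) (sym (ℤP.*-identityˡ i))) (sym (fromℚᵘ-* (mkℚᵘ (+ 1) 1) (mkℚᵘ i 0)))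

  ½+½ : ∀ x → ½ * x + ½ * x ≡ x
  ½+½ = solve-∀-in ℚ-ring

  /2+/2 : ∀ i → i / 2 + i / 2 ≡ ι i
  /2+/2 i = trans (cong₂ _+_ (/2≡½* i) (/2≡½* i)) (½+½ (ι i))

  -- The factor 2/f in `χ` cancels the f/2 in 𝒪_f, so SQ receives an integer coefficient.
  2/f*nf/2 : ∀ n f .{{_ : ℕ.NonZero f}} → ((+ 2) / f) * ((n ℤ.* + f) / 2) ≡ ι n
  2/f*nf/2 n (suc d) = trans (fromℚᵘ-* (mkℚᵘ (+ 2) d) (mkℚᵘ (n ℤ.* + suc d) 1)) (ℚP.fromℚᵘ-cong {mkℚᵘ (+ 2) d ℚᵘ.* mkℚᵘ (n ℤ.* + suc d) 1} {mkℚᵘ n 0} (*≡*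
    (trans (e n (+ suc d)) (cong (n ℤ.*_) (sym (ℤP.pos-* (suc d) 2))))))
    where
    e : ∀ n f → (+ 2 ℤ.* (n ℤ.* f)) ℤ.* + 1 ≡ n ℤ.* (f ℤ.* + 2)
    e = solve-∀

  bézout : ∀ m n → ∃[ d ] (d ℕD.∣ m × d ℕD.∣ n × ∃[ x ] ∃[ y ] + m ℤ.* x ℤ.+ + n ℤ.* y ≡ + d)
  bézout m n with Bézout.lemma m n
  ... | Bézout.result d g (Bézout.+- x y eq) = d , GCD.gcd∣m g , GCD.gcd∣n g , + x , ℤ.- (+ y) , solution
    where
    e : ∀ m n x y → m ℤ.* x ℤ.+ n ℤ.* ℤ.- y ≡ x ℤ.* m ℤ.- y ℤ.* n
    e = solve-∀
    f : ∀ d z → (d ℤ.+ z) ℤ.- z ≡ d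
    f = solve-∀
    solution : + m ℤ.* + x ℤ.+ + n ℤ.* ℤ.- (+ y) ≡ + d
    solution = trans (e (+ m) (+ n) (+ x) (+ y)) (trans
      (cong₂ ℤ._-_ (trans (sym (ℤP.pos-* x m)) (cong +_ (sym eq))) (sym (ℤP.pos-* y n))) (f (+ d) (+ (y ℕ.* n))))
  ... | Bézout.result d g (Bézout.-+ x y eq) = d , GCD.gcd∣m g , GCD.gcd∣n g , ℤ.- (+ x) , + y , solution
    where
    e : ∀ m n x y → m ℤ.* ℤ.- x ℤ.+ n ℤ.* y ≡ y ℤ.* n ℤ.- x ℤ.* m
    e = solve-∀
    f : ∀ d z → (d ℤ.+ z) ℤ.- z ≡ d
    f = solve-∀
    solution : + m ℤ.* ℤ.- (+ x) ℤ.+ + n ℤ.* + y ≡ + d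
    solution = trans (e (+ m) (+ n) (+ x) (+ y)) (trans
      (cong₂ ℤ._-_ (trans (sym (ℤP.pos-* y n)) (cong +_ (sym eq))) (sym (ℤP.pos-* x m))) (f (+ d) (+ (x ℕ.* m))))

  abs-multiple : ∀ i → ∃[ σ ] + ∣ i ∣ ≡ i ℤ.* σ
  abs-multiple (+ n) = + 1 , sym (ℤP.*-identityʳ (+ n))
  abs-multiple -[1+ n ] = ℤ.- (+ 1) , e (+ suc n)
    where
    e : ∀ n → n ≡ (ℤ.- n) ℤ.* ℤ.- (+ 1)
    e = solve-∀

  -- Two Bézout relations are nested; σ, τ and υ are the signs that undo the absolute values.
  primitive-bézout : ∀ Q → Primitive Q → ∃[ x ] ∃[ y ] ∃[ z ] a Q ℤ.* x ℤ.+ b Q ℤ.* y ℤ.+ c Q ℤ.* z ≡ + 1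
  primitive-bézout (form a b c) prim =
    let d₁ , d₁∣a , d₁∣b , x , y , e₁ = bézout ∣ a ∣ ∣ b ∣
        d , d∣d₁ , d∣c , z , w , e₂ = bézout d₁ ∣ c ∣
        d≡1 = ℕD.∣1⇒≡1 (prim (+ d) (ℕD.∣-trans d∣d₁ d₁∣a) (ℕD.∣-trans d∣d₁ d₁∣b) d∣c)
        σ , a≡ = abs-multiple a
        τ , b≡ = abs-multiple b
        υ , c≡ = abs-multiple c
    in σ ℤ.* x ℤ.* z , τ ℤ.* y ℤ.* z , υ ℤ.* w , trans (e a b c σ τ υ x y z w)
         (trans (cong₂ (λ α β → (α ℤ.* x ℤ.+ β ℤ.* y) ℤ.* z ℤ.+ c ℤ.* υ ℤ.* w) (sym a≡) (sym b≡))
         (trans (cong₂ (λ δ γ → δ ℤ.* z ℤ.+ γ ℤ.* w) e₁ (sym c≡)) (trans e₂ (cong +_ d≡1))))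
    where
    e : ∀ a b c σ τ υ x y z w → a ℤ.* (σ ℤ.* x ℤ.* z) ℤ.+ b ℤ.* (τ ℤ.* y ℤ.* z) ℤ.+ c ℤ.* (υ ℤ.* w) ≡
      (a ℤ.* σ ℤ.* x ℤ.+ b ℤ.* τ ℤ.* y) ℤ.* z ℤ.+ c ℤ.* υ ℤ.* w
    e = solve-∀

  -- The stabiliser as the unit group of ℤ[w].

  mat-≡ : ∀ {p p' q q' r r' s s'} → p ≡ p' → q ≡ q' → r ≡ r' → s ≡ s' → mat p q r s ≡ mat p' q' r' s'
  mat-≡ refl refl refl refl = refl

  ι-dot : ∀ p q r s → ι (p ℤ.* q ℤ.+ r ℤ.* s) ≡ ι p * ι q + ι r * ι s
  ι-dot p q r s = trans (ι-+ (p ℤ.* q) (r ℤ.* s)) (cong₂ _+_ (ι-* p q) (ι-* r s))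

  ι-det : ∀ p q r s → ι (p ℤ.* s ℤ.- q ℤ.* r) ≡ ι p * ι s - ι q * ι r
  ι-det p q r s = trans (ι-- (p ℤ.* s) (q ℤ.* r)) (cong₂ _-_ (ι-* p s) (ι-* q r))

  μ-11 : ∀ a c x u y v → x ℤ.* y ℤ.- (a ℤ.* c) ℤ.* u ℤ.* v ≡ x ℤ.* y ℤ.+ (ℤ.- (c ℤ.* u)) ℤ.* (a ℤ.* v)
  μ-11 = solve-∀

  μ-12 : ∀ b c x u y v → ℤ.- (c ℤ.* (x ℤ.* v ℤ.+ u ℤ.* y ℤ.+ b ℤ.* u ℤ.* v)) ≡
    x ℤ.* (ℤ.- (c ℤ.* v)) ℤ.+ (ℤ.- (c ℤ.* u)) ℤ.* (y ℤ.+ b ℤ.* v)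
  μ-12 = solve-∀

  μ-21 : ∀ a b x u y v → a ℤ.* (x ℤ.* v ℤ.+ u ℤ.* y ℤ.+ b ℤ.* u ℤ.* v) ≡
    (a ℤ.* u) ℤ.* y ℤ.+ (x ℤ.+ b ℤ.* u) ℤ.* (a ℤ.* v)
  μ-21 = solve-∀

  μ-22 : ∀ a b c x u y v →
    (x ℤ.* y ℤ.- (a ℤ.* c) ℤ.* u ℤ.* v) ℤ.+ b ℤ.* (x ℤ.* v ℤ.+ u ℤ.* y ℤ.+ b ℤ.* u ℤ.* v) ≡
    (a ℤ.* u) ℤ.* (ℤ.- (c ℤ.* v)) ℤ.+ (x ℤ.+ b ℤ.* u) ℤ.* (y ℤ.+ b ℤ.* v)
  μ-22 = solve-∀

  det-identity : ∀ a b c x u → x ℤ.* x ℤ.+ b ℤ.* x ℤ.* u ℤ.+ (a ℤ.* c) ℤ.* u ℤ.* u ≡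
    x ℤ.* (x ℤ.+ b ℤ.* u) ℤ.- (ℤ.- (c ℤ.* u)) ℤ.* (a ℤ.* u)
  det-identity = solve-∀

  det-product : ∀ p q r s p' q' r' s' → (p * s - q * r) * (p' * s' - q' * r') ≡
    (p * p' + q * r') * (r * q' + s * s') - (p * q' + q * s') * (r * p' + s * r')
  det-product = solve-∀-in ℚ-ring

  -- With e = ps − qr these are the entries of Mᵀ Q = Q adj(M), obtained from e Mᵀ Q M = Q and e² = 1.
  adj-row₁ : ∀ p q r s A H C → (p * s - q * r) * ((p * A + r * H) * p + (p * H + r * C) * r) * s
    - (p * s - q * r) * ((p * A + r * H) * q + (p * H + r * C) * s) * r ≡
    (p * s - q * r) * (p * s - q * r) * (p * A + r * H)
  adj-row₁ = solve-∀-in ℚ-ring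

  adj-row₂ : ∀ p q r s A H C → (p * s - q * r) * ((p * A + r * H) * q + (p * H + r * C) * s) * p
    - (p * s - q * r) * ((p * A + r * H) * p + (p * H + r * C) * r) * q ≡
    (p * s - q * r) * (p * s - q * r) * (p * H + r * C)
  adj-row₂ = solve-∀-in ℚ-ring

  adj-row₃ : ∀ p q r s A H C → (p * s - q * r) * ((q * A + s * H) * q + (q * H + s * C) * s) * p
    - (p * s - q * r) * ((q * A + s * H) * p + (q * H + s * C) * r) * q ≡
    (p * s - q * r) * (p * s - q * r) * (q * H + s * C)
  adj-row₃ = solve-∀-in ℚ-ring

  -- A, H, C stand for a, b/2, c. Comparing entries in MᵀQ = Q adj(M) gives the vanishing of the 2×2
  -- minors of (a, b, c) and (r, s - p, -q).
  module Commuting (p q r s A H C : ℚ) (e²≡1 : (p * s - q * r) * (p * s - q * r) ≡ 1ℚ)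
    (E₁₁ : (p * s - q * r) * ((p * A + r * H) * p + (p * H + r * C) * r) ≡ A)
    (E₁₂ : (p * s - q * r) * ((p * A + r * H) * q + (p * H + r * C) * s) ≡ H)
    (E₂₁ : (p * s - q * r) * ((q * A + s * H) * p + (q * H + s * C) * r) ≡ H)
    (E₂₂ : (p * s - q * r) * ((q * A + s * H) * q + (q * H + s * C) * s) ≡ C) where

    private
      drop-e² : ∀ {x} → (p * s - q * r) * (p * s - q * r) * x ≡ x
      drop-e² {x} = trans (cong (_* x) e²≡1) (ℚP.*-identityˡ x)

      row₁ : A * s - H * r ≡ p * A + r * H
      row₁ = trans (cong₂ (λ y z → y * s - z * r) (sym E₁₁) (sym E₁₂)) (trans (adj-row₁ p q r s A H C) drop-e²)

      row₂ : H * p - A * q ≡ p * H + r * C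
      row₂ = trans (cong₂ (λ y z → y * p - z * q) (sym E₁₂) (sym E₁₁)) (trans (adj-row₂ p q r s A H C) drop-e²)

      row₃ : C * p - H * q ≡ q * H + s * C
      row₃ = trans (cong₂ (λ y z → y * p - z * q) (sym E₂₂) (sym E₂₁)) (trans (adj-row₃ p q r s A H C) drop-e²)

    commute₁ : A * (s - p) ≡ (H + H) * r
    commute₁ = trans (f A H p r s) (trans (cong (λ y → y - p * A + H * r) row₁) (g A H p r))
      where
      f : ∀ A H p r s → A * (s - p) ≡ (A * s - H * r) - p * A + H * r
      f = solve-∀-in ℚ-ring
      g : ∀ A H p r → (p * A + r * H) - p * A + H * r ≡ (H + H) * r
      g = solve-∀-in ℚ-ring

    commute₂ : A * - q ≡ C * r
    commute₂ = trans (f A H p q) (trans (cong (λ y → y - H * p) row₂) (g C H p r))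
      where
      f : ∀ A H p q → A * - q ≡ (H * p - A * q) - H * p
      f = solve-∀-in ℚ-ring
      g : ∀ C H p r → (p * H + r * C) - H * p ≡ C * r
      g = solve-∀-in ℚ-ring

    commute₃ : C * (s - p) ≡ (H + H) * - q
    commute₃ = trans (f C H p q s) (trans (cong (λ y → y - C * p - H * q) (sym row₃)) (g C H p q))
      where
      f : ∀ C H p q s → C * (s - p) ≡ (q * H + s * C) - C * p - H * q
      f = solve-∀-in ℚ-ring
      g : ∀ C H p q → (C * p - H * q) - C * p - H * q ≡ (H + H) * - q
      g = solve-∀-in ℚ-ring

  -- For the converse: every M = X I + U w satisfies MᵀQM = det(M) Q identically. The four entries
  -- are stated after multiplication by det M.
  stab-11 : ∀ X U A H C → let p = X; q = - (C * U); r = A * U; s = X + (H + H) * U in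
    (p * s - q * r) * ((p * A + r * H) * p + (p * H + r * C) * r) ≡ (p * s - q * r) * (p * s - q * r) * A
  stab-11 = solve-∀-in ℚ-ring

  stab-12 : ∀ X U A H C → let p = X; q = - (C * U); r = A * U; s = X + (H + H) * U in
    (p * s - q * r) * ((p * A + r * H) * q + (p * H + r * C) * s) ≡ (p * s - q * r) * (p * s - q * r) * H
  stab-12 = solve-∀-in ℚ-ring

  stab-21 : ∀ X U A H C → let p = X; q = - (C * U); r = A * U; s = X + (H + H) * U in
    (p * s - q * r) * ((q * A + s * H) * p + (q * H + s * C) * r) ≡ (p * s - q * r) * (p * s - q * r) * H
  stab-21 = solve-∀-in ℚ-ring

  stab-22 : ∀ X U A H C → let p = X; q = - (C * U); r = A * U; s = X + (H + H) * U in
    (p * s - q * r) * ((q * A + s * H) * q + (q * H + s * C) * s) ≡ (p * s - q * r) * (p * s - q * r) * C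
  stab-22 = solve-∀-in ℚ-ring

  parametrised-stab : ∀ X U A H C → let M = mat X (- (C * U)) (A * U) (X + (H + H) * U); T = mat A H H C in
    det M * det M ≡ 1ℚ → det M ⊛ (transpose M · T · M) ≡ T
  parametrised-stab X U A H C e²≡1 = mat-≡
    (trans (stab-11 X U A H C) drop) (trans (stab-12 X U A H C) drop)
    (trans (stab-21 X U A H C) drop) (trans (stab-22 X U A H C) drop)
    where
    M = mat X (- (C * U)) (A * U) (X + (H + H) * U)
    drop : ∀ {x} → det M * det M * x ≡ x
    drop {x} = trans (cong (_* x) e²≡1) (ℚP.*-identityˡ x)

  bézout-factor : ∀ a b c x y z r s q → a ℤ.* x ℤ.+ b ℤ.* y ℤ.+ c ℤ.* z ≡ + 1 →
    a ℤ.* s ≡ b ℤ.* r → a ℤ.* q ≡ c ℤ.* r → a ℤ.* (r ℤ.* x ℤ.+ s ℤ.* y ℤ.+ q ℤ.* z) ≡ r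
  bézout-factor a b c x y z r s q e f g = begin
    a ℤ.* (r ℤ.* x ℤ.+ s ℤ.* y ℤ.+ q ℤ.* z)                              ≡⟨ p a x y z r s q ⟩
    a ℤ.* x ℤ.* r ℤ.+ (a ℤ.* s) ℤ.* y ℤ.+ (a ℤ.* q) ℤ.* z                ≡⟨ cong₂ (λ i j → a ℤ.* x ℤ.* r ℤ.+ i ℤ.* y ℤ.+ j ℤ.* z) f g ⟩
    a ℤ.* x ℤ.* r ℤ.+ (b ℤ.* r) ℤ.* y ℤ.+ (c ℤ.* r) ℤ.* z                ≡⟨ o a b c x y z r ⟩
    (a ℤ.* x ℤ.+ b ℤ.* y ℤ.+ c ℤ.* z) ℤ.* r                              ≡⟨ cong (ℤ._* r) e ⟩
    + 1 ℤ.* r                                                            ≡⟨ ℤP.*-identityˡ r ⟩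
    r ∎
    where
    open ≡-Reasoning
    p : ∀ a x y z r s q → a ℤ.* (r ℤ.* x ℤ.+ s ℤ.* y ℤ.+ q ℤ.* z) ≡ a ℤ.* x ℤ.* r ℤ.+ (a ℤ.* s) ℤ.* y ℤ.+ (a ℤ.* q) ℤ.* z
    p = solve-∀
    o : ∀ a b c x y z r → a ℤ.* x ℤ.* r ℤ.+ (b ℤ.* r) ℤ.* y ℤ.+ (c ℤ.* r) ℤ.* z ≡ (a ℤ.* x ℤ.+ b ℤ.* y ℤ.+ c ℤ.* z) ℤ.* r
    o = solve-∀

  -- With ax + by + cz = 1 the multiplier must be u = rx + sy + qz, and the vanishing minors turn a
  -- u into (ax + by + cz) r; the other coordinates follow by symmetry.
  proportional : ∀ Q → Primitive Q → ∀ r s q → a Q ℤ.* s ≡ b Q ℤ.* r → a Q ℤ.* q ≡ c Q ℤ.* r → c Q ℤ.* s ≡ b Q ℤ.* q →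
    ∃[ u ] (a Q ℤ.* u ≡ r × b Q ℤ.* u ≡ s × c Q ℤ.* u ≡ q)
  proportional Q@(form a b c) prim r s q as≡br aq≡cr cs≡bq =
    let x , y , z , e = primitive-bézout Q prim
    in r ℤ.* x ℤ.+ s ℤ.* y ℤ.+ q ℤ.* z ,
       bézout-factor a b c x y z r s q e as≡br aq≡cr ,
       trans (cong (b ℤ.*_) (perm₁ r s q x y z)) (bézout-factor b a c y x z s r q (trans (perm₁ b a c y x z) e) (sym as≡br) (sym cs≡bq)) ,
       trans (cong (c ℤ.*_) (perm₂ r s q x y z)) (bézout-factor c b a z y x q s r (trans (perm₂ c b a z y x) e) cs≡bq (sym aq≡cr))
    where
    perm₁ : ∀ r s q x y z → r ℤ.* x ℤ.+ s ℤ.* y ℤ.+ q ℤ.* z ≡ s ℤ.* y ℤ.+ r ℤ.* x ℤ.+ q ℤ.* z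
    perm₁ = solve-∀
    perm₂ : ∀ r s q x y z → r ℤ.* x ℤ.+ s ℤ.* y ℤ.+ q ℤ.* z ≡ q ℤ.* z ℤ.+ s ℤ.* y ℤ.+ r ℤ.* x
    perm₂ = solve-∀

  inverse-det : ∀ p q r s p' q' r' s' → mat (ι p) (ι q) (ι r) (ι s) · mat (ι p') (ι q') (ι r') (ι s') ≡ I →
    (p ℤ.* s ℤ.- q ℤ.* r) ℤ.* (p' ℤ.* s' ℤ.- q' ℤ.* r') ≡ + 1
  inverse-det p q r s p' q' r' s' eq = ι-injective (begin
    ι ((p ℤ.* s ℤ.- q ℤ.* r) ℤ.* (p' ℤ.* s' ℤ.- q' ℤ.* r'))           ≡⟨ ι-* (p ℤ.* s ℤ.- q ℤ.* r) (p' ℤ.* s' ℤ.- q' ℤ.* r') ⟩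
    ι (p ℤ.* s ℤ.- q ℤ.* r) * ι (p' ℤ.* s' ℤ.- q' ℤ.* r')             ≡⟨ cong₂ _*_ (ι-det p q r s) (ι-det p' q' r' s') ⟩
    (ι p * ι s - ι q * ι r) * (ι p' * ι s' - ι q' * ι r')             ≡⟨ det-product (ι p) (ι q) (ι r) (ι s) (ι p') (ι q') (ι r') (ι s') ⟩
    det (mat (ι p) (ι q) (ι r) (ι s) · mat (ι p') (ι q') (ι r') (ι s')) ≡⟨ cong det eq ⟩
    1ℚ ∎)
    where open ≡-Reasoning

  module Stabiliser (Q : Form) (prim : Primitive Q) where
    open Order (b Q) (a Q ℤ.* c Q) public
    open Order-Properties (b Q) (a Q ℤ.* c Q) public

    -- The matrix of x I + u w, since w = (b/2) I + SQ has the integral rows (0, -c) and (a, b).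
    μ : Elt → Mat
    μ (elt x u) = mat (ι x) (ι (ℤ.- (c Q ℤ.* u))) (ι (a Q ℤ.* u)) (ι (x ℤ.+ b Q ℤ.* u))

    μ-∙ : ∀ α β → μ (α ∙ β) ≡ μ α · μ β
    μ-∙ (elt x u) (elt y v) = trans (cong μ (∙-def x u y v)) (mat-≡
      (trans (cong ι (μ-11 (a Q) (c Q) x u y v)) (ι-dot x y (ℤ.- (c Q ℤ.* u)) (a Q ℤ.* v)))
      (trans (cong ι (μ-12 (b Q) (c Q) x u y v)) (ι-dot x (ℤ.- (c Q ℤ.* v)) (ℤ.- (c Q ℤ.* u)) (y ℤ.+ b Q ℤ.* v)))
      (trans (cong ι (μ-21 (a Q) (b Q) x u y v)) (ι-dot (a Q ℤ.* u) y (x ℤ.+ b Q ℤ.* u) (a Q ℤ.* v)))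
      (trans (cong ι (μ-22 (a Q) (b Q) (c Q) x u y v)) (ι-dot (a Q ℤ.* u) (ℤ.- (c Q ℤ.* v)) (x ℤ.+ b Q ℤ.* u) (y ℤ.+ b Q ℤ.* v))))

    μ-one : μ one ≡ I
    μ-one = mat-≡ refl (cong ι (e (c Q))) (cong ι (ℤP.*-zeroʳ (a Q))) (cong ι (f (b Q)))
      where
      e : ∀ c → ℤ.- (c ℤ.* + 0) ≡ + 0
      e = solve-∀
      f : ∀ b → + 1 ℤ.+ b ℤ.* + 0 ≡ + 1
      f = solve-∀

    μ-neg-one : μ (neg one) ≡ -I
    μ-neg-one = trans (cong μ (neg-def (+ 1) (+ 0)))
      (mat-≡ refl (cong ι (e (c Q))) (cong ι (ℤP.*-zeroʳ (a Q))) (cong ι (f (b Q))))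
      where
      e : ∀ c → ℤ.- (c ℤ.* + 0) ≡ + 0
      e = solve-∀
      f : ∀ b → ℤ.- (+ 1) ℤ.+ b ℤ.* + 0 ≡ ℤ.- (+ 1)
      f = solve-∀

    -- The entries determine a u, b u and c u, and a Bézout relation recovers u from them.
    μ-injective : ∀ {α β} → μ α ≡ μ β → α ≡ β
    μ-injective {elt x u} {elt y v} eq = cong₂ elt x≡y u≡v
      where
      x≡y : x ≡ y
      x≡y = ι-injective (cong m11 eq)
      cu≡cv : c Q ℤ.* u ≡ c Q ℤ.* v
      cu≡cv = ℤP.neg-injective (ι-injective (cong m12 eq))
      au≡av : a Q ℤ.* u ≡ a Q ℤ.* v
      au≡av = ι-injective (cong m21 eq)
      bu≡bv : b Q ℤ.* u ≡ b Q ℤ.* v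
      bu≡bv = +-cancelˡ x _ _ (trans (ι-injective (cong m22 eq)) (cong (ℤ._+ b Q ℤ.* v) (sym x≡y)))
      expand : ∀ a b c x y z u → (a ℤ.* x ℤ.+ b ℤ.* y ℤ.+ c ℤ.* z) ℤ.* u ≡ (a ℤ.* u) ℤ.* x ℤ.+ (b ℤ.* u) ℤ.* y ℤ.+ (c ℤ.* u) ℤ.* z
      expand = solve-∀
      u≡v : u ≡ v
      u≡v = let x' , y' , z' , e = primitive-bézout Q prim in
        trans (sym (ℤP.*-identityˡ u)) (trans (cong (ℤ._* u) (sym e)) (trans (expand (a Q) (b Q) (c Q) x' y' z' u)
        (trans (cong₂ ℤ._+_ (cong₂ ℤ._+_ (cong (ℤ._* x') au≡av) (cong (ℤ._* y') bu≡bv)) (cong (ℤ._* z') cu≡cv))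
        (trans (sym (expand (a Q) (b Q) (c Q) x' y' z' v)) (trans (cong (ℤ._* v) e) (ℤP.*-identityˡ v))))))

    det-μ : ∀ α → det (μ α) ≡ ι (N α)
    det-μ (elt x u) = trans (sym (ι-det x (ℤ.- (c Q ℤ.* u)) (a Q ℤ.* u) (x ℤ.+ b Q ℤ.* u)))
      (cong ι (sym (trans (N-def x u) (det-identity (a Q) (b Q) (c Q) x u))))

    μ-parametrised : ∀ x u → μ (elt x u) ≡
      mat (ι x) (- (ι (c Q) * ι u)) (ι (a Q) * ι u) (ι x + (b Q / 2 + b Q / 2) * ι u)
    μ-parametrised x u = mat-≡ refl (trans (ι-neg (c Q ℤ.* u)) (cong -_ (ι-* (c Q) u))) (ι-* (a Q) u)
      (trans (ι-+ x (b Q ℤ.* u)) (cong (λ y → ι x + y) (trans (ι-* (b Q) u) (cong (_* ι u) (sym (/2+/2 (b Q)))))))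

    unit⇒stab : ∀ {α} → IsUnit α → Stab Q (μ α)
    unit⇒stab {α@(elt x u)} unit = (int α , μ (inv α) , int (inv α) ,
        trans (sym (μ-∙ α (inv α))) (trans (cong μ (∙-inv unit)) μ-one) ,
        trans (sym (μ-∙ (inv α) α)) (trans (cong μ (inv-∙ unit)) μ-one)) ,
      subst (λ M → det M ⊛ (transpose M · toMat Q · M) ≡ toMat Q) (sym (μ-parametrised x u))
        (parametrised-stab (ι x) (ι u) (ι (a Q)) (b Q / 2) (ι (c Q)) 
          (subst (λ M → det M * det M ≡ 1ℚ) (μ-parametrised x u)
            (trans (cong₂ _*_ (det-μ α) (det-μ α)) (trans (sym (ι-* (N α) (N α))) (cong ι (±1-square (norm-±1 unit)))))))
      where
      int : ∀ α → IntMat (μ α)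
      int (elt x u) = (x , refl) , (ℤ.- (c Q ℤ.* u) , refl) , (a Q ℤ.* u , refl) , (x ℤ.+ b Q ℤ.* u , refl)

    -- Invertibility over ℤ gives det M = ±1. This is used twice: as e² = 1 for the commutation
    -- relations and as the norm of the resulting element.
    stab⇒unit : ∀ {M} → Stab Q M → ∃[ α ] (IsUnit α × M ≡ μ α)
    stab⇒unit {mat _ _ _ _} ((((p , refl) , (q , refl) , (r , refl) , (s , refl)) ,
      mat _ _ _ _ , ((p' , refl) , (q' , refl) , (r' , refl) , (s' , refl)) , MN≡I , _) , stable) =
      let u , au≡r , bu≡s-p , cu≡-q = proportional Q prim r (s ℤ.- p) (ℤ.- q)
            (ι-injective (trans (ι-* (a Q) (s ℤ.- p)) (trans (cong (ι (a Q) *_) (ι-- s p))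
              (trans commute₁ (trans (cong (_* ι r) (/2+/2 (b Q))) (sym (ι-* (b Q) r)))))))
            (ι-injective (trans (ι-* (a Q) (ℤ.- q)) (trans (cong (ι (a Q) *_) (ι-neg q))
              (trans commute₂ (sym (ι-* (c Q) r))))))
            (ι-injective (trans (ι-* (c Q) (s ℤ.- p)) (trans (cong (ι (c Q) *_) (ι-- s p))
              (trans commute₃ (trans (cong₂ _*_ (/2+/2 (b Q)) (sym (ι-neg q))) (sym (ι-* (b Q) (ℤ.- q))))))))
          q≡ = trans (sym (ℤP.neg-involutive q)) (cong ℤ.-_ (sym cu≡-q))
          s≡ = trans (e s p) (cong (λ z → p ℤ.+ z) (sym bu≡s-p))
      in elt p u ,
         is-unit (subst ±1 (sym (trans (N-def p u) (trans (det-identity (a Q) (b Q) (c Q) p u)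
           (cong₂ ℤ._-_ (cong (p ℤ.*_) (sym s≡)) (cong₂ ℤ._*_ (sym q≡) au≡r))))) n-unit) ,
         mat-≡ refl (cong ι q≡) (cong ι (sym au≡r)) (cong ι s≡)
      where
      e : ∀ s p → s ≡ p ℤ.+ (s ℤ.- p)
      e = solve-∀
      n = p ℤ.* s ℤ.- q ℤ.* r
      n-unit : ±1 n
      n-unit = m*n≡1⇒±1 n _ (inverse-det p q r s p' q' r' s' MN≡I)
      open Commuting (ι p) (ι q) (ι r) (ι s) (ι (a Q)) (b Q / 2) (ι (c Q))
        (trans (cong₂ _*_ (sym (ι-det p q r s)) (sym (ι-det p q r s))) (trans (sym (ι-* n n)) (cong ι (±1-square n-unit))))
        (cong m11 stable) (cong m12 stable) (cong m21 stable) (cong m22 stable)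

    stab⇔ : ∀ {P : Mat → Set} → (∀ {α} → IsUnit α → P (μ α)) → (∀ M → P M → ∃[ α ] (IsUnit α × M ≡ μ α)) →
      ∀ M → Stab Q M ⇔ P M
    stab⇔ {P} f g M = mk⇔
      (λ stab → let α , unit , M≡ = stab⇒unit stab in subst P (sym M≡) (f unit))
      (λ p → let α , unit , M≡ = g M p in subst (Stab Q) (sym M≡) (unit⇒stab unit))

    module Words {g h : Elt} (g-unit : IsUnit g) (h-unit : IsUnit h)
      (spanned : ∀ {α} → IsUnit α → ∃[ v ] α ≡ word g h v) where

      isomorphism : ∀ {L} → (∀ v → word g h v ≡ one ⇔ L v) → IsoFromℤ²/ L (Stab Q)
      isomorphism {L} kernel = record
        { φ = λ v → μ (word g h v)
        ; into = λ v → unit⇒stab (unit-word g-unit h-unit v)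
        ; onto = λ M stab → let α , unit , M≡ = stab⇒unit stab
                                v , α≡ = spanned unit
                            in v , trans (cong μ (sym α≡)) (sym M≡)
        ; hom = λ { (i , j) (k , l) → trans (cong μ (word-+ g-unit h-unit i j k l)) (μ-∙ _ _) }
        ; ker = λ v w → mk⇔ (λ eq → Equivalence.to (kernel (v -² w)) (to v w (μ-injective eq)))
                            (λ l → cong μ (from v w (Equivalence.from (kernel (v -² w)) l)))
        }
        where
        cancel : ∀ i k → (i ℤ.- k) ℤ.+ k ≡ i
        cancel = solve-∀
        split : ∀ v w → word g h v ≡ word g h (v -² w) ∙ word g h w
        split (i , j) (k , l) = trans (sym (cong₂ (λ x y → word g h (x , y)) (cancel i k) (cancel j l)))
          (word-+ g-unit h-unit (i ℤ.- k) (j ℤ.- l) k l)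
        to : ∀ v w → word g h v ≡ word g h w → word g h (v -² w) ≡ one
        to v w eq = ∙-cancelʳ (unit-word g-unit h-unit w) _ _ (trans (sym (split v w)) (trans eq (sym (one-∙ _))))
        from : ∀ v w → word g h (v -² w) ≡ one → word g h v ≡ word g h w
        from v w eq = trans (split v w) (trans (cong (_∙ word g h w) eq) (one-∙ _))

      module _ {gs : List Mat} (gs⊆stab : ∀ {m} → m ∈ gs → Stab Q m) (g-gen : Gen gs (μ g)) (h-gen : Gen gs (μ h)) where

        gen-^ : ∀ {α} → Gen gs (μ α) → ∀ n → Gen gs (μ (α ^ n))
        gen-^ _ zero = subst (Gen gs) (sym μ-one) gen-one
        gen-^ {α} m (suc n) = subst (Gen gs) (sym (μ-∙ α (α ^ n))) (gen-mul m (gen-^ m n))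

        gen-inverse : ∀ {α} → IsUnit α → Gen gs (μ α) → Gen gs (μ (inv α))
        gen-inverse {α} unit m = gen-inv m
          (trans (sym (μ-∙ α (inv α))) (trans (cong μ (∙-inv unit)) μ-one))
          (trans (sym (μ-∙ (inv α) α)) (trans (cong μ (inv-∙ unit)) μ-one))

        gen-pow : ∀ {α} → IsUnit α → Gen gs (μ α) → ∀ i → Gen gs (μ (pow α i))
        gen-pow unit m (+ n) = gen-^ m n
        gen-pow unit m -[1+ n ] = gen-^ (gen-inverse unit m) (suc n)

        gen⇒unit : ∀ M → Gen gs M → ∃[ α ] (IsUnit α × M ≡ μ α)
        gen⇒unit .I gen-one = one , unit-one , sym μ-one
        gen⇒unit M (gen-gen m∈gs) = stab⇒unit (gs⊆stab m∈gs)
        gen⇒unit .(A · B) (gen-mul {A} {B} m n) =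
          let α , a , A≡ = gen⇒unit A m
              β , b , B≡ = gen⇒unit B n
          in α ∙ β , unit-∙ a b , trans (cong₂ _·_ A≡ B≡) (sym (μ-∙ α β))
        -- `Gen` admits any two-sided inverse B, which uniqueness of inverses identifies with
        -- `μ (inv α)`.
        gen⇒unit B (gen-inv {A} m AB≡I BA≡I) =
          let α , unit , A≡ = gen⇒unit A m
          in inv α , unit-inv unit , matrix-inverse-unique A B (μ (inv α)) BA≡I
               (trans (cong (_· μ (inv α)) A≡) (trans (sym (μ-∙ α (inv α))) (trans (cong μ (∙-inv unit)) μ-one)))
          where
          matrix-inverse-unique : ∀ A B C → B · A ≡ I → A · C ≡ I → B ≡ C
          matrix-inverse-unique A B C BA AC = trans (sym (·-I B)) (trans (cong (B ·_) (sym AC))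
            (trans (sym (·-assoc B A C)) (trans (cong (_· C) BA) (I-· C))))
            where
            row-I₁ : ∀ x y → x * 1ℚ + y * 0ℚ ≡ x
            row-I₁ = solve-∀-in ℚ-ring
            row-I₂ : ∀ x y → x * 0ℚ + y * 1ℚ ≡ y
            row-I₂ = solve-∀-in ℚ-ring
            col-I₁ : ∀ x y → 1ℚ * x + 0ℚ * y ≡ x
            col-I₁ = solve-∀-in ℚ-ring
            col-I₂ : ∀ x y → 0ℚ * x + 1ℚ * y ≡ y
            col-I₂ = solve-∀-in ℚ-ring
            assoc : ∀ x y p q r s z w → (x * p + y * r) * z + (x * q + y * s) * w ≡ x * (p * z + q * w) + y * (r * z + s * w)
            assoc = solve-∀-in ℚ-ring
            ·-I : ∀ M → M · I ≡ M
            ·-I (mat p q r s) = mat-≡ (row-I₁ p q) (row-I₂ p q) (row-I₁ r s) (row-I₂ r s)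
            I-· : ∀ M → I · M ≡ M
            I-· (mat p q r s) = mat-≡ (col-I₁ p r) (col-I₁ q s) (col-I₂ p r) (col-I₂ q s)
            ·-assoc : ∀ A B C → A · B · C ≡ A · (B · C)
            ·-assoc (mat x y z w) (mat p q r s) (mat k l m n) = mat-≡
              (assoc x y p q r s k m) (assoc x y p q r s l n) (assoc z w p q r s k m) (assoc z w p q r s l n)

        generated : ∀ M → Stab Q M ⇔ Gen gs M
        generated = stab⇔ (λ unit → let v , α≡ = spanned unit in subst (λ α → Gen gs (μ α)) (sym α≡) (gen-word v)) gen⇒unit
          where
          gen-word : ∀ v → Gen gs (μ (word g h v))
          gen-word (i , j) = subst (Gen gs) (sym (μ-∙ (pow g i) (pow h j))) (gen-mul (gen-pow g-unit g-gen i) (gen-pow h-unit h-gen j))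

  -- Membership in `F₊` in terms of the discriminant.

  -- For y = n/d in lowest terms, d divides n² and is coprime to n, so d = 1.
  rational-square : ∀ z y → ι z ≡ y * y → ∃[ k ] z ≡ k ℤ.* k
  rational-square z y@(mkℚ n d-1 coprime) eq = n , trans (sym (ℤP.*-identityʳ z)) (trans (cong (λ d → z ℤ.* + (d ℕ.* d)) (sym d≡1)) z*d²≡n²)
    where
    d = suc d-1
    cross : ℚ.toℚᵘ (ι z) ℚᵘ.≃ mkℚᵘ n d-1 ℚᵘ.* mkℚᵘ n d-1
    cross = ℚᵘP.≃-trans (ℚP.toℚᵘ-cong eq) (ℚP.toℚᵘ-homo-* y y)
    cross' : mkℚᵘ z 0 ℚᵘ.≃ mkℚᵘ n d-1 ℚᵘ.* mkℚᵘ n d-1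
    cross' = ℚᵘP.≃-trans (ℚᵘP.≃-sym (ℚP.toℚᵘ-fromℚᵘ (mkℚᵘ z 0))) cross
    z*d²≡n² : z ℤ.* + (d ℕ.* d) ≡ n ℤ.* n
    z*d²≡n² with *≡* e ← cross' = trans e (ℤP.*-identityʳ (n ℤ.* n))
    d∣n² : d ℕD.∣ ∣ n ∣ ℕ.* ∣ n ∣
    d∣n² = ℕD.divides (∣ z ∣ ℕ.* d) (trans (sym (ℤP.abs-* n n)) (trans (cong ∣_∣ (sym z*d²≡n²))
      (trans (ℤP.abs-* z (+ (d ℕ.* d))) (sym (ℕP.*-assoc ∣ z ∣ d d)))))
    coprime' : Coprime ∣ n ∣ d
    coprime' = recompute coprime
    d∣n : d ℕD.∣ ∣ n ∣
    d∣n = coprime-divisor (coprime-sym coprime') d∣n²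
    d≡1 : d ≡ 1
    d≡1 = coprime' (d∣n , ℕD.∣-refl)

  disc-square : ∀ p q r s → (p * s + q * r) * (p * s + q * r) - (1ℚ + 1ℚ + 1ℚ + 1ℚ) * (p * r) * (q * s) ≡ (p * s - q * r) * (p * s - q * r)
  disc-square = solve-∀-in ℚ-ring

  disc-Δ : ∀ Q → disc Q ≡ Order.Δ (b Q) (a Q ℤ.* c Q)
  disc-Δ (form a b c) = e a b c
    where
    e : ∀ a b c → b ℤ.* b ℤ.- + 4 ℤ.* a ℤ.* c ≡ b ℤ.* b ℤ.- + 4 ℤ.* (a ℤ.* c)
    e = solve-∀

  ι-disc : ∀ Q → ι (disc Q) ≡ ι (b Q) * ι (b Q) - (1ℚ + 1ℚ + 1ℚ + 1ℚ) * ι (a Q) * ι (c Q)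
  ι-disc (form a b c) = trans (ι-- (b ℤ.* b) (+ 4 ℤ.* a ℤ.* c))
    (cong₂ _-_ (ι-* b b) (trans (ι-* (+ 4 ℤ.* a) c) (cong (_* ι c) (ι-* (+ 4) a))))

  -- The discriminant of (px + qy)(rx + sy) is (ps - qr)².
  reducible⇒square : ∀ Q → ReducibleOverℚ Q → ∃[ k ] disc Q ≡ k ℤ.* k
  reducible⇒square Q (p , q , r , s , a≡ , b≡ , c≡) = rational-square (disc Q) (p * s - q * r)
    (trans (ι-disc Q) (trans (cong₂ _-_ (cong₂ _*_ b≡ b≡) (cong₂ (λ x y → (1ℚ + 1ℚ + 1ℚ + 1ℚ) * x * y) a≡ c≡)) (disc-square p q r s)))

  factor-b : ∀ A B K i → A * (½ * (B - K) * i) + ½ * (B + K) * 1ℚ ≡ ½ * (B - K) * (A * i) + ½ * (B + K)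
  factor-b = solve-∀-in ℚ-ring

  factor-b' : ∀ B K → ½ * (B - K) * 1ℚ + ½ * (B + K) ≡ B
  factor-b' = solve-∀-in ℚ-ring

  factor-c : ∀ B K i → ½ * (B + K) * (½ * (B - K) * i) ≡ ½ * ½ * (B * B - K * K) * i
  factor-c = solve-∀-in ℚ-ring

  factor-c' : ∀ A B C i → ½ * ½ * (B * B - (B * B - (1ℚ + 1ℚ + 1ℚ + 1ℚ) * A * C)) * i ≡ C * (A * i)
  factor-c' = solve-∀-in ℚ-ring

  0*+1* : ∀ x y → x ≡ 0ℚ * y + 1ℚ * x
  0*+1* = solve-∀-in ℚ-ring

  -- For a ≠ 0 the factors are ax + (b + k)/2 · y and x + (b - k)/(2a) · y, by the quadratic
  -- formula; for a = 0 the form is y(bx + cy).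
  square⇒reducible : ∀ Q k → disc Q ≡ k ℤ.* k → ReducibleOverℚ Q
  square⇒reducible Q@(form a b c) k Δ≡k² with ℤP._≟_ a (+ 0)
  ... | yes refl = 0ℚ , 1ℚ , ι b , ι c , sym (ℚP.*-zeroˡ (ι b)) , 0*+1* (ι b) (ι c) , sym (ℚP.*-identityˡ (ι c))
  ... | no a≢0 = ι a , ½ * (ι b + ι k) , 1ℚ , ½ * (ι b - ι k) * i ,
      sym (ℚP.*-identityʳ (ι a)) ,
      sym (trans (factor-b (ι a) (ι b) (ι k) i) (trans (cong (λ z → ½ * (ι b - ι k) * z + ½ * (ι b + ι k)) ai≡1) (factor-b' (ι b) (ι k)))) ,
      sym (trans (factor-c (ι b) (ι k) i) (trans (cong (λ z → ½ * ½ * (ι b * ι b - z) * i) k²≡)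
        (trans (factor-c' (ι a) (ι b) (ι c) i) (trans (cong (ι c *_) ai≡1) (ℚP.*-identityʳ (ι c))))))
    where
    instance
      ιa≢0 : ℚ.NonZero (ι a)
      ιa≢0 = ℚ.≢-nonZero λ eq → a≢0 (ι-injective eq)
    i = ℚ.1/ ι a
    ai≡1 : ι a * i ≡ 1ℚ
    ai≡1 = ℚP.*-inverseʳ (ι a)
    k²≡ : ι k * ι k ≡ ι b * ι b - (1ℚ + 1ℚ + 1ℚ + 1ℚ) * ι a * ι c
    k²≡ = trans (sym (ι-* k k)) (trans (cong ι (sym Δ≡k²)) (ι-disc Q))

  a≡0⇒disc : ∀ b c → b ℤ.* b ℤ.- + 4 ℤ.* + 0 ℤ.* c ≡ b ℤ.* b
  a≡0⇒disc = solve-∀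

  eval-10 : ∀ a b c → a ℤ.* + 1 ℤ.* + 1 ℤ.+ b ℤ.* + 1 ℤ.* + 0 ℤ.+ c ℤ.* + 0 ℤ.* + 0 ≡ a
  eval-10 = solve-∀

  eval-vertex : ∀ a b c → a ℤ.* (ℤ.- b) ℤ.* (ℤ.- b) ℤ.+ b ℤ.* (ℤ.- b) ℤ.* (+ 2 ℤ.* a) ℤ.+ c ℤ.* (+ 2 ℤ.* a) ℤ.* (+ 2 ℤ.* a) ≡
    ℤ.- (a ℤ.* (b ℤ.* b ℤ.- + 4 ℤ.* a ℤ.* c))
  eval-vertex = solve-∀

  complete-square : ∀ a b c x y → + 4 ℤ.* (a ℤ.* (a ℤ.* x ℤ.* x ℤ.+ b ℤ.* x ℤ.* y ℤ.+ c ℤ.* y ℤ.* y)) ≡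
    (+ 2 ℤ.* a ℤ.* x ℤ.+ b ℤ.* y) ℤ.* (+ 2 ℤ.* a ℤ.* x ℤ.+ b ℤ.* y) ℤ.+ ℤ.- (b ℤ.* b ℤ.- + 4 ℤ.* a ℤ.* c) ℤ.* (y ℤ.* y)
  complete-square = solve-∀

  nonsquare⇒a≢0 : ∀ Q → NonSquare (disc Q) → ¬ a Q ≡ + 0
  nonsquare⇒a≢0 (form .(+ 0) b c) nsq refl = nsq b (a≡0⇒disc b c)

  -- Q takes the values a at (1, 0) and -aΔ at (-b, 2a), which have opposite signs.
  nonsquare⇒F₊ : ∀ Q → + 0 ℤ.< disc Q → NonSquare (disc Q) → F₊ Q
  nonsquare⇒F₊ Q@(form a b c) 0<Δ nsq = indefinite (ℤP.<-cmp a (+ 0)) , λ red → let k , eq = reducible⇒square Q red in nsq k eq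
    where
    indefinite : _ → Indefinite Q
    indefinite (tri≈ _ a≡0 _) = ⊥-elim (nonsquare⇒a≢0 Q nsq a≡0)
    indefinite (tri> _ _ 0<a) =
      (+ 1 , + 0 , subst (+ 0 ℤ.<_) (sym (eval-10 a b c)) 0<a) ,
      (ℤ.- b , + 2 ℤ.* a , subst (ℤ._< + 0) (sym (eval-vertex a b c)) (ℤP.neg-mono-< (0<*0< 0<a 0<Δ)))
    indefinite (tri< a<0 _ _) =
      (ℤ.- b , + 2 ℤ.* a , subst (+ 0 ℤ.<_) (sym (trans (eval-vertex a b c) (ℤP.neg-distribˡ-* a (disc Q)))) (0<*0< (ℤP.neg-mono-< a<0) 0<Δ)) ,
      (+ 1 , + 0 , subst (ℤ._< + 0) (sym (eval-10 a b c)) a<0)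

  F₊⇒nonsquare : ∀ Q → F₊ Q → NonSquare (disc Q)
  F₊⇒nonsquare Q (_ , irr) k eq = irr (square⇒reducible Q k eq)

  -- 4aQ = (2ax + by)² - Δy², so Δ < 0 would make aQ nonnegative everywhere.
  F₊⇒disc>0 : ∀ Q → F₊ Q → + 0 ℤ.< disc Q
  F₊⇒disc>0 Q@(form a b c) F@(((x , y , 0<Q) , (z , w , Q<0)) , _) with ℤP.<-cmp (disc Q) (+ 0)
  ... | tri> _ _ 0<Δ = 0<Δ
  ... | tri≈ _ Δ≡0 _ = ⊥-elim (F₊⇒nonsquare Q F (+ 0) Δ≡0)
  ... | tri< Δ<0 _ _ = ⊥-elim (sign (ℤP.<-cmp a (+ 0)))
    where
    0≤aQ : ∀ x y → + 0 ℤ.≤ a ℤ.* eval Q x y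
    0≤aQ x y = 0≤i*j⇒0≤i (a ℤ.* eval Q x y) {+ 4} (+<+ (s≤s z≤n)) (subst (+ 0 ℤ.≤_)
      (trans (sym (complete-square a b c x y)) (ℤP.*-comm (+ 4) (a ℤ.* eval Q x y)))
      (0≤+0≤ (0≤square (+ 2 ℤ.* a ℤ.* x ℤ.+ b ℤ.* y)) (0≤*0≤ (ℤP.<⇒≤ (ℤP.neg-mono-< Δ<0)) (0≤square y))))
    sign : _ → ⊥
    sign (tri≈ _ a≡0 _) = nonsquare⇒a≢0 Q (F₊⇒nonsquare Q F) a≡0
    sign (tri> _ _ 0<a) = ℤP.<-irrefl refl (ℤP.≤-<-trans (0≤aQ z w)
      (subst (ℤ._< + 0) (trans (cong ℤ.-_ (sym (ℤP.neg-distribʳ-* a (eval Q z w)))) (ℤP.neg-involutive _)) (ℤP.neg-mono-< (0<*0< 0<a (ℤP.neg-mono-< Q<0)))))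
    sign (tri< a<0 _ _) = ℤP.<-irrefl refl (ℤP.≤-<-trans (0≤aQ x y)
      (subst (ℤ._< + 0) (trans (cong ℤ.-_ (sym (ℤP.neg-distribˡ-* a (eval Q x y)))) (ℤP.neg-involutive _)) (ℤP.neg-mono-< (0<*0< (ℤP.neg-mono-< a<0) 0<Q))))

  -- Identities for matrices t/2 I + u SQ and for the order 𝒪_f.

  combination-11 : ∀ τ ν H C A → τ * 1ℚ + ν * (0ℚ * A + - 1ℚ * H) ≡ τ - ν * H
  combination-11 = solve-∀-in ℚ-ring

  combination-12 : ∀ τ ν H C A → τ * 0ℚ + ν * (0ℚ * H + - 1ℚ * C) ≡ - (C * ν)
  combination-12 = solve-∀-in ℚ-ring

  combination-21 : ∀ τ ν H C A → τ * 0ℚ + ν * (1ℚ * A + 0ℚ * H) ≡ A * ν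
  combination-21 = solve-∀-in ℚ-ring

  combination-22 : ∀ τ ν H C A → τ * 1ℚ + ν * (1ℚ * H + 0ℚ * C) ≡ τ + ν * H
  combination-22 = solve-∀-in ℚ-ring

  half-trace : ∀ X U H → ½ * ((1ℚ + 1ℚ) * X + (H + H) * U) ≡ X + U * H
  half-trace = solve-∀-in ℚ-ring

  x+z-z : ∀ X Z → X ≡ X + Z - Z
  x+z-z = solve-∀-in ℚ-ring

  x+[h+h]u : ∀ X U H → X + (H + H) * U ≡ X + U * H + U * H
  x+[h+h]u = solve-∀-in ℚ-ring

  1⊛ : ∀ A → A ≡ 1ℚ ⊛ A
  1⊛ (mat p q r s) = mat-≡ (e p) (e q) (e r) (e s)
    where
    e : ∀ p → p ≡ 1ℚ * p
    e = solve-∀-in ℚ-ring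

  0I⊕ : ∀ A → A ≡ (0ℚ ⊛ I) ⊕ A
  0I⊕ (mat p q r s) = mat-≡ (e p) (f q) (f r) (e s)
    where
    e : ∀ p → p ≡ 0ℚ * 1ℚ + p
    e = solve-∀-in ℚ-ring
    f : ∀ p → p ≡ 0ℚ * 0ℚ + p
    f = solve-∀-in ℚ-ring

  -- By z² ≡ z (mod 2) and f² Δ₀ = b² − 4ac.
  conductor-parity : ∀ Q Δ₀ f → Conductor (disc Q) Δ₀ f → ∃[ δ ] + f ℤ.* Δ₀ ≡ b Q ℤ.+ + 2 ℤ.* δ
  conductor-parity Q@(form a b c) Δ₀ f eq =
    let w₁ , e₁ = square-parity (+ f)
        w₂ , e₂ = square-parity b
    in w₂ ℤ.- + 2 ℤ.* (a ℤ.* c) ℤ.- w₁ ℤ.* Δ₀ , (begin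
      + f ℤ.* Δ₀                                                     ≡⟨ p (+ f) Δ₀ w₁ ⟩
      (+ f ℤ.+ + 2 ℤ.* w₁) ℤ.* Δ₀ ℤ.- + 2 ℤ.* (w₁ ℤ.* Δ₀)            ≡⟨ cong (λ z → z ℤ.* Δ₀ ℤ.- + 2 ℤ.* (w₁ ℤ.* Δ₀)) (sym e₁) ⟩
      + f ℤ.* + f ℤ.* Δ₀ ℤ.- + 2 ℤ.* (w₁ ℤ.* Δ₀)                     ≡⟨ cong (ℤ._- + 2 ℤ.* (w₁ ℤ.* Δ₀)) (trans (cong (ℤ._* Δ₀) (sym (ℤP.pos-* f f))) eq) ⟩
      b ℤ.* b ℤ.- + 4 ℤ.* a ℤ.* c ℤ.- + 2 ℤ.* (w₁ ℤ.* Δ₀)            ≡⟨ cong (λ z → z ℤ.- + 4 ℤ.* a ℤ.* c ℤ.- + 2 ℤ.* (w₁ ℤ.* Δ₀)) e₂ ⟩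
      (b ℤ.+ + 2 ℤ.* w₂) ℤ.- + 4 ℤ.* a ℤ.* c ℤ.- + 2 ℤ.* (w₁ ℤ.* Δ₀) ≡⟨ q a b c w₁ w₂ Δ₀ ⟩
      b ℤ.+ + 2 ℤ.* (w₂ ℤ.- + 2 ℤ.* (a ℤ.* c) ℤ.- w₁ ℤ.* Δ₀) ∎)
    where
    open ≡-Reasoning
    p : ∀ f Δ₀ w₁ → f ℤ.* Δ₀ ≡ (f ℤ.+ + 2 ℤ.* w₁) ℤ.* Δ₀ ℤ.- + 2 ℤ.* (w₁ ℤ.* Δ₀)
    p = solve-∀
    q : ∀ a b c w₁ w₂ Δ₀ → (b ℤ.+ + 2 ℤ.* w₂) ℤ.- + 4 ℤ.* a ℤ.* c ℤ.- + 2 ℤ.* (w₁ ℤ.* Δ₀) ≡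
      b ℤ.+ + 2 ℤ.* (w₂ ℤ.- + 2 ℤ.* (a ℤ.* c) ℤ.- w₁ ℤ.* Δ₀)
    q = solve-∀

  -- The trace of m + n f(Δ₀ + √Δ₀)/2 is 2m + n f Δ₀. With fΔ₀ = b + 2δ it is also the trace of (m +
  -- nδ) + n w, the matching element of ℤ[w].
  order-trace : ∀ m n f Δ₀ b δ → f ℤ.* Δ₀ ≡ b ℤ.+ + 2 ℤ.* δ →
    + 2 ℤ.* (m ℤ.+ n ℤ.* δ) ℤ.+ b ℤ.* n ≡ + 2 ℤ.* m ℤ.+ n ℤ.* f ℤ.* Δ₀
  order-trace m n f Δ₀ b δ eq = trans (p m n b δ) (trans (cong (λ z → + 2 ℤ.* m ℤ.+ n ℤ.* z) (sym eq)) (q m n f Δ₀))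
    where
    p : ∀ m n b δ → + 2 ℤ.* (m ℤ.+ n ℤ.* δ) ℤ.+ b ℤ.* n ≡ + 2 ℤ.* m ℤ.+ n ℤ.* (b ℤ.+ + 2 ℤ.* δ)
    p = solve-∀
    q : ∀ m n f Δ₀ → + 2 ℤ.* m ℤ.+ n ℤ.* (f ℤ.* Δ₀) ≡ + 2 ℤ.* m ℤ.+ n ℤ.* f ℤ.* Δ₀
    q = solve-∀

  half-sum : ∀ M N → ½ * ((1ℚ + 1ℚ) * M + N) ≡ M + ½ * N
  half-sum = solve-∀-in ℚ-ring

  ½-cancel : ∀ {x y} → ½ * x ≡ ½ * y → x ≡ y
  ½-cancel {x} {y} eq = trans (sym (½+½ x)) (trans (cong₂ _+_ eq eq) (½+½ y))

  κ-re : ∀ t t' n n' F D → (½ * t) * (½ * t') + D * (½ * (n * F)) * (½ * (n' * F)) ≡ ½ * (½ * (t * t' + F * F * D * (n * n')))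
  κ-re = solve-∀-in ℚ-ring

  κ-ir : ∀ t t' n n' F → (½ * t) * (½ * (n' * F)) + (½ * (n * F)) * (½ * t') ≡ ½ * (½ * (t * n' + n * t') * F)
  κ-ir = solve-∀-in ℚ-ring

  ½*2 : ∀ x → ½ * ((1ℚ + 1ℚ) * x) ≡ x
  ½*2 = solve-∀-in ℚ-ring

  -- The three cases of the classification.

  module Classification (Q : Form) (prim : Primitive Q) where
    open Stabiliser Q prim
    open SmallDiscriminant (b Q) (a Q ℤ.* c Q)

    -- Putting w = (b/2) I + SQ turns the scalar part into half the trace. The named generators and
    -- the values of `χ` have this shape.
    μ-combination : ∀ {α t u} → TU α t u → μ α ≡ ((½ * ι t) ⊛ I) ⊕ (ι u ⊛ SQ Q)
    μ-combination {elt x u} (refl , refl) = trans (μ-parametrised x u) (mat-≡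
      (trans (x+z-z (ι x) (ι u * H)) (trans (cong (_- ι u * H) (sym τ≡)) (sym (combination-11 τ (ι u) H (ι (c Q)) (ι (a Q))))))
      (sym (combination-12 τ (ι u) H (ι (c Q)) (ι (a Q))))
      (sym (combination-21 τ (ι u) H (ι (c Q)) (ι (a Q))))
      (trans (x+[h+h]u (ι x) (ι u) H) (trans (cong (_+ ι u * H) (sym τ≡)) (sym (combination-22 τ (ι u) H (ι (c Q)) (ι (a Q)))))))
      where
      H = b Q / 2
      τ = ½ * ι (tr (elt x u))
      τ≡ : τ ≡ ι x + ι u * H
      τ≡ = trans (cong (λ t → ½ * ι t) (tr-def (elt x u))) (trans (cong (½ *_) (trans (ι-dot (+ 2) x (b Q) u)
        (cong (λ B → (1ℚ + 1ℚ) * ι x + B * ι u) (sym (/2+/2 (b Q)))))) (half-trace (ι x) (ι u) H))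

    Δ≡ : ∀ {δ} → disc Q ≡ δ → Δ ≡ δ
    Δ≡ eq = trans (sym (disc-Δ Q)) eq

    trivial-stabiliser : (∀ {α} → IsUnit α → im α ≡ + 0) → ∀ M → Stab Q M ⇔ (M ≡ I ⊎ M ≡ -I)
    trivial-stabiliser im0 = stab⇔ (λ unit → to (unit-im0 unit (im0 unit))) from
      where
      from : ∀ M → M ≡ I ⊎ M ≡ -I → ∃[ α ] (IsUnit α × M ≡ μ α)
      from M (inj₁ M≡I) = one , unit-one , trans M≡I (sym μ-one)
      from M (inj₂ M≡-I) = neg one , unit-neg-one , trans M≡-I (sym μ-neg-one)
      to : ∀ {α} → α ≡ one ⊎ α ≡ neg one → μ α ≡ I ⊎ μ α ≡ -I
      to (inj₁ refl) = inj₁ μ-one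
      to (inj₂ refl) = inj₂ μ-neg-one

    private
      4m≢ : ∀ m r → 0 ℕ.< r → r ℕ.< 4 → ¬ 4 ℕ.* m ≡ r
      4m≢ zero .0 () _ refl
      4m≢ (suc m) r _ r<4 eq = ℕP.<⇒≢ (ℕP.<-≤-trans r<4 (ℕP.m≤m*n 4 (suc m))) (sym eq)

      4x≢ : ∀ x r → 0 ℕ.< r → r ℕ.< 4 → ¬ + 4 ℤ.* x ≡ ℤ.- (+ r)
      4x≢ x r 0<r r<4 eq = 4m≢ ∣ x ∣ r 0<r r<4 (trans (sym (ℤP.abs-* (+ 4) x)) (trans (cong ∣_∣ eq) (ℤP.∣-i∣≡∣i∣ (+ r))))

    disc-mod-4 : ∃[ x ] (disc Q ≡ + 4 ℤ.* x ⊎ disc Q ≡ + 1 ℤ.+ + 4 ℤ.* x)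
    disc-mod-4 with parity (b Q)
    ... | q , inj₁ b≡ = q ℤ.* q ℤ.- a Q ℤ.* c Q , inj₁ (trans (cong (λ b → b ℤ.* b ℤ.- + 4 ℤ.* a Q ℤ.* c Q) b≡) (e (a Q) (c Q) q))
      where
      e : ∀ a c q → (q ℤ.* + 2) ℤ.* (q ℤ.* + 2) ℤ.- + 4 ℤ.* a ℤ.* c ≡ + 4 ℤ.* (q ℤ.* q ℤ.- a ℤ.* c)
      e = solve-∀
    ... | q , inj₂ b≡ = q ℤ.* q ℤ.+ q ℤ.- a Q ℤ.* c Q , inj₂ (trans (cong (λ b → b ℤ.* b ℤ.- + 4 ℤ.* a Q ℤ.* c Q) b≡) (e (a Q) (c Q) q))
      where
      e : ∀ a c q → (+ 1 ℤ.+ q ℤ.* + 2) ℤ.* (+ 1 ℤ.+ q ℤ.* + 2) ℤ.- + 4 ℤ.* a ℤ.* c ≡ + 1 ℤ.+ + 4 ℤ.* (q ℤ.* q ℤ.+ q ℤ.- a ℤ.* c)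
      e = solve-∀

    -- Δ is 0 or 1 modulo 4, which excludes -1 and -2.
    disc≢ : ∀ r → 0 ℕ.< r → r ℕ.< 3 → ¬ disc Q ≡ ℤ.- (+ r)
    disc≢ r 0<r r<3 eq with disc-mod-4
    ... | x , inj₁ e = 4x≢ x r 0<r (ℕP.m<n⇒m<1+n r<3) (trans (sym e) eq)
    ... | x , inj₂ e = 4x≢ x (suc r) (s≤s z≤n) (s≤s r<3) (trans (shift (+ 4 ℤ.* x)) (trans (cong (ℤ._- + 1) (trans (sym e) eq)) (shift' (+ r))))
      where
      shift : ∀ y → y ≡ (+ 1 ℤ.+ y) ℤ.- + 1
      shift = solve-∀
      shift' : ∀ r → ℤ.- r ℤ.- + 1 ≡ ℤ.- (+ 1 ℤ.+ r)
      shift' = solve-∀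

    -- A positive non-square Δ would put Q in `F₊`, so what remains is Δ ≤ -5 or Δ = k² with k ≥ 3.
    -- There t² - Δu² = ±4 forces u = 0.
    part₁ : ¬ F₊ Q → ¬ F₋ Q → ∀ M → Stab Q M ⇔ (M ≡ I ⊎ M ≡ -I)
    part₁ ¬F₊ ¬F₋ = trivial-stabiliser (λ {α} → im0 (disc Q) refl)
      where
      square : ∀ k → disc Q ≡ + k ℤ.* + k → ∀ {α} → IsUnit α → im α ≡ + 0
      square 0 eq = ⊥-elim (¬F₋ (inj₂ (inj₂ (inj₁ eq))))
      square 1 eq = ⊥-elim (¬F₋ (inj₂ (inj₂ (inj₂ (inj₁ eq)))))
      square 2 eq = ⊥-elim (¬F₋ (inj₂ (inj₂ (inj₂ (inj₂ eq)))))
      square k@(suc (suc (suc _))) eq = square-trivial k (s≤s (s≤s (s≤s z≤n))) (Δ≡ eq)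
      im0 : ∀ δ → disc Q ≡ δ → ∀ {α} → IsUnit α → im α ≡ + 0
      im0 -[1+ 0 ] eq = ⊥-elim (disc≢ 1 (s≤s z≤n) (s≤s (s≤s z≤n)) eq)
      im0 -[1+ 1 ] eq = ⊥-elim (disc≢ 2 (s≤s z≤n) (s≤s (s≤s (s≤s z≤n))) eq)
      im0 -[1+ 2 ] eq = ⊥-elim (¬F₋ (inj₂ (inj₁ eq)))
      im0 -[1+ 3 ] eq = ⊥-elim (¬F₋ (inj₁ eq))
      im0 -[1+ D@(suc (suc (suc (suc _)))) ] eq = negative-trivial (suc D) (s≤s (s≤s (s≤s (s≤s (s≤s z≤n))))) (Δ≡ eq)
      im0 (+ n) eq with isSquare? (+ n)
      ... | yes (k , k²≡) = square k (trans eq (sym k²≡))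
      ... | no none = ⊥-elim (¬F₊ (nonsquare⇒F₊ Q (positive n eq) nonsquare))
        where
        nonsquare : NonSquare (disc Q)
        nonsquare k e = none (∣ k ∣ , trans (sym (ℤP.pos-* ∣ k ∣ ∣ k ∣)) (trans (sym (square-abs k)) (trans (sym e) eq)))
        positive : ∀ n → disc Q ≡ + n → + 0 ℤ.< disc Q
        positive zero e = ⊥-elim (nonsquare (+ 0) e)
        positive (suc n) e = subst (+ 0 ℤ.<_) (sym e) (+<+ (s≤s z≤n))

    part₃ : (disc Q ≡ ℤ.- (+ 4) →
              (∀ M → Stab Q M ⇔ Gen (SQ Q ∷ []) M) × IsoFromℤ²/ (L-ℤ/n 4) (Stab Q))
           × (disc Q ≡ ℤ.- (+ 3) →
              (∀ M → Stab Q M ⇔ Gen (((½ ⊛ I) ⊕ SQ Q) ∷ []) M) × IsoFromℤ²/ (L-ℤ/n 6) (Stab Q))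
           × (disc Q ≡ + 0 →
              (∀ M → Stab Q M ⇔ Gen (-I ∷ (I ⊕ SQ Q) ∷ []) M) × IsoFromℤ²/ L-ℤ/2×ℤ (Stab Q))
           × (disc Q ≡ + 1 →
              (∀ M → Stab Q M ⇔ Gen (-I ∷ (((+ 2) / 1) ⊛ SQ Q) ∷ []) M) × IsoFromℤ²/ L-ℤ/2×ℤ/2 (Stab Q))
           × (disc Q ≡ + 4 →
              (∀ M → Stab Q M ⇔ Gen (-I ∷ SQ Q ∷ []) M) × IsoFromℤ²/ L-ℤ/2×ℤ/2 (Stab Q))
    part₃ = disc-4 , disc-3 , disc-0 , disc-1 , disc+4
      where
      one-generator : ∀ {g m} → IsUnit g → (∀ {α} → IsUnit α → ∃[ v ] α ≡ word g one v) → m ≡ μ g → ∀ M → Stab Q M ⇔ Gen (m ∷ []) M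
      one-generator {g} {m} unit spanned m≡ = Words.generated unit unit-one spanned
        (λ { (here refl) → subst (Stab Q) (sym m≡) (unit⇒stab unit) })
        (subst (Gen (m ∷ [])) m≡ (gen-gen (here refl)))
        (subst (Gen (m ∷ [])) (sym μ-one) gen-one)

      two-generators : ∀ {h m} → IsUnit h → (∀ {α} → IsUnit α → ∃[ v ] α ≡ word (neg one) h v) → m ≡ μ h → ∀ M → Stab Q M ⇔ Gen (-I ∷ m ∷ []) M
      two-generators {h} {m} unit spanned m≡ = Words.generated unit-neg-one unit spanned
        (λ { (here refl) → subst (Stab Q) μ-neg-one (unit⇒stab unit-neg-one)
           ; (there (here refl)) → subst (Stab Q) (sym m≡) (unit⇒stab unit) })
        (subst (Gen (-I ∷ m ∷ [])) (sym μ-neg-one) (gen-gen (here refl)))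
        (subst (Gen (-I ∷ m ∷ [])) m≡ (gen-gen (there (here refl))))

      b-residue : ∀ δ ρ → disc Q ≡ + 2 ℤ.* δ ℤ.+ ρ → ∃[ β ] b Q ≡ + 2 ℤ.* β ℤ.+ ρ
      b-residue δ ρ eq = let w , e = square-parity (b Q) in
        δ ℤ.+ + 2 ℤ.* (a Q ℤ.* c Q) ℤ.- w , half-residue (a Q ℤ.* c Q) (b Q) w δ ρ e (Δ≡ eq)

      -- With im 1 the trace 2x + b can be any integer of the parity of b, which is that of Δ = 2δ +
      -- ρ; τ selects the trace.
      element : ∀ δ ρ τ → disc Q ≡ + 2 ℤ.* δ ℤ.+ ρ → ∃[ α ] TU α (+ 2 ℤ.* τ ℤ.+ ρ) (+ 1)
      element δ ρ τ eq = let β , b≡ = b-residue δ ρ eq in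
        elt (τ ℤ.- β) (+ 1) , trans (tr-def _) (trans (cong (λ b → + 2 ℤ.* (τ ℤ.- β) ℤ.+ b ℤ.* + 1) b≡) (e β ρ τ)) , refl
        where
        e : ∀ β ρ τ → + 2 ℤ.* (τ ℤ.- β) ℤ.+ (+ 2 ℤ.* β ℤ.+ ρ) ℤ.* + 1 ≡ + 2 ℤ.* τ ℤ.+ ρ
        e = solve-∀

      -- This is √Δ = 2w - b, with matrix 2SQ.
      trace-double : TU (elt (ℤ.- b Q) (+ 2)) (+ 0) (+ 2)
      trace-double = trans (tr-def (elt (ℤ.- b Q) (+ 2))) (e (b Q)) , refl
        where
        e : ∀ b → + 2 ℤ.* ℤ.- b ℤ.+ b ℤ.* + 2 ≡ + 0
        e = solve-∀

      disc-4 : disc Q ≡ ℤ.- (+ 4) → (∀ M → Stab Q M ⇔ Gen (SQ Q ∷ []) M) × IsoFromℤ²/ (L-ℤ/n 4) (Stab Q)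
      disc-4 eq = one-generator unit spanned (trans (trans (1⊛ (SQ Q)) (0I⊕ (1ℚ ⊛ SQ Q))) (sym (μ-combination tu))) ,
                  Words.isomorphism unit unit-one spanned kernel
        where
        tu = proj₂ (element (ℤ.- (+ 2)) (+ 0) (+ 0) eq)
        open Disc-4 (Δ≡ eq) tu

      disc-3 : disc Q ≡ ℤ.- (+ 3) → (∀ M → Stab Q M ⇔ Gen (((½ ⊛ I) ⊕ SQ Q) ∷ []) M) × IsoFromℤ²/ (L-ℤ/n 6) (Stab Q)
      disc-3 eq = one-generator unit spanned (trans (cong ((½ ⊛ I) ⊕_) (1⊛ (SQ Q))) (sym (μ-combination tu))) ,
                  Words.isomorphism unit unit-one spanned kernel
        where
        -- -3 = 2 · (-2) + 1, and 2 · 0 + 1 = 1 is the trace of ½ I + SQ.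
        tu = proj₂ (element (ℤ.- (+ 2)) (+ 1) (+ 0) eq)
        open Disc-3 (Δ≡ eq) tu

      disc-0 : disc Q ≡ + 0 → (∀ M → Stab Q M ⇔ Gen (-I ∷ (I ⊕ SQ Q) ∷ []) M) × IsoFromℤ²/ L-ℤ/2×ℤ (Stab Q)
      disc-0 eq = two-generators unit spanned (trans (cong (I ⊕_) (1⊛ (SQ Q))) (sym (μ-combination tu))) ,
                  Words.isomorphism unit-neg-one unit spanned kernel
        where
        tu = proj₂ (element (+ 0) (+ 0) (+ 1) eq)
        open Disc-0 (Δ≡ eq) tu

      disc-1 : disc Q ≡ + 1 → (∀ M → Stab Q M ⇔ Gen (-I ∷ (((+ 2) / 1) ⊛ SQ Q) ∷ []) M) × IsoFromℤ²/ L-ℤ/2×ℤ/2 (Stab Q)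
      disc-1 eq = two-generators unit spanned (trans (0I⊕ (((+ 2) / 1) ⊛ SQ Q)) (sym (μ-combination trace-double))) ,
                  Words.isomorphism unit-neg-one unit spanned kernel
        where open Disc-1 (Δ≡ eq) trace-double

      disc+4 : disc Q ≡ + 4 → (∀ M → Stab Q M ⇔ Gen (-I ∷ SQ Q ∷ []) M) × IsoFromℤ²/ L-ℤ/2×ℤ/2 (Stab Q)
      disc+4 eq = two-generators unit spanned (trans (trans (1⊛ (SQ Q)) (0I⊕ (1ℚ ⊛ SQ Q))) (sym (μ-combination tu))) ,
                  Words.isomorphism unit-neg-one unit spanned kernel
        where
        tu = proj₂ (element (+ 2) (+ 0) (+ 0) eq)
        open Disc+4 (Δ≡ eq) tu

    module Conductor-Order (Δ₀ : ℤ) (f : ℕ) .{{_ : ℕ.NonZero f}} (conductor : Conductor (disc Q) Δ₀ f) where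

      -- The number (t + u√Δ)/2, where √Δ = f√Δ₀.
      κ : Elt → K
      κ α = (½ * ι (tr α)) +√ ((im α ℤ.* + f) / 2)

      K-≡ : ∀ {x x' y y'} → x ≡ x' → y ≡ y' → (x +√ y) ≡ (x' +√ y')
      K-≡ refl refl = refl

      ir-κ : ∀ α → ir (κ α) ≡ ½ * (ι (im α) * ι (+ f))
      ir-κ α = trans (/2≡½* (im α ℤ.* + f)) (cong (½ *_) (ι-* (im α) (+ f)))

      χ-κ : ∀ α → χ Q f (κ α) ≡ μ α
      χ-κ α = trans (cong (λ ν → ((½ * ι (tr α)) ⊛ I) ⊕ (ν ⊛ SQ Q)) (2/f*nf/2 (im α) f)) (sym (μ-combination {α} (refl , refl)))

      ιΔ≡ : ι Δ ≡ ι (+ f) * ι (+ f) * ι Δ₀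
      ιΔ≡ = trans (cong ι (trans (sym (disc-Δ Q)) (trans (sym conductor) (cong (ℤ._* Δ₀) (ℤP.pos-* f f)))))
        (trans (ι-* (+ f ℤ.* + f) Δ₀) (cong (_* ι Δ₀) (ι-* (+ f) (+ f))))

      κ-∙ : ∀ α β → mulK Δ₀ (κ α) (κ β) ≡ κ (α ∙ β)
      κ-∙ α β = K-≡
        (trans (cong₂ (λ y z → (½ * t) * (½ * t') + ι Δ₀ * y * z) (ir-κ α) (ir-κ β)) (trans (κ-re t t' n n' F (ι Δ₀))
          (cong (½ *_) (trans (cong (½ *_) (sym re≡)) (½*2 (ι (tr (α ∙ β))))))))
        (trans (cong₂ (λ y z → (½ * t) * z + y * (½ * t')) (ir-κ α) (ir-κ β)) (trans (κ-ir t t' n n' F)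
          (trans (cong (½ *_) (cong (_* F) (trans (cong (½ *_) (sym im≡)) (½*2 (ι (im (α ∙ β))))))) (sym (ir-κ (α ∙ β))))))
        where
        t = ι (tr α)
        t' = ι (tr β)
        n = ι (im α)
        n' = ι (im β)
        F = ι (+ f)
        re≡ : (1ℚ + 1ℚ) * ι (tr (α ∙ β)) ≡ t * t' + F * F * ι Δ₀ * (n * n')
        re≡ = trans (sym (ι-* (+ 2) (tr (α ∙ β)))) (trans (cong ι (tr-∙ α β)) (trans (ι-dot (tr α) (tr β) Δ (im α ℤ.* im β))
          (cong (λ z → t * t' + z) (cong₂ _*_ ιΔ≡ (ι-* (im α) (im β))))))
        im≡ : (1ℚ + 1ℚ) * ι (im (α ∙ β)) ≡ t * n' + n * t'
        im≡ = trans (sym (ι-* (+ 2) (im (α ∙ β)))) (trans (cong ι (im-∙ α β)) (ι-dot (tr α) (im β) (im α) (tr β)))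

      κ-one : κ one ≡ oneK
      κ-one = cong (λ t → (½ * ι t) +√ 0ℚ) (proj₁ TU-one)

      κ-injective : ∀ {α β} → κ α ≡ κ β → α ≡ β
      κ-injective {α} {β} eq = tr-im-injective (ι-injective (½-cancel (cong K.re eq))) (cancel-f (ι-injective (½-cancel
        (trans (sym (/2≡½* (im α ℤ.* + f))) (trans (cong ir eq) (/2≡½* (im β ℤ.* + f)))))))
        where
        cancel-f : ∀ {i j} → i ℤ.* + f ≡ j ℤ.* + f → i ≡ j
        cancel-f {i} {j} = ℤP.*-cancelʳ-≡ i j (+ f)

      order-re : ∀ m n → (½ * ι (+ 2 ℤ.* m ℤ.+ n ℤ.* + f ℤ.* Δ₀)) ≡ (m / 1) + (n ℤ.* + f ℤ.* Δ₀) / 2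
      order-re m n = trans (cong (½ *_) (trans (ι-+ (+ 2 ℤ.* m) (n ℤ.* + f ℤ.* Δ₀)) (cong (_+ ι (n ℤ.* + f ℤ.* Δ₀)) (ι-* (+ 2) m))))
        (trans (half-sum (ι m) (ι (n ℤ.* + f ℤ.* Δ₀))) (cong (λ z → ι m + z) (sym (/2≡½* (n ℤ.* + f ℤ.* Δ₀)))))

      order-κ : ∀ {u} → InOrder Δ₀ f u → ∃[ α ] u ≡ κ α
      order-κ (m , n , u≡) =
        let δ , e = conductor-parity Q Δ₀ f conductor
            α = elt (m ℤ.+ n ℤ.* δ) n
        in α , trans u≡ (K-≡ (sym (trans (cong (λ t → ½ * ι t) (trans (tr-def α) (order-trace m n (+ f) Δ₀ (b Q) δ e))) (order-re m n))) refl)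

      κ-order : ∀ α → InOrder Δ₀ f (κ α)
      κ-order α@(elt x n) =
        let δ , e = conductor-parity Q Δ₀ f conductor
            m = x ℤ.- n ℤ.* δ
        in m , n , K-≡ (trans (cong (λ t → ½ * ι t) (trans (tr-def α) (trans (cong (λ y → + 2 ℤ.* y ℤ.+ b Q ℤ.* n) (back x (n ℤ.* δ)))
             (order-trace m n (+ f) Δ₀ (b Q) δ e)))) (order-re m n)) refl
        where
        back : ∀ x y → x ≡ (x ℤ.- y) ℤ.+ y
        back = solve-∀

      -- `κ` identifies ℤ[w] with 𝒪_f and carries `μ` to `χ`, so an inverse in 𝒪_f pulls back to an
      -- inverse in ℤ[w].
      units : ∀ M → Stab Q M ⇔ (∃[ u ] (Unit Δ₀ f u × M ≡ χ Q f u))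
      units = stab⇔
        (λ {α} unit → κ α , (κ-order α , κ (inv α) , κ-order (inv α) ,
           trans (κ-∙ α (inv α)) (trans (cong κ (∙-inv unit)) κ-one)) , sym (χ-κ α))
        (λ { M (u , (u∈𝒪 , v , v∈𝒪 , uv≡1) , M≡) →
           let α , u≡ = order-κ u∈𝒪
               β , v≡ = order-κ v∈𝒪
           in α , inverse⇒unit α β (κ-injective (trans (sym (κ-∙ α β)) (trans (cong₂ (mulK Δ₀) (sym u≡) (sym v≡)) (trans uv≡1 (sym κ-one))))) ,
              trans M≡ (trans (cong (χ Q f) u≡) (χ-κ α)) })

    F₊-isomorphism : F₊ Q → IsoFromℤ²/ L-ℤ/2×ℤ (Stab Q)
    F₊-isomorphism F = Words.isomorphism unit-neg-one (IsFundamental.unit fund) (span fund) (kernel-ℤ/2×ℤ (IsFundamental.unit fund) (free fund))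
      where
      nsq : NonSquare Δ
      nsq = subst NonSquare (disc-Δ Q) (F₊⇒nonsquare Q F)
      0<Δ' : + 0 ℤ.< Δ
      0<Δ' = subst (+ 0 ℤ.<_) (disc-Δ Q) (F₊⇒disc>0 Q F)
      -- Δ = 1 is a square. The bound 2 enters the trace estimate of the descent and the growth of t
      -- + 2u.
      2≤Δ : + 2 ℤ.≤ Δ
      2≤Δ = ℤP.i<j⇒suc[i]≤j (ℤP.≤∧≢⇒< (0<⇒1≤ 0<Δ') (λ 1≡Δ → nsq (+ 1) (sym 1≡Δ)))
      open Fundamental (b Q) (a Q ℤ.* c Q) 2≤Δ nsq using (fundamental; module IsFundamental)
      open Generation (b Q) (a Q ℤ.* c Q) 2≤Δ nsq using (span; free)
      fund = proj₂ fundamental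

theorem4p43 : (Q : Form) → Primitive Q →
    (¬ F₊ Q → ¬ F₋ Q → ∀ M → Stab Q M ⇔ (M ≡ I ⊎ M ≡ -I))
    × (F₊ Q → (D Δ₀ : ℤ) (f : ℕ) .{{_ : NonZero f}} →
    SquareFreePart (disc Q) D → FundDisc D Δ₀ → Conductor (disc Q) Δ₀ f →
    (∀ M → Stab Q M ⇔ (∃[ u ] (Unit Δ₀ f u × M ≡ χ Q f u)))
    × IsoFromℤ²/ L-ℤ/2×ℤ (Stab Q))
    × (F₋ Q →
    (disc Q ≡ ℤ.- (+ 4) →
    (∀ M → Stab Q M ⇔ Gen (SQ Q ∷ []) M) × IsoFromℤ²/ (L-ℤ/n 4) (Stab Q))
    × (disc Q ≡ ℤ.- (+ 3) →
    (∀ M → Stab Q M ⇔ Gen (((½ ⊛ I) ⊕ SQ Q) ∷ []) M) × IsoFromℤ²/ (L-ℤ/n 6) (Stab Q))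
    × (disc Q ≡ + 0 →
    (∀ M → Stab Q M ⇔ Gen (-I ∷ (I ⊕ SQ Q) ∷ []) M) × IsoFromℤ²/ L-ℤ/2×ℤ (Stab Q))
    × (disc Q ≡ + 1 →
    (∀ M → Stab Q M ⇔ Gen (-I ∷ (((+ 2) / 1) ⊛ SQ Q) ∷ []) M) × IsoFromℤ²/ L-ℤ/2×ℤ/2 (Stab Q))
    × (disc Q ≡ + 4 →
    (∀ M → Stab Q M ⇔ Gen (-I ∷ SQ Q ∷ []) M) × IsoFromℤ²/ L-ℤ/2×ℤ/2 (Stab Q)))
theorem4p43 Q prim =
  part₁ ,
  (λ F D Δ₀ f _ _ conductor → Conductor-Order.units Δ₀ f conductor , F₊-isomorphism F) ,
  (λ _ → part₃)
  where open Stabilisers.Classification Q prim
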